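{- Let $\mathbb{F}$ be $\mathbb{R}$ or $\mathbb{C}$, and let $\mathbb{F}(\epsilon)$ be the field of rational functions in an indeterminate $\epsilon$. Let $A_0, A_1, \ldots, A_n \in \mathbb{F}(\epsilon)^{r\times r}$ be such that $\operatorname{rank}(A_i) = 1$ over $\mathbb{F}(\epsilon)$ for each $1\le i\le n$. Suppose that $f = \lim_{\epsilon\to 0}\det\left(A_0 + \sum_{i=1}^n A_i x_i\right)$ is defined. Then there exist $B_0, B_1, \ldots, B_n \in \mathbb{F}^{(n+r)\times(n+r)}$ such that $f = \det\left(B_0 + \sum_{i=1}^n B_i x_i\right)$ and $\operatorname{rank}(B_i) = 1$ over $\mathbb{F}$ for each $i\in[n]$. Moreover, if $A_0 = 0$, then the matrices $B_1, \ldots, B_n$ can be taken in $\mathbb{F}^{r\times r}$ (so that $f=\det(\sum_{i=1}^n B_i x_i)$ with each $B_i$ of rank one).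
   Context: $x_1,\ldots,x_n$ are indeterminates. For a nonzero polynomial $p\in\mathbb{F}[\epsilon]$, $\mathrm{mindeg}(p)$ is the least degree of a term of $p$; for $0\neq g/h\in\mathbb{F}(\epsilon)$ define $\mathrm{val}(g/h)=\mathrm{mindeg}(g)-\mathrm{mindeg}(h)$, and $\mathrm{val}(0)=+\infty$. For $c\in\mathbb{F}(\epsilon)$, $\lim_{\epsilon\to0}c$ exists iff $\mathrm{val}(c)\ge 0$. For a polynomial $P\in\mathbb{F}(\epsilon)[x_1,\ldots,x_n]$, $\lim_{\epsilon\to 0}P$ is said to be defined (to exist) if the limit at $\epsilon=0$ exists for the coefficient of every monomial of $P$; it is then the polynomial in $\mathbb{F}[x_1,\ldots,x_n]$ obtained by taking these limits coefficientwise.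
   Formalization: In the "Moreover" clause the B_i have rank at most one, not exactly one: for r=n=1, A_0=0, A_1=(ε) one has f=0, which no rank-one 1×1 matrix B_1 gives. For every x_i occurring in f the rank of B_i is then exactly one. -}

module Defs where

open import Level as L using (_⊔_)
open import Algebra.Bundles using (AbelianGroup; CommutativeRing)
open import Algebra.Bundles.Raw using (RawRing)
open import Data.Empty using (⊥-elim)
open import Data.Fin.Base using (Fin; zero; suc; toℕ)
open import Data.Integer.Base as ℤ using (ℤ; _⊖_; 0ℤ)
open import Data.List.Base as List using (List; []; _∷_)
open import Data.Nat.Base as ℕ using (ℕ; zero; suc)
open import Data.Product.Base using (∃; ∃-syntax; _×_; _,_; proj₁; proj₂)
open import Data.Sum.Base using (inj₁; inj₂)
open import Data.Vec.Functional using (Vector; head; tail; removeAt; transpose)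
open import Relation.Binary.Bundles using (Setoid)
open import Relation.Binary.Core using (Rel)
open import Relation.Binary.Definitions using (Decidable)
open import Relation.Binary.Structures using (IsDecTotalOrder)
open import Relation.Nullary using (¬_; Dec; yes; no; _×-dec_)
open import Relation.Nullary.Construct.Add.Supremum using (_⁺; ⊤⁺; [_])
open import Relation.Unary using (Pred)
import Algebra.Consequences.Setoid as Consequences
import Algebra.Construct.DirectProduct as DirectProduct
import Algebra.Definitions.RawMonoid as RawMonoidDefinitions
import Algebra.Definitions.RawSemiring as RawSemiringDefinitions
import Algebra.Properties.Ring as RingProperties
import Relation.Binary.Construct.Add.Supremum.NonStrict as Supremum
import Relation.Binary.Reasoning.Setoid as SetoidReasoning
import Algebra.Solver.Ring.NaturalCoefficients.Default as Solver

------------------------------------------------------------------------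
-- Fields

record Field c ℓ : Set (L.suc (c ⊔ ℓ)) where
  field
    commutativeRing : CommutativeRing c ℓ
  open CommutativeRing commutativeRing public
  field
    _≟_     : Decidable _≈_
    1≉0     : ¬ (1# ≈ 0#)
    inverse : ∀ x → ¬ (x ≈ 0#) → ∃[ y ] x * y ≈ 1#

  infix 8 _⁻¹[_]
  _⁻¹[_] : ∀ x → ¬ (x ≈ 0#) → Carrier
  x ⁻¹[ x≉0 ] = proj₁ (inverse x x≉0)

  xy≈0⇒y≈0 : ∀ {x y} → ¬ (x ≈ 0#) → x * y ≈ 0# → y ≈ 0#
  xy≈0⇒y≈0 {x} {y} x≉0 xy≈0 = let (z , xz≈1) = inverse x x≉0 in begin
    y            ≈⟨ *-identityˡ y ⟨
    1# * y       ≈⟨ *-congʳ (trans (*-comm z x) xz≈1) ⟨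
    (z * x) * y  ≈⟨ *-assoc z x y ⟩
    z * (x * y)  ≈⟨ *-congˡ xy≈0 ⟩
    z * 0#       ≈⟨ zeroʳ z ⟩
    0#           ∎
    where open SetoidReasoning setoid

-- The real numbers, given by the axioms of a Dedekind-complete ordered field,
-- which determine them up to isomorphism.  The order is decidable, as it is for
-- the classical reals.

record RealNumbers c ℓ₁ ℓ₂ : Set (L.suc (c ⊔ ℓ₁ ⊔ ℓ₂)) where
  infix 4 _≤_
  field
    commutativeRing : CommutativeRing c ℓ₁
  open CommutativeRing commutativeRing public
  field
    _≤_             : Rel Carrier ℓ₂
    isDecTotalOrder : IsDecTotalOrder _≈_ _≤_
    1≉0             : ¬ (1# ≈ 0#)
    inverse         : ∀ x → ¬ (x ≈ 0#) → ∃[ y ] x * y ≈ 1#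
    +-monoˡ-≤       : ∀ {x y} z → x ≤ y → x + z ≤ y + z
    *-nonNegative   : ∀ {x y} → 0# ≤ x → 0# ≤ y → 0# ≤ x * y

  UpperBound : ∀ {p} → Pred Carrier p → Pred Carrier (c ⊔ ℓ₂ ⊔ p)
  UpperBound P b = ∀ x → P x → x ≤ b

  field
    complete : (P : Pred Carrier (c ⊔ ℓ₁ ⊔ ℓ₂)) → ∃ P → ∃ (UpperBound P) →
               ∃[ s ] UpperBound P s × (∀ b → UpperBound P b → s ≤ b)

  open IsDecTotalOrder isDecTotalOrder public
    using (_≟_; total; antisym; ≤-respʳ-≈; ≤-respˡ-≈)

module FieldsOf {c ℓ₁ ℓ₂} (ℝ : RealNumbers c ℓ₁ ℓ₂) where
  open RealNumbers ℝ

  realField : Field c ℓ₁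
  realField = record
    { commutativeRing = commutativeRing
    ; _≟_             = _≟_
    ; 1≉0             = 1≉0
    ; inverse         = inverse
    }

  open RingProperties ring using
    (-‿distribˡ-*; -‿distribʳ-*; -‿involutive; -1*x≈-x)

  -x*-x≈x*x : ∀ x → - x * - x ≈ x * x
  -x*-x≈x*x x = trans (sym (-‿distribˡ-* x (- x)))
    (trans (-‿cong (sym (-‿distribʳ-* x x))) (-‿involutive (x * x)))

  x²-nonNegative : ∀ x → 0# ≤ x * x
  x²-nonNegative x with total 0# x
  ... | inj₁ 0≤x = *-nonNegative 0≤x 0≤x
  ... | inj₂ x≤0 = ≤-respʳ-≈ (-x*-x≈x*x x) (*-nonNegative 0≤-x 0≤-x)
    where
    0≤-x : 0# ≤ - x
    0≤-x = ≤-respˡ-≈ (-‿inverseʳ x)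
             (≤-respʳ-≈ (+-identityˡ (- x)) (+-monoˡ-≤ (- x) x≤0))

  x²+y²≈0⇒x≈0 : ∀ x y → x * x + y * y ≈ 0# → x ≈ 0#
  x²+y²≈0⇒x≈0 x y eq with x ≟ 0#
  ... | yes x≈0 = x≈0
  ... | no  x≉0 = Field.xy≈0⇒y≈0 realField x≉0
    (antisym
      (≤-respˡ-≈ (+-identityˡ (x * x))
        (≤-respʳ-≈ (trans (+-comm (y * y) (x * x)) eq)
          (+-monoˡ-≤ (x * x) (x²-nonNegative y))))
      (x²-nonNegative x))

  ℂ : Set c
  ℂ = Carrier × Carrier

  infix  4 _≈ᶜ_
  infixl 6 _+ᶜ_
  infixl 7 _*ᶜ_
  infix  8 -ᶜ_

  _≈ᶜ_ : Rel ℂ ℓ₁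
  (a , b) ≈ᶜ (a′ , b′) = a ≈ a′ × b ≈ b′

  i² : Carrier
  i² = - 1#

  _+ᶜ_ _*ᶜ_ : ℂ → ℂ → ℂ
  (a , b) +ᶜ (a′ , b′) = a + a′ , b + b′
  (a , b) *ᶜ (a′ , b′) = a * a′ + i² * (b * b′) , a * b′ + b * a′

  -ᶜ_ : ℂ → ℂ
  -ᶜ (a , b) = - a , - b

  0ᶜ 1ᶜ : ℂ
  0ᶜ = 0# , 0#
  1ᶜ = 1# , 0#

  private
    open Solver commutativeSemiring using (solve; _:=_; _:+_; _:*_; con)

    *ᶜ-cong : ∀ {x y u v} → x ≈ᶜ y → u ≈ᶜ v → x *ᶜ u ≈ᶜ y *ᶜ v
    *ᶜ-cong (p , q) (r , s) =
        +-cong (*-cong p r) (*-congˡ (*-cong q s))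
      , +-cong (*-cong p s) (*-cong q r)

    *ᶜ-comm : ∀ x y → x *ᶜ y ≈ᶜ y *ᶜ x
    *ᶜ-comm (a , b) (c , d) =
        +-cong (*-comm a c) (*-congˡ (*-comm b d))
      , trans (+-cong (*-comm a d) (*-comm b c)) (+-comm (d * a) (c * b))

    *ᶜ-assoc : ∀ x y z → (x *ᶜ y) *ᶜ z ≈ᶜ x *ᶜ (y *ᶜ z)
    *ᶜ-assoc (a , b) (c , d) (e , f) =
        solve 7 (λ a b c d e f m →
          (a :* c :+ m :* (b :* d)) :* e :+ m :* ((a :* d :+ b :* c) :* f) :=
          a :* (c :* e :+ m :* (d :* f)) :+ m :* (b :* (c :* f :+ d :* e)))
          refl a b c d e f i²
      , solve 7 (λ a b c d e f m →
          (a :* c :+ m :* (b :* d)) :* f :+ (a :* d :+ b :* c) :* e :=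
          a :* (c :* f :+ d :* e) :+ b :* (c :* e :+ m :* (d :* f)))
          refl a b c d e f i²

    *ᶜ-identityˡ : ∀ x → 1ᶜ *ᶜ x ≈ᶜ x
    *ᶜ-identityˡ (a , b) =
        solve 3 (λ a b m → con 1 :* a :+ m :* (con 0 :* b) := a) refl a b i²
      , solve 2 (λ a b → con 1 :* b :+ con 0 :* a := b) refl a b

    *ᶜ-distribˡ : ∀ x y z → x *ᶜ (y +ᶜ z) ≈ᶜ x *ᶜ y +ᶜ x *ᶜ z
    *ᶜ-distribˡ (a , b) (c , d) (e , f) =
        solve 7 (λ a b c d e f m →
          a :* (c :+ e) :+ m :* (b :* (d :+ f)) :=
          (a :* c :+ m :* (b :* d)) :+ (a :* e :+ m :* (b :* f)))
          refl a b c d e f i²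
      , solve 6 (λ a b c d e f →
          a :* (d :+ f) :+ b :* (c :+ e) :=
          (a :* d :+ b :* c) :+ (a :* f :+ b :* e))
          refl a b c d e f

  complexRing : CommutativeRing c ℓ₁
  complexRing = record
    { Carrier = ℂ ; _≈_ = _≈ᶜ_ ; _+_ = _+ᶜ_ ; _*_ = _*ᶜ_
    ; -_ = -ᶜ_ ; 0# = 0ᶜ ; 1# = 1ᶜ
    ; isCommutativeRing = record
      { isRing = record
        { +-isAbelianGroup = AbelianGroup.isAbelianGroup
            (DirectProduct.abelianGroup +-abelianGroup +-abelianGroup)
        ; *-cong     = *ᶜ-cong
        ; *-assoc    = *ᶜ-assoc
        ; *-identity = comm∧idˡ⇒id *ᶜ-comm *ᶜ-identityˡ
        ; distrib    = comm∧distrˡ⇒distr +ᶜ-cong *ᶜ-comm *ᶜ-distribˡ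
        }
      ; *-comm = *ᶜ-comm
      }
    }
    where
    ℂ-setoid : Setoid c ℓ₁
    ℂ-setoid = AbelianGroup.setoid
      (DirectProduct.abelianGroup +-abelianGroup +-abelianGroup)
    open Consequences ℂ-setoid using (comm∧idˡ⇒id; comm∧distrˡ⇒distr)
    +ᶜ-cong : ∀ {x y u v} → x ≈ᶜ y → u ≈ᶜ v → x +ᶜ u ≈ᶜ y +ᶜ v
    +ᶜ-cong (p , q) (r , s) = +-cong p r , +-cong q s

  complexField : Field c ℓ₁
  complexField = record
    { commutativeRing = complexRing
    ; _≟_             = λ (a , b) (c , d) → (a ≟ c) ×-dec (b ≟ d)
    ; 1≉0             = λ (1≈0 , _) → 1≉0 1≈0
    ; inverse         = inverseᶜ
    }
    where
    open SetoidReasoning setoid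
    inverseᶜ : ∀ x → ¬ (x ≈ᶜ 0ᶜ) → ∃[ y ] x *ᶜ y ≈ᶜ 1ᶜ
    inverseᶜ (a , b) x≉0 = (a * n , - b * n) , (begin
        a * (a * n) + i² * (b * (- b * n))  ≈⟨ +-congˡ step ⟩
        a * (a * n) + b * (b * n)           ≈⟨ solve 3 (λ a b n →
          a :* (a :* n) :+ b :* (b :* n) := (a :* a :+ b :* b) :* n)
          refl a b n ⟩
        (a * a + b * b) * n                 ≈⟨ proj₂ N⁻¹ ⟩
        1#                                  ∎) , (begin
        a * (- b * n) + b * (a * n)         ≈⟨ solve 4 (λ a b -b n →
          a :* (-b :* n) :+ b :* (a :* n) := (-b :+ b) :* (a :* n))
          refl a b (- b) n ⟩
        (- b + b) * (a * n)                 ≈⟨ *-congʳ (-‿inverseˡ b) ⟩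
        0# * (a * n)                        ≈⟨ zeroˡ (a * n) ⟩
        0#                                  ∎)
      where
      N≉0 : ¬ (a * a + b * b ≈ 0#)
      N≉0 N≈0 = x≉0
        ( x²+y²≈0⇒x≈0 a b N≈0
        , x²+y²≈0⇒x≈0 b a (trans (+-comm (b * b) (a * a)) N≈0))
      N⁻¹ = inverse (a * a + b * b) N≉0
      n = proj₁ N⁻¹
      step : i² * (b * (- b * n)) ≈ b * (b * n)
      step = begin
        i² * (b * (- b * n))  ≈⟨ solve 4 (λ m b -b n →
          m :* (b :* (-b :* n)) := b :* ((m :* -b) :* n)) refl i² b (- b) n ⟩
        b * ((i² * - b) * n)  ≈⟨ *-congˡ (*-congʳ (-1*x≈-x (- b))) ⟩
        b * (- (- b) * n)     ≈⟨ *-congˡ (*-congʳ (-‿involutive b)) ⟩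
        b * (b * n)           ∎

data ℝ-or-ℂ : Set where
  real complex : ℝ-or-ℂ

scalars : ∀ {c ℓ₁ ℓ₂} → RealNumbers c ℓ₁ ℓ₂ → ℝ-or-ℂ → Field c ℓ₁
scalars ℝ real    = FieldsOf.realField ℝ
scalars ℝ complex = FieldsOf.complexField ℝ

------------------------------------------------------------------------
-- Polynomials

-- Univariate polynomials as lists of coefficients, constant term first; lists
-- differing by trailing zeros are equal.

module Polynomial {c ℓ} (R : RawRing c ℓ) where
  open RawRing R

  coeff : List Carrier → ℕ → Carrier
  coeff []      _       = 0#
  coeff (a ∷ p) zero    = a
  coeff (a ∷ p) (suc k) = coeff p k

  infixl 6 _⊞_
  infixl 7 _⊠_

  _⊞_ : List Carrier → List Carrier → List Carrier
  []      ⊞ q       = q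
  (a ∷ p) ⊞ []      = a ∷ p
  (a ∷ p) ⊞ (b ∷ q) = a + b ∷ p ⊞ q

  _⊠_ : List Carrier → List Carrier → List Carrier
  []      ⊠ q = []
  (a ∷ p) ⊠ q = List.map (a *_) q ⊞ (0# ∷ p ⊠ q)

  polyRing : RawRing c ℓ
  polyRing = record
    { Carrier = List Carrier
    ; _≈_     = λ p q → ∀ k → coeff p k ≈ coeff q k
    ; _+_     = _⊞_
    ; _*_     = _⊠_
    ; -_      = List.map -_
    ; 0#      = []
    ; 1#      = 1# ∷ []
    }

-- R[x₁,…,xₙ] = R[x₂,…,xₙ][x₁]

_[x₁⋯x_] : ∀ {c ℓ} → RawRing c ℓ → ℕ → RawRing c ℓ
R [x₁⋯x zero  ] = R
R [x₁⋯x suc n ] = Polynomial.polyRing (R [x₁⋯x n ])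

module MvPolynomial {c ℓ} (R : RawRing c ℓ) where
  open RawRing R using (Carrier)

  MvPoly : ℕ → Set c
  MvPoly n = RawRing.Carrier (R [x₁⋯x n ])

  const : ∀ n → Carrier → MvPoly n
  const zero    a = a
  const (suc n) a = const n a ∷ []

  var : ∀ {n} → Fin n → MvPoly n
  var {suc n} zero    = RawRing.0# (R [x₁⋯x n ]) ∷ RawRing.1# (R [x₁⋯x n ]) ∷ []
  var {suc n} (suc i) = var i ∷ []

  -- The coefficient of the monomial x^α.
  coefficient : ∀ n → MvPoly n → Vector ℕ n → Carrier
  coefficient zero    P α = P
  coefficient (suc n) P α =
    coefficient n (Polynomial.coeff (R [x₁⋯x n ]) P (head α)) (tail α)

------------------------------------------------------------------------
-- Matrices

Matrix : ∀ {a} → Set a → ℕ → ℕ → Set a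
Matrix A m n = Vector (Vector A n) m

module LinearAlgebra {c ℓ} (R : RawRing c ℓ) where
  open RawRing R
  open RawMonoidDefinitions +-rawMonoid using (sum)
  open RawSemiringDefinitions rawSemiring using (_^_)

  combination : ∀ {m k} → Vector Carrier k → Vector (Vector Carrier m) k →
                Vector Carrier m
  combination a v i = sum λ j → a j * v j i

  LinearlyIndependent : ∀ {m k} → Vector (Vector Carrier m) k → Set (c ⊔ ℓ)
  LinearlyIndependent v =
    ∀ a → (∀ i → combination a v i ≈ 0#) → ∀ j → a j ≈ 0#

  infix 4 _∈span_
  _∈span_ : ∀ {m k} → Vector Carrier m → Vector (Vector Carrier m) k →
            Set (c ⊔ ℓ)
  w ∈span v = ∃[ a ] ∀ i → w i ≈ combination a v i

  -- The column space has a basis of k vectors.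
  HasRank : ∀ {m n} → Matrix Carrier m n → ℕ → Set (c ⊔ ℓ)
  HasRank {m} A k = ∃[ b ] LinearlyIndependent {m} {k} b
    × (∀ j → b j ∈span transpose A)
    × (∀ j → transpose A j ∈span b)

  HasRankAtMost : ∀ {m n} → Matrix Carrier m n → ℕ → Set (c ⊔ ℓ)
  HasRankAtMost A k = ∃[ l ] l ℕ.≤ k × HasRank A l

  -- Laplace expansion along the first row.
  det : ∀ {n} → Matrix Carrier n n → Carrier
  det {zero}  M = 1#
  det {suc n} M = sum λ j →
    ((- 1#) ^ toℕ j * M zero j) * det (λ i → removeAt (M (suc i)) j)

module Pencil {c ℓ} (R : RawRing c ℓ) where
  open RawRing R using (Carrier)
  open MvPolynomial R

  module _ {n : ℕ} where
    open RawRing (R [x₁⋯x n ]) using (_+_; _*_; +-rawMonoid)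
    open RawMonoidDefinitions +-rawMonoid using (sum)

    linearPencil : ∀ {r} → Vector (Matrix Carrier r r) n →
                   Matrix (MvPoly n) r r
    linearPencil A i j = sum λ k → const n (A k i j) * var k

    affinePencil : ∀ {r} → Matrix Carrier r r → Vector (Matrix Carrier r r) n →
                   Matrix (MvPoly n) r r
    affinePencil A₀ A i j = const n (A₀ i j) + linearPencil A i j

------------------------------------------------------------------------
-- Rational functions in ε and limits at ε = 0

module RationalFunctions {c ℓ} (F : Field c ℓ) where
  open Field F
  open Polynomial rawRing public using (coeff)
  open Polynomial rawRing using (_⊞_; _⊠_; polyRing)

  F[ε] : RawRing c ℓ
  F[ε] = polyRing

  private
    module P = RawRing F[ε]

    coeff-⊞ : ∀ p q k → coeff (p ⊞ q) k ≈ coeff p k + coeff q k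
    coeff-⊞ []      q       k       = sym (+-identityˡ _)
    coeff-⊞ (a ∷ p) []      k       = sym (+-identityʳ _)
    coeff-⊞ (a ∷ p) (b ∷ q) zero    = refl
    coeff-⊞ (a ∷ p) (b ∷ q) (suc k) = coeff-⊞ p q k

    coeff-map : ∀ a p k → coeff (List.map (a *_) p) k ≈ a * coeff p k
    coeff-map a []      k       = sym (zeroʳ a)
    coeff-map a (b ∷ p) zero    = refl
    coeff-map a (b ∷ p) (suc k) = coeff-map a p k

    coeff-⊠ : ∀ a p q k →
              coeff ((a ∷ p) ⊠ q) k ≈ a * coeff q k + coeff (0# ∷ p ⊠ q) k
    coeff-⊠ a p q k = trans (coeff-⊞ (List.map (a *_) q) (0# ∷ p ⊠ q) k)
                            (+-congʳ (coeff-map a q k))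

    ⊠-shift : ∀ p b q → b ≈ 0# →
              ∀ k → coeff (p ⊠ (b ∷ q)) k ≈ coeff (0# ∷ p ⊠ q) k
    ⊠-shift []      b q b≈0 zero    = refl
    ⊠-shift []      b q b≈0 (suc k) = refl
    ⊠-shift (a ∷ p) b q b≈0 zero    =
      trans (+-identityʳ (a * b)) (trans (*-congˡ b≈0) (zeroʳ a))
    ⊠-shift (a ∷ p) b q b≈0 (suc k) =
      trans (coeff-⊠ a p (b ∷ q) (suc k))
        (trans (+-congˡ (⊠-shift p b q b≈0 k)) (sym (coeff-⊠ a p q k)))

    xy≈0⇒q≈0 : ∀ a p q → ¬ (a ≈ 0#) → (a ∷ p) ⊠ q P.≈ P.0# → q P.≈ P.0#
    xy≈0⇒q≈0 a p []      a≉0 pq≈0 k = refl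
    xy≈0⇒q≈0 a p (b ∷ q) a≉0 pq≈0 k = go k
      where
      b≈0 : b ≈ 0#
      b≈0 = xy≈0⇒y≈0 a≉0 (trans (sym (+-identityʳ (a * b))) (pq≈0 0))
      go : ∀ k → coeff (b ∷ q) k ≈ 0#
      go zero    = b≈0
      go (suc k) = xy≈0⇒q≈0 a p q a≉0
        (λ l → trans (sym (⊠-shift (a ∷ p) b q b≈0 (suc l))) (pq≈0 (suc l))) k

  ⊠-nonzero : ∀ p q → ¬ (p P.≈ P.0#) → ¬ (q P.≈ P.0#) → ¬ (p ⊠ q P.≈ P.0#)
  ⊠-nonzero []      q p≉0 q≉0 pq≈0 = p≉0 λ _ → refl
  ⊠-nonzero (a ∷ p) q p≉0 q≉0 pq≈0 with a ≟ 0#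
  ... | no  a≉0 = q≉0 (xy≈0⇒q≈0 a p q a≉0 pq≈0)
  ... | yes a≈0 = ⊠-nonzero p q
    (λ p≈0 → p≉0 λ { zero → a≈0 ; (suc k) → p≈0 k }) q≉0
    (λ k → begin
      coeff (p ⊠ q) k                          ≈⟨ +-identityˡ _ ⟨
      0# + coeff (p ⊠ q) k                     ≈⟨ +-congʳ (zeroˡ _) ⟨
      0# * coeff q (suc k) + coeff (p ⊠ q) k   ≈⟨ +-congʳ (*-congʳ a≈0) ⟨
      a * coeff q (suc k) + coeff (p ⊠ q) k    ≈⟨ coeff-⊠ a p q (suc k) ⟨
      coeff ((a ∷ p) ⊠ q) (suc k)              ≈⟨ pq≈0 (suc k) ⟩
      0#                                       ∎)
    where open SetoidReasoning setoid

  _≟0 : ∀ p → Dec (p P.≈ P.0#)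
  []      ≟0 = yes λ _ → refl
  (a ∷ p) ≟0 with a ≟ 0# | p ≟0
  ... | yes a≈0 | yes p≈0 = yes λ { zero → a≈0 ; (suc k) → p≈0 k }
  ... | no  a≉0 | _       = no λ ap≈0 → a≉0 (ap≈0 0)
  ... | _       | no p≉0  = no λ ap≈0 → p≉0 λ k → ap≈0 (suc k)

  -- The rational function num/den.
  record Fraction : Set (c ⊔ ℓ) where
    constructor fraction
    field
      num   : P.Carrier
      den   : P.Carrier
      den≉0 : ¬ (den P.≈ P.0#)
  open Fraction public

  den*den≉0 : ∀ x y → ¬ (den x P.* den y P.≈ P.0#)
  den*den≉0 x y = ⊠-nonzero (den x) (den y) (den≉0 x) (den≉0 y)

  F⟨ε⟩ : RawRing (c ⊔ ℓ) ℓ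
  F⟨ε⟩ = record
    { Carrier = Fraction
    ; _≈_     = λ x y → num x P.* den y P.≈ num y P.* den x
    ; _+_     = λ x y → fraction (num x P.* den y P.+ num y P.* den x)
                                 (den x P.* den y) (den*den≉0 x y)
    ; _*_     = λ x y → fraction (num x P.* num y)
                                 (den x P.* den y) (den*den≉0 x y)
    ; -_      = λ x → fraction (P.- num x) (den x) (den≉0 x)
    ; 0#      = fraction P.0# P.1# λ 1≈0 → 1≉0 (1≈0 0)
    ; 1#      = fraction P.1# P.1# λ 1≈0 → 1≉0 (1≈0 0)
    }

  mindeg : ∀ p → ¬ (p P.≈ P.0#) → ℕ
  mindeg []      p≉0 = ⊥-elim (p≉0 λ _ → refl)
  mindeg (a ∷ p) p≉0 with a ≟ 0#
  ... | no  _   = 0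
  ... | yes a≈0 = suc (mindeg p λ p≈0 → p≉0 λ { zero → a≈0 ; (suc k) → p≈0 k })

  coeff-mindeg : ∀ p p≉0 → ¬ (coeff p (mindeg p p≉0) ≈ 0#)
  coeff-mindeg []      p≉0 = ⊥-elim (p≉0 λ _ → refl)
  coeff-mindeg (a ∷ p) p≉0 with a ≟ 0#
  ... | no  a≉0 = a≉0
  ... | yes a≈0 = coeff-mindeg p _

  val : Fraction → ℤ ⁺
  val (fraction g h h≉0) with g ≟0
  ... | yes _   = ⊤⁺
  ... | no  g≉0 = [ mindeg g g≉0 ⊖ mindeg h h≉0 ]

  open Supremum ℤ._≤_ using (_≤⁺_)

  LimitExists : Fraction → Set
  LimitExists x = [ 0ℤ ] ≤⁺ val x

  -- For val (g/h) ≥ 0, the value at ε = 0 of (g/εᵈ)/(h/εᵈ), d = mindeg h.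
  limit : Fraction → Carrier
  limit (fraction g h h≉0) =
    coeff g (mindeg h h≉0) * coeff h (mindeg h h≉0) ⁻¹[ coeff-mindeg h h≉0 ]

  open MvPolynomial using (MvPoly; coefficient)

  record IsLimit n (P : MvPoly F⟨ε⟩ n) (f : MvPoly rawRing n) : Set ℓ where
    field
      defined : ∀ α → LimitExists (coefficient F⟨ε⟩ n P α)
      value   : ∀ α → coefficient rawRing n f α ≈ limit (coefficient F⟨ε⟩ n P α)

open LinearAlgebra public using (HasRank; HasRankAtMost; det)
open Pencil public using (linearPencil; affinePencil)

{-# OPTIONS --safe #-}

-- The construction takes place over 𝔽[ε] instead of 𝔽(ε).  Clearing denominators turns the
-- pencil into M = A₀ + Σ Aᵢxᵢ over 𝔽[ε], with the 2 × 2 minors of A₁,…,Aₙ still zero and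
-- det M = εᴺ (f + O(ε)).  If N = 0, put ε = 0.  If N > 0, then M is singular at ε = 0.  As
-- A₁,…,Aₙ have rank at most one, Edmonds' matroid intersection theorem, in a form which allows
-- an arbitrary A₀, gives invertible P, Q over 𝔽 such that PMQ vanishes at ε = 0 on a common
-- p × q block with p + q > r.  Dividing these p rows by ε and multiplying the other r − q
-- columns by ε keeps the entries in 𝔽[ε] and the minors zero, and lowers N by p + q − r ≥ 1.
--
-- This already gives r × r matrices B₀,…,Bₙ of rank at most one for i ≥ 1, with B₀ = 0 if
-- A₀ = 0.  The n extra rows and columns only serve to make the ranks equal to one: they hold
-- an identity block, and where Bᵢ = 0 the variable xᵢ is put above the diagonal blocks.

module Submission where

open import Defs
open import Algebra.Bundles using (CommutativeRing)
open import Algebra.Bundles.Raw using (RawRing)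
import Algebra.Definitions.RawSemiring as RawSemiringDefinitions
import Algebra.Morphism.Construct.Composition as Composition
import Algebra.Morphism.Construct.Identity as Identity
import Algebra.Morphism.Structures as Morphisms
import Algebra.Properties.CommutativeSemigroup as CommutativeSemigroupProperties
import Algebra.Properties.Ring as RingProperties
import Algebra.Properties.Semiring.Sum as SemiringSum
import Algebra.Solver.Ring.NaturalCoefficients.Default as Solver
open import Algebra.Structures using (IsCommutativeRing)
open import Data.Bool.Base using (Bool; true; false; if_then_else_)
import Data.Bool.Properties as BoolP
open import Data.Fin.Base using (Fin; zero; suc; toℕ; inject₁; punchIn; punchOut; _↑ˡ_; _↑ʳ_)
open import Data.Fin.Induction using (<-weakInduction)
import Data.Fin.Properties as Fin
import Data.Integer.Base as ℤ
import Data.Integer.Properties as ℤ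
open import Data.List.Base as L using (List)
import Data.List.Properties as LP
open import Data.List.Relation.Unary.All as All using (All)
import Data.List.Relation.Unary.All.Properties as AllP
open import Data.Nat.Base as ℕ using (ℕ; zero; suc; z≤n; s≤s)
import Data.Nat.Properties as ℕ
open import Data.Product.Base using (Σ-syntax; ∃; ∃₂; _×_; _,_; proj₁; proj₂)
open import Data.Sum.Base using (_⊎_; inj₁; inj₂)
open import Data.Unit.Base using (⊤)
open import Data.Vec.Functional as Vec using (Vector; removeAt; insertAt; transpose; tail; head)
import Data.Vec.Functional.Properties as VecP
open import Function.Base using (_∘_)
open import Level using (Lift; lift; _⊔_)
import Relation.Binary.Construct.Add.Supremum.NonStrict as Supremum
open import Relation.Binary.Definitions using (tri<; tri≈; tri>)
open import Relation.Binary.PropositionalEquality as ≡ using (_≡_; _≢_)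
import Relation.Binary.Reasoning.Setoid as SetoidReasoning
open import Relation.Nullary using (¬_; Dec; yes; no; does; contradiction; ¬?; _×-dec_; decidable-stable)

-- The condition carried along is the vanishing of the 2 × 2 minors and not rank one. It is a
-- polynomial identity, so it survives clearing denominators, multiplication by P and Q, cancelling
-- ε and setting ε = 0, whereas the rank may fall to zero at ε = 0. For A₀ = 0 there is no room to
-- repair this: with n = r = 1 and A₁ = (ε) the limit is 0 and forces B₁ = 0, so this half concludes
-- rank at most one. The common denominator is normalised to leading coefficient 1. All coefficients
-- of the cleared determinant then have their prescribed term at the same exponent N, with no scalar
-- in front of f; coefficients with limit 0 fit in, as only the terms up to ε^N are recorded. A
-- descent step returns its surplus powers of ε, and the determinants of P and Q, through one row. N
-- thus drops by exactly one and the recursion is structural. The block of zeros is sought as a pair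
-- of subspaces, so that blocks for x₁ = 0 and for the coefficient of x₁ can be combined by
-- intersections and sums. Without variables the claim is about A₀ alone, and Gaussian elimination
-- proves it.

-- Univariate polynomials as a commutative ring

module PolynomialRing {c ℓ} (R : CommutativeRing c ℓ) where
  open CommutativeRing R hiding (zero)
  open Polynomial rawRing
  open L using ([]; _∷_)
  open RingProperties ring using (-0#≈0#)
  open SetoidReasoning setoid

  infix 4 _≈ₚ_
  _≈ₚ_ : List Carrier → List Carrier → Set ℓ
  p ≈ₚ q = ∀ k → coeff p k ≈ coeff q k

  shift : List Carrier → List Carrier
  shift p = 0# ∷ p

  infixr 8 _·_
  _·_ : Carrier → List Carrier → List Carrier
  a · p = L.map (a *_) p

  coeff-⊞ : ∀ p q k → coeff (p ⊞ q) k ≈ coeff p k + coeff q k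
  coeff-⊞ []      q       k       = sym (+-identityˡ _)
  coeff-⊞ (a ∷ p) []      k       = sym (+-identityʳ _)
  coeff-⊞ (a ∷ p) (b ∷ q) zero    = refl
  coeff-⊞ (a ∷ p) (b ∷ q) (suc k) = coeff-⊞ p q k

  coeff-· : ∀ a p k → coeff (a · p) k ≈ a * coeff p k
  coeff-· a []      k       = sym (zeroʳ a)
  coeff-· a (b ∷ p) zero    = refl
  coeff-· a (b ∷ p) (suc k) = coeff-· a p k

  coeff-neg : ∀ p k → coeff (L.map -_ p) k ≈ - coeff p k
  coeff-neg []      k       = sym -0#≈0#
  coeff-neg (b ∷ p) zero    = refl
  coeff-neg (b ∷ p) (suc k) = coeff-neg p k

  coeff-⊠ : ∀ a p q k → coeff ((a ∷ p) ⊠ q) k ≈ a * coeff q k + coeff (shift (p ⊠ q)) k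
  coeff-⊠ a p q k = trans (coeff-⊞ (a · q) (shift (p ⊠ q)) k) (+-congʳ (coeff-· a q k))

  coeff-⊠-zero : ∀ p q → coeff (p ⊠ q) 0 ≈ coeff p 0 * coeff q 0
  coeff-⊠-zero []      q = sym (zeroˡ _)
  coeff-⊠-zero (a ∷ p) q = trans (coeff-⊠ a p q 0) (+-identityʳ _)

  shift-cong : ∀ {p q} → p ≈ₚ q → shift p ≈ₚ shift q
  shift-cong eq zero    = refl
  shift-cong eq (suc k) = eq k

  shift-⊞ : ∀ p q → shift (p ⊞ q) ≈ₚ shift p ⊞ shift q
  shift-⊞ p q zero    = sym (+-identityˡ 0#)
  shift-⊞ p q (suc k) = refl

  ⊠-congˡ : ∀ p {q q′} → q ≈ₚ q′ → p ⊠ q ≈ₚ p ⊠ q′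
  ⊠-congˡ []      eq k = refl
  ⊠-congˡ (a ∷ p) {q} {q′} eq k = begin
    coeff ((a ∷ p) ⊠ q) k                    ≈⟨ coeff-⊠ a p q k ⟩
    a * coeff q k + coeff (shift (p ⊠ q)) k   ≈⟨ +-cong (*-congˡ (eq k)) (shift-cong (⊠-congˡ p eq) k) ⟩
    a * coeff q′ k + coeff (shift (p ⊠ q′)) k ≈⟨ coeff-⊠ a p q′ k ⟨
    coeff ((a ∷ p) ⊠ q′) k                   ∎

  ⊠-zeroʳ : ∀ p → p ⊠ [] ≈ₚ []
  ⊠-zeroʳ []      k       = refl
  ⊠-zeroʳ (a ∷ p) zero    = refl
  ⊠-zeroʳ (a ∷ p) (suc k) = ⊠-zeroʳ p k

  -- `_⊠_` recurses on its left factor. This is the mirror recursion on the right factor, from which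
  -- `⊠-comm` follows by induction.
  ⊠-∷ : ∀ p b q → p ⊠ (b ∷ q) ≈ₚ b · p ⊞ shift (p ⊠ q)
  ⊠-∷ []      b q zero    = refl
  ⊠-∷ []      b q (suc k) = refl
  ⊠-∷ (a ∷ p) b q zero    = +-congʳ (*-comm a b)
  ⊠-∷ (a ∷ p) b q (suc k) = begin
    coeff (a · q ⊞ p ⊠ (b ∷ q)) k                             ≈⟨ coeff-⊞ (a · q) _ k ⟩
    coeff (a · q) k + coeff (p ⊠ (b ∷ q)) k                   ≈⟨ +-congˡ (⊠-∷ p b q k) ⟩
    coeff (a · q) k + coeff (b · p ⊞ shift (p ⊠ q)) k         ≈⟨ +-congˡ (coeff-⊞ (b · p) _ k) ⟩
    coeff (a · q) k + (coeff (b · p) k + coeff (shift (p ⊠ q)) k) ≈⟨ x∙yz≈y∙xz _ _ _ ⟩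
    coeff (b · p) k + (coeff (a · q) k + coeff (shift (p ⊠ q)) k) ≈⟨ +-congˡ (coeff-⊞ (a · q) _ k) ⟨
    coeff (b · p) k + coeff ((a ∷ p) ⊠ q) k                   ≈⟨ coeff-⊞ (b · p) _ k ⟨
    coeff (b · p ⊞ (a ∷ p) ⊠ q) k                             ∎
    where
    open CommutativeSemigroupProperties +-commutativeSemigroup using (x∙yz≈y∙xz)

  ⊠-comm : ∀ p q → p ⊠ q ≈ₚ q ⊠ p
  ⊠-comm []      q k = sym (⊠-zeroʳ q k)
  ⊠-comm (a ∷ p) q k = begin
    coeff (a · q ⊞ shift (p ⊠ q)) k               ≈⟨ coeff-⊞ (a · q) _ k ⟩
    coeff (a · q) k + coeff (shift (p ⊠ q)) k     ≈⟨ +-congˡ (shift-cong (⊠-comm p q) k) ⟩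
    coeff (a · q) k + coeff (shift (q ⊠ p)) k     ≈⟨ coeff-⊞ (a · q) _ k ⟨
    coeff (a · q ⊞ shift (q ⊠ p)) k               ≈⟨ ⊠-∷ q a p k ⟨
    coeff (q ⊠ (a ∷ p)) k                         ∎

  ⊠-distribˡ : ∀ p q r → p ⊠ (q ⊞ r) ≈ₚ p ⊠ q ⊞ p ⊠ r
  ⊠-distribˡ []      q r k = refl
  ⊠-distribˡ (a ∷ p) q r k = begin
    coeff ((a ∷ p) ⊠ (q ⊞ r)) k
      ≈⟨ coeff-⊠ a p (q ⊞ r) k ⟩
    a * coeff (q ⊞ r) k + coeff (shift (p ⊠ (q ⊞ r))) k
      ≈⟨ +-cong (trans (*-congˡ (coeff-⊞ q r k)) (distribˡ _ _ _))
           (trans (shift-cong (⊠-distribˡ p q r) k)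
           (trans (shift-⊞ (p ⊠ q) (p ⊠ r) k) (coeff-⊞ (shift (p ⊠ q)) (shift (p ⊠ r)) k))) ⟩
    (a * coeff q k + a * coeff r k) + (coeff (shift (p ⊠ q)) k + coeff (shift (p ⊠ r)) k)
      ≈⟨ interchange _ _ _ _ ⟩
    (a * coeff q k + coeff (shift (p ⊠ q)) k) + (a * coeff r k + coeff (shift (p ⊠ r)) k)
      ≈⟨ +-cong (coeff-⊠ a p q k) (coeff-⊠ a p r k) ⟨
    coeff ((a ∷ p) ⊠ q) k + coeff ((a ∷ p) ⊠ r) k
      ≈⟨ coeff-⊞ ((a ∷ p) ⊠ q) _ k ⟨
    coeff ((a ∷ p) ⊠ q ⊞ (a ∷ p) ⊠ r) k ∎
    where
    open CommutativeSemigroupProperties +-commutativeSemigroup using (interchange)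

  ⊞-cong : ∀ {p p′ q q′} → p ≈ₚ p′ → q ≈ₚ q′ → p ⊞ q ≈ₚ p′ ⊞ q′
  ⊞-cong {p} {p′} {q} {q′} e f k =
    trans (coeff-⊞ p q k) (trans (+-cong (e k) (f k)) (sym (coeff-⊞ p′ q′ k)))

  ⊠-distribʳ : ∀ p q r → (q ⊞ r) ⊠ p ≈ₚ q ⊠ p ⊞ r ⊠ p
  ⊠-distribʳ p q r k = trans (⊠-comm (q ⊞ r) p k) (trans (⊠-distribˡ p q r k)
    (⊞-cong {p ⊠ q} {q ⊠ p} {p ⊠ r} {r ⊠ p} (⊠-comm p q) (⊠-comm p r) k))

  ·-⊠ : ∀ a p q → (a · p) ⊠ q ≈ₚ a · (p ⊠ q)
  ·-⊠ a []      q k = refl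
  ·-⊠ a (b ∷ p) q k = begin
    coeff ((a * b ∷ a · p) ⊠ q) k                       ≈⟨ coeff-⊠ (a * b) (a · p) q k ⟩
    (a * b) * coeff q k + coeff (shift (a · p ⊠ q)) k    ≈⟨ +-cong (*-assoc _ _ _) (lemma k) ⟩
    a * (b * coeff q k) + a * coeff (shift (p ⊠ q)) k    ≈⟨ distribˡ _ _ _ ⟨
    a * (b * coeff q k + coeff (shift (p ⊠ q)) k)        ≈⟨ *-congˡ (coeff-⊠ b p q k) ⟨
    a * coeff ((b ∷ p) ⊠ q) k                           ≈⟨ coeff-· a ((b ∷ p) ⊠ q) k ⟨
    coeff (a · ((b ∷ p) ⊠ q)) k                         ∎
    where
    lemma : ∀ k → coeff (shift (a · p ⊠ q)) k ≈ a * coeff (shift (p ⊠ q)) k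
    lemma zero    = sym (zeroʳ a)
    lemma (suc k) = trans (·-⊠ a p q k) (coeff-· a (p ⊠ q) k)

  shift-⊠ : ∀ p q → shift p ⊠ q ≈ₚ shift (p ⊠ q)
  shift-⊠ p q k = trans (coeff-⊠ 0# p q k) (trans (+-congʳ (zeroˡ _)) (+-identityˡ _))

  ⊠-shift : ∀ p q → p ⊠ shift q ≈ₚ shift (p ⊠ q)
  ⊠-shift p q k = trans (⊠-comm p (shift q) k)
    (trans (shift-⊠ q p k) (shift-cong {q ⊠ p} {p ⊠ q} (⊠-comm q p) k))

  ⊠-assoc : ∀ p q r → (p ⊠ q) ⊠ r ≈ₚ p ⊠ (q ⊠ r)
  ⊠-assoc []      q r k = refl
  ⊠-assoc (a ∷ p) q r k = begin
    coeff ((a · q ⊞ shift (p ⊠ q)) ⊠ r) k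
      ≈⟨ ⊠-distribʳ r (a · q) (shift (p ⊠ q)) k ⟩
    coeff ((a · q) ⊠ r ⊞ shift (p ⊠ q) ⊠ r) k
      ≈⟨ coeff-⊞ ((a · q) ⊠ r) _ k ⟩
    coeff ((a · q) ⊠ r) k + coeff (shift (p ⊠ q) ⊠ r) k
      ≈⟨ +-cong (trans (·-⊠ a q r k) (coeff-· a (q ⊠ r) k))
           (trans (shift-⊠ (p ⊠ q) r k) (shift-cong (⊠-assoc p q r) k)) ⟩
    a * coeff (q ⊠ r) k + coeff (shift (p ⊠ (q ⊠ r))) k
      ≈⟨ coeff-⊠ a p (q ⊠ r) k ⟨
    coeff ((a ∷ p) ⊠ (q ⊠ r)) k ∎

  const-⊠ : ∀ a q → (a ∷ []) ⊠ q ≈ₚ a · q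
  const-⊠ a q k = begin
    coeff (a · q ⊞ (0# ∷ [])) k           ≈⟨ coeff-⊞ (a · q) _ k ⟩
    coeff (a · q) k + coeff (0# ∷ []) k   ≈⟨ +-congˡ (0∷[] k) ⟩
    coeff (a · q) k + 0#                  ≈⟨ +-identityʳ _ ⟩
    coeff (a · q) k                       ∎
    where
    0∷[] : ∀ k → coeff (0# ∷ []) k ≈ 0#
    0∷[] zero    = refl
    0∷[] (suc k) = refl

  ⊠-identityˡ : ∀ q → (1# ∷ []) ⊠ q ≈ₚ q
  ⊠-identityˡ q k = trans (const-⊠ 1# q k) (trans (coeff-· 1# q k) (*-identityˡ _))

  commutativeRing : CommutativeRing c ℓ
  commutativeRing = record
    { RawRing polyRing
    ; isCommutativeRing = record
      { isRing = record
        { +-isAbelianGroup = record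
          { isGroup = record
            { isMonoid = record
              { isSemigroup = record
                { isMagma = record
                  { isEquivalence = record
                    { refl  = λ k → refl
                    ; sym   = λ e k → sym (e k)
                    ; trans = λ e f k → trans (e k) (f k)
                    }
                  ; ∙-cong = λ {p} {p′} {q} {q′} → ⊞-cong {p} {p′} {q} {q′}
                  }
                ; assoc = λ p q r k → begin
                    coeff ((p ⊞ q) ⊞ r) k             ≈⟨ coeff-⊞ (p ⊞ q) r k ⟩
                    coeff (p ⊞ q) k + coeff r k       ≈⟨ +-congʳ (coeff-⊞ p q k) ⟩
                    coeff p k + coeff q k + coeff r k ≈⟨ +-assoc _ _ _ ⟩
                    coeff p k + (coeff q k + coeff r k) ≈⟨ +-congˡ (coeff-⊞ q r k) ⟨
                    coeff p k + coeff (q ⊞ r) k       ≈⟨ coeff-⊞ p (q ⊞ r) k ⟨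
                    coeff (p ⊞ (q ⊞ r)) k             ∎
                }
              ; identity = (λ p k → refl)
                         , (λ p k → trans (coeff-⊞ p [] k) (+-identityʳ _))
              }
            ; inverse =
                (λ p k → trans (coeff-⊞ (L.map -_ p) p k)
                           (trans (+-congʳ (coeff-neg p k)) (-‿inverseˡ _)))
              , (λ p k → trans (coeff-⊞ p (L.map -_ p) k)
                           (trans (+-congˡ (coeff-neg p k)) (-‿inverseʳ _)))
            ; ⁻¹-cong = λ {p} {q} e k →
                trans (coeff-neg p k) (trans (-‿cong (e k)) (sym (coeff-neg q k)))
            }
          ; comm = λ p q k → trans (coeff-⊞ p q k)
                               (trans (+-comm _ _) (sym (coeff-⊞ q p k)))
          }
        ; *-cong = λ {p} {p′} {q} {q′} e f k → trans (⊠-congˡ p f k)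
            (trans (⊠-comm p q′ k) (trans (⊠-congˡ q′ e k) (⊠-comm q′ p′ k)))
        ; *-assoc    = ⊠-assoc
        ; *-identity = ⊠-identityˡ
                     , (λ p k → trans (⊠-comm p (1# ∷ []) k) (⊠-identityˡ p k))
        ; distrib    = ⊠-distribˡ , ⊠-distribʳ
        }
      ; *-comm = ⊠-comm
      }
    }

-- Ring homomorphisms and polynomial coefficients

module _ {c₁ ℓ₁ c₂ ℓ₂} (R : CommutativeRing c₁ ℓ₁) (S : CommutativeRing c₂ ℓ₂) where
  private
    module R = CommutativeRing R
    module S = CommutativeRing S

  IsHomomorphism : (R.Carrier → S.Carrier) → Set _
  IsHomomorphism = Morphisms.RingMorphisms.IsRingHomomorphism R.rawRing S.rawRing

  isHomomorphism : (f : R.Carrier → S.Carrier) →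
    (∀ {x y} → x R.≈ y → f x S.≈ f y) →
    (∀ x y → f (x R.+ y) S.≈ f x S.+ f y) →
    (∀ x y → f (x R.* y) S.≈ f x S.* f y) →
    f R.0# S.≈ S.0# → f R.1# S.≈ S.1# → (∀ x → f (R.- x) S.≈ S.- f x) →
    IsHomomorphism f
  isHomomorphism f f-cong f-+ f-* f-0 f-1 f-neg = record
    { isSemiringHomomorphism = record
      { isNearSemiringHomomorphism = record
        { +-isMonoidHomomorphism = record
          { isMagmaHomomorphism = record
            { isRelHomomorphism = record { cong = f-cong }
            ; homo = f-+
            }
          ; ε-homo = f-0
          }
        ; *-homo = f-*
        }
      ; 1#-homo = f-1
      }
    ; -‿homo = f-neg
    }

module Homomorphism {c₁ ℓ₁ c₂ ℓ₂} (R : CommutativeRing c₁ ℓ₁) (S : CommutativeRing c₂ ℓ₂)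
  {f : CommutativeRing.Carrier R → CommutativeRing.Carrier S} (f-hom : IsHomomorphism R S f) =
  Morphisms.RingMorphisms.IsRingHomomorphism f-hom

module PolynomialHomomorphisms {c ℓ} (R : CommutativeRing c ℓ) where
  private
    module R = CommutativeRing R
    R[x] = PolynomialRing.commutativeRing R
  open PolynomialRing R
  open Polynomial R.rawRing using (coeff; _⊞_; _⊠_)
  open L using ([]; _∷_)

  constant-hom : IsHomomorphism R R[x] (_∷ [])
  constant-hom = isHomomorphism R R[x] _
    (λ { e zero → e ; e (suc k) → R.refl })
    (λ { x y zero → R.refl ; x y (suc k) → R.refl })
    (λ { x y zero → R.sym (R.+-identityʳ _) ; x y (suc k) → R.refl })
    (λ { zero → R.refl ; (suc k) → R.refl })
    (λ k → R.refl)
    (λ { x zero → R.refl ; x (suc k) → R.refl })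

  coeff₀-hom : IsHomomorphism R[x] R (λ p → coeff p 0)
  coeff₀-hom = isHomomorphism R[x] R _
    (λ e → e 0) (λ p q → coeff-⊞ p q 0) coeff-⊠-zero
    R.refl R.refl (λ p → coeff-neg p 0)

  -- The constant term of an entry from which x₁ has been split off as in `pencil-suc`; `deletion`
  -- reads it off. `coeff₁-linear` has the product in the other order because `contraction` meets
  -- the shape produced by `det-addCorner`.
  coeff₀-linear : ∀ a b → R._≈_ (coeff ((a ∷ []) ⊞ (b ∷ []) ⊠ (R.0# ∷ R.1# ∷ [])) 0) a
  coeff₀-linear a b = R.trans
    (R.+-congˡ (R.trans (R.+-identityʳ _) (R.zeroʳ b))) (R.+-identityʳ a)

  coeff₁-linear : ∀ a b → R._≈_ (coeff ((a ∷ []) ⊞ (R.0# ∷ R.1# ∷ []) ⊠ (b ∷ [])) 1) b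
  coeff₁-linear a b = R.trans (R.+-identityʳ _) (R.*-identityˡ b)

module _ {c₁ ℓ₁ c₂ ℓ₂} (R : CommutativeRing c₁ ℓ₁) (S : CommutativeRing c₂ ℓ₂)
  {f : CommutativeRing.Carrier R → CommutativeRing.Carrier S} (f-hom : IsHomomorphism R S f) where
  private
    module R = CommutativeRing R
    module S = CommutativeRing S
    module RP = Polynomial R.rawRing
    module SP = Polynomial S.rawRing
    module R[x] = PolynomialRing R
    module S[x] = PolynomialRing S
    module f = Homomorphism R S f-hom
  open L using ([]; _∷_)
  open SetoidReasoning S.setoid

  coeff-map : ∀ p k → SP.coeff (L.map f p) k S.≈ f (RP.coeff p k)
  coeff-map []      k       = S.sym f.0#-homo
  coeff-map (a ∷ p) zero    = S.refl
  coeff-map (a ∷ p) (suc k) = coeff-map p k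

  private
    map-⊠ : ∀ p q → L.map f (p RP.⊠ q) S[x].≈ₚ L.map f p SP.⊠ L.map f q
    map-⊠ []      q k = S.refl
    map-⊠ (a ∷ p) q k = begin
      SP.coeff (L.map f ((a ∷ p) RP.⊠ q)) k
        ≈⟨ coeff-map ((a ∷ p) RP.⊠ q) k ⟩
      f (RP.coeff ((a ∷ p) RP.⊠ q) k)
        ≈⟨ f.⟦⟧-cong (R[x].coeff-⊠ a p q k) ⟩
      f (a R.* RP.coeff q k R.+ RP.coeff (R[x].shift (p RP.⊠ q)) k)
        ≈⟨ S.trans (f.+-homo _ _) (S.+-congʳ (f.*-homo _ _)) ⟩
      f a S.* f (RP.coeff q k) S.+ f (RP.coeff (R[x].shift (p RP.⊠ q)) k)
        ≈⟨ S.+-cong (S.*-congˡ (coeff-map q k)) (shifted k) ⟨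
      f a S.* SP.coeff (L.map f q) k S.+ SP.coeff (S[x].shift (L.map f p SP.⊠ L.map f q)) k
        ≈⟨ S[x].coeff-⊠ (f a) (L.map f p) (L.map f q) k ⟨
      SP.coeff (L.map f (a ∷ p) SP.⊠ L.map f q) k ∎
      where
      shifted : ∀ k → SP.coeff (S[x].shift (L.map f p SP.⊠ L.map f q)) k S.≈
                      f (RP.coeff (R[x].shift (p RP.⊠ q)) k)
      shifted zero    = S.sym f.0#-homo
      shifted (suc k) = S.trans (S.sym (map-⊠ p q k)) (coeff-map (p RP.⊠ q) k)

  map-hom : IsHomomorphism R[x].commutativeRing S[x].commutativeRing (L.map f)
  map-hom = isHomomorphism R[x].commutativeRing S[x].commutativeRing _
    (λ {p} {q} e k → begin
      SP.coeff (L.map f p) k ≈⟨ coeff-map p k ⟩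
      f (RP.coeff p k)       ≈⟨ f.⟦⟧-cong (e k) ⟩
      f (RP.coeff q k)       ≈⟨ coeff-map q k ⟨
      SP.coeff (L.map f q) k ∎)
    (λ p q k → begin
      SP.coeff (L.map f (p RP.⊞ q)) k ≈⟨ coeff-map (p RP.⊞ q) k ⟩
      f (RP.coeff (p RP.⊞ q) k)       ≈⟨ f.⟦⟧-cong (R[x].coeff-⊞ p q k) ⟩
      f (RP.coeff p k R.+ RP.coeff q k) ≈⟨ f.+-homo _ _ ⟩
      f (RP.coeff p k) S.+ f (RP.coeff q k) ≈⟨ S.+-cong (coeff-map p k) (coeff-map q k) ⟨
      SP.coeff (L.map f p) k S.+ SP.coeff (L.map f q) k ≈⟨ S[x].coeff-⊞ (L.map f p) (L.map f q) k ⟨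
      SP.coeff (L.map f p SP.⊞ L.map f q) k ∎)
    map-⊠
    (λ k → S.refl)
    (λ { zero → f.1#-homo ; (suc k) → S.refl })
    (λ p k → begin
      SP.coeff (L.map f (L.map R.-_ p)) k ≈⟨ coeff-map (L.map R.-_ p) k ⟩
      f (RP.coeff (L.map R.-_ p) k)       ≈⟨ f.⟦⟧-cong (R[x].coeff-neg p k) ⟩
      f (R.- RP.coeff p k)                ≈⟨ f.-‿homo _ ⟩
      S.- f (RP.coeff p k)                ≈⟨ S.-‿cong (coeff-map p k) ⟨
      S.- SP.coeff (L.map f p) k          ≈⟨ S[x].coeff-neg (L.map f p) k ⟨
      SP.coeff (L.map S.-_ (L.map f p)) k ∎)

-- Multivariate polynomial rings

module MvRing {c ℓ} (R : CommutativeRing c ℓ) where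
  private module R = CommutativeRing R
  open MvPolynomial R.rawRing

  -- The operations are taken whole from `R.rawRing [x₁⋯x n ]` and only the axioms go by recursion.
  -- For a variable `n` the carrier and the operations are therefore definitionally those of the
  -- theorem.
  mvRing : ℕ → CommutativeRing c ℓ
  private
    isCommutativeRing : ∀ n → let open RawRing (R.rawRing [x₁⋯x n ]) in
      IsCommutativeRing _≈_ _+_ _*_ -_ 0# 1#
  mvRing n = record
    { RawRing (R.rawRing [x₁⋯x n ]) ; isCommutativeRing = isCommutativeRing n }
  isCommutativeRing zero    = R.isCommutativeRing
  isCommutativeRing (suc n) =
    CommutativeRing.isCommutativeRing (PolynomialRing.commutativeRing (mvRing n))

  module Mv n = CommutativeRing (mvRing n)

  const-hom : ∀ n → IsHomomorphism R (mvRing n) (const n)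
  const-hom zero    = Identity.isRingHomomorphism R.rawRing R.refl
  const-hom (suc n) = Composition.isRingHomomorphism
    (λ {p} {q} {r} → Mv.trans (suc n) {p} {q} {r}) (const-hom n)
    (PolynomialHomomorphisms.constant-hom (mvRing n))

  coefficient-cong : ∀ n {P Q} → Mv._≈_ n P Q → ∀ α → coefficient n P α R.≈ coefficient n Q α
  coefficient-cong zero    e α = e
  coefficient-cong (suc n) e α = coefficient-cong n (e (head α)) (tail α)

  coefficient-ext : ∀ n {P Q} → (∀ α → coefficient n P α R.≈ coefficient n Q α) → Mv._≈_ n P Q
  coefficient-ext zero    e   = e Vec.[]
  coefficient-ext (suc n) e k = coefficient-ext n λ α → e (k Vec.∷ α)

  coefficient-scale : ∀ n a P α →
    coefficient n (Mv._*_ n (const n a) P) α R.≈ a R.* coefficient n P α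
  coefficient-scale zero    a P α = R.refl
  coefficient-scale (suc n) a P α = R.trans
    (coefficient-cong n (Mv.trans n (const-⊠ (const n a) P (head α)) (coeff-· (const n a) P (head α))) (tail α))
    (coefficient-scale n a _ (tail α))
    where open PolynomialRing (mvRing n)

  -- The determinant of the empty matrix is 1, so this excludes size 0 wherever a pencil is
  -- singular.
  nontrivial : ¬ (R.1# R.≈ R.0#) → ∀ n → ¬ (Mv._≈_ n (Mv.1# n) (Mv.0# n))
  nontrivial 1≉0 zero    e = 1≉0 e
  nontrivial 1≉0 (suc n) e = nontrivial 1≉0 n (e 0)

  coefficient-0# : ∀ n α → coefficient n (Mv.0# n) α R.≈ R.0#
  coefficient-0# zero    α = R.refl
  coefficient-0# (suc n) α = coefficient-0# n (tail α)

module _ {c₁ ℓ₁ c₂ ℓ₂} (R : CommutativeRing c₁ ℓ₁) (S : CommutativeRing c₂ ℓ₂)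
  (f : CommutativeRing.Carrier R → CommutativeRing.Carrier S) where
  private
    module R = CommutativeRing R
    module S = CommutativeRing S
    module R[x] = MvPolynomial R.rawRing
    module S[x] = MvPolynomial S.rawRing
    module RMv = MvRing R
    module SMv = MvRing S

  mvMap : ∀ n → R[x].MvPoly n → S[x].MvPoly n
  mvMap zero    = f
  mvMap (suc n) = L.map (mvMap n)

  mvMap-const : ∀ n a → mvMap n (R[x].const n a) ≡ S[x].const n (f a)
  mvMap-const zero    a = ≡.refl
  mvMap-const (suc n) a = ≡.cong (L._∷ L.[]) (mvMap-const n a)

  module _ (f-hom : IsHomomorphism R S f) where

    mvMap-hom : ∀ n → IsHomomorphism (RMv.mvRing n) (SMv.mvRing n) (mvMap n)
    mvMap-hom zero    = f-hom
    mvMap-hom (suc n) = map-hom (RMv.mvRing n) (SMv.mvRing n) (mvMap-hom n)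

    mvMap-var : ∀ n (i : Fin n) → SMv.Mv._≈_ n (mvMap n (R[x].var i)) (S[x].var i)
    mvMap-var (suc n) zero zero          =
      Homomorphism.0#-homo (RMv.mvRing n) (SMv.mvRing n) (mvMap-hom n)
    mvMap-var (suc n) zero (suc zero)    =
      Homomorphism.1#-homo (RMv.mvRing n) (SMv.mvRing n) (mvMap-hom n)
    mvMap-var (suc n) zero (suc (suc k)) = SMv.Mv.refl n
    mvMap-var (suc n) (suc i) zero       = mvMap-var n i
    mvMap-var (suc n) (suc i) (suc k)    = SMv.Mv.refl n

    coefficient-mvMap : ∀ n P α →
      S[x].coefficient n (mvMap n P) α S.≈ f (R[x].coefficient n P α)
    coefficient-mvMap zero    P α = S.refl
    coefficient-mvMap (suc n) P α = S.trans
      (SMv.coefficient-cong n (coeff-map (RMv.mvRing n) (SMv.mvRing n) (mvMap-hom n) P (head α)) (tail α))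
      (coefficient-mvMap n _ (tail α))

-- Determinants as alternating multilinear functions

punchIn-inject₁ : ∀ {n} (i k : Fin n) → k ≢ i → punchIn (inject₁ i) k ≡ punchIn (suc i) k
punchIn-inject₁ zero    zero    k≢i = contradiction ≡.refl k≢i
punchIn-inject₁ zero    (suc k) k≢i = ≡.refl
punchIn-inject₁ (suc i) zero    k≢i = ≡.refl
punchIn-inject₁ (suc i) (suc k) k≢i = ≡.cong suc (punchIn-inject₁ i k (k≢i ∘ ≡.cong suc))

-- Position i is the only one at which deleting column i and deleting column i + 1 differ: it then
-- holds i + 1 or i. Hence equal adjacent columns have equal minors.
punchIn-inject₁-self : ∀ {n} (i : Fin n) → punchIn (inject₁ i) i ≡ suc i
punchIn-inject₁-self zero    = ≡.refl
punchIn-inject₁-self (suc i) = ≡.cong suc (punchIn-inject₁-self i)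

punchIn-suc-self : ∀ {n} (i : Fin n) → punchIn (suc i) i ≡ inject₁ i
punchIn-suc-self zero    = ≡.refl
punchIn-suc-self (suc i) = ≡.cong suc (punchIn-suc-self i)

-- Deleting a column away from an adjacent pair leaves the pair adjacent, so the induction of
-- `det-adjacentColumns` applies to that minor.
punchIn-adjacent : ∀ {n} (k : Fin (2 ℕ.+ n)) (i : Fin (suc n)) → k ≢ inject₁ i → k ≢ suc i →
  ∃ λ (i′ : Fin n) → punchIn k (inject₁ i′) ≡ inject₁ i × punchIn k (suc i′) ≡ suc i
punchIn-adjacent zero zero    k≢ k≢′ = contradiction ≡.refl k≢
punchIn-adjacent zero (suc i) k≢ k≢′ = i , ≡.refl , ≡.refl
punchIn-adjacent (suc zero) zero k≢ k≢′ = contradiction ≡.refl k≢′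
punchIn-adjacent {suc n} (suc (suc k)) zero k≢ k≢′ = zero , ≡.refl , ≡.refl
punchIn-adjacent {suc n} (suc k) (suc i) k≢ k≢′ =
  let (i′ , e , e′) = punchIn-adjacent k i (k≢ ∘ ≡.cong suc) (k≢′ ∘ ≡.cong suc)
  in suc i′ , ≡.cong suc e , ≡.cong suc e′

module Determinant {c ℓ} (R : CommutativeRing c ℓ) where
  open CommutativeRing R hiding (zero)
  open SemiringSum semiring
  open RawSemiringDefinitions (RawRing.rawSemiring rawRing) using (_^_)
  open RingProperties ring using (-1*x≈-x; -0#≈0#; x+x≈x⇒x≈0)
  open Solver commutativeSemiring using (solve; _:=_; _:+_; _:*_; con)
  open SetoidReasoning setoid

  Mat : ℕ → Set c
  Mat n = Matrix Carrier n n

  infix 4 _≋_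
  _≋_ : ∀ {m n} → Matrix Carrier m n → Matrix Carrier m n → Set ℓ
  A ≋ B = ∀ i j → A i j ≈ B i j

  infixl 7 _⊡_
  _⊡_ : ∀ {l m n} → Matrix Carrier l m → Matrix Carrier m n → Matrix Carrier l n
  (A ⊡ B) i j = sum λ k → A i k * B k j

  δ : ∀ {n} → Mat n
  δ i j with i Fin.≟ j
  ... | yes _ = 1#
  ... | no  _ = 0#

  δ-diag : ∀ {n} (i : Fin n) → δ i i ≈ 1#
  δ-diag i with i Fin.≟ i
  ... | yes _  = refl
  ... | no i≢i = contradiction ≡.refl i≢i

  δ-off : ∀ {n} {i j : Fin n} → i ≢ j → δ i j ≈ 0#
  δ-off {i = i} {j} i≢j with i Fin.≟ j
  ... | yes i≡j = contradiction i≡j i≢j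
  ... | no  _   = refl

  δ-injection : ∀ {m n} (f : Fin m → Fin n) → (∀ {i j} → f i ≡ f j → i ≡ j) →
    ∀ i j → δ (f i) (f j) ≈ δ i j
  δ-injection f f-injective i j = go (i Fin.≟ j)
    where
    go : Dec (i ≡ j) → δ (f i) (f j) ≈ δ i j
    go (yes ≡.refl) = trans (δ-diag (f i)) (sym (δ-diag i))
    go (no i≢j)     = trans (δ-off (i≢j ∘ f-injective)) (sym (δ-off i≢j))

  δ-sym : ∀ {n} (i j : Fin n) → δ i j ≈ δ j i
  δ-sym i j = go (i Fin.≟ j)
    where
    go : Dec (i ≡ j) → δ i j ≈ δ j i
    go (yes ≡.refl) = refl
    go (no i≢j)     = trans (δ-off i≢j) (sym (δ-off (i≢j ∘ ≡.sym)))

  sum-zero : ∀ {n} (f : Vector Carrier n) → (∀ i → f i ≈ 0#) → sum f ≈ 0#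
  sum-zero {n} f f≈0 = trans (sum-cong-≋ f≈0) (sum-replicate-zero n)

  sum-single : ∀ {n} (f : Vector Carrier n) i → (∀ j → j ≢ i → f j ≈ 0#) → sum f ≈ f i
  sum-single {suc n} f i f≈0 = begin
    sum f                    ≈⟨ sum-remove {i = i} f ⟩
    f i + sum (removeAt f i) ≈⟨ +-congˡ (sum-zero _ λ j → f≈0 _ (Fin.punchInᵢ≢i i j)) ⟩
    f i + 0#                 ≈⟨ +-identityʳ _ ⟩
    f i                      ∎

  sum-δˡ : ∀ {n} (f : Vector Carrier n) i → sum (λ j → δ i j * f j) ≈ f i
  sum-δˡ f i = trans
    (sum-single _ i λ j j≢i → trans (*-congʳ (δ-off (j≢i ∘ ≡.sym))) (zeroˡ _))
    (trans (*-congʳ (δ-diag i)) (*-identityˡ _))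

  sum-δʳ : ∀ {n} (f : Vector Carrier n) i → sum (λ j → f j * δ j i) ≈ f i
  sum-δʳ f i = trans
    (sum-single _ i λ j j≢i → trans (*-congˡ (δ-off j≢i)) (zeroʳ _))
    (trans (*-congˡ (δ-diag i)) (*-identityʳ _))

  sum-linear : ∀ {n} a (f g : Vector Carrier n) →
    sum (λ i → a * f i + g i) ≈ a * sum f + sum g
  sum-linear a f g = trans (∑-distrib-+ (λ i → a * f i) g) (+-congʳ (sym (*-distribˡ-sum a f)))

  D : ∀ {n} → Mat n → Carrier
  D = det rawRing

  sign : ∀ {n} → Fin n → Carrier
  sign j = (- 1#) ^ toℕ j

  minor : ∀ {n} → Mat (suc n) → Fin (suc n) → Mat n
  minor M j i = removeAt (M (suc i)) j

  det-cong : ∀ {n} {M N : Mat n} → M ≋ N → D M ≈ D N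
  det-cong {zero}  e = refl
  det-cong {suc n} {M} {N} e = sum-cong-≋ {x = term M} {y = term N} λ j →
    *-cong (*-congˡ (e zero j)) (det-cong λ i k → e (suc i) (punchIn j k))
    where
    term : Mat (suc n) → Vector Carrier (suc n)
    term M j = (sign j * M zero j) * D (minor M j)

  -- Additivity and homogeneity in row i form one clause, a relation between three matrices given
  -- entrywise. It contains no row update and so applies to any matrices with the right entries.
  record Alternating {n} (F : Mat n → Carrier) : Set (c ⊔ ℓ) where
    field
      cong        : ∀ {M N} → M ≋ N → F M ≈ F N
      linear      : ∀ i a {X Y Z} → (∀ j → X i j ≈ a * Y i j + Z i j) →
                    (∀ k → k ≢ i → ∀ j → X k j ≈ Y k j) →
                    (∀ k → k ≢ i → ∀ j → X k j ≈ Z k j) →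
                    F X ≈ a * F Y + F Z
      alternating : ∀ {i j} X → i ≢ j → (∀ k → X i k ≈ X j k) → F X ≈ 0#

  private
    sum-adjacent : ∀ {n} (f : Vector Carrier (suc n)) (i : Fin n) →
      f (inject₁ i) + f (suc i) ≈ 0# →
      (∀ k → k ≢ inject₁ i → k ≢ suc i → f k ≈ 0#) → sum f ≈ 0#
    sum-adjacent {suc n} f zero e f≈0 = begin
      f zero + (f (suc zero) + sum (λ k → f (suc (suc k)))) ≈⟨ +-assoc _ _ _ ⟨
      f zero + f (suc zero) + sum (λ k → f (suc (suc k)))   ≈⟨ +-cong e (sum-zero _ λ k → f≈0 (suc (suc k)) (λ ()) (λ ())) ⟩
      0# + 0#                                               ≈⟨ +-identityˡ 0# ⟩
      0#                                                    ∎
    sum-adjacent {suc n} f (suc i) e f≈0 = trans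
      (+-cong (f≈0 zero (λ ()) (λ ()))
        (sum-adjacent (tail f) i e λ k p q → f≈0 (suc k) (p ∘ Fin.suc-injective) (q ∘ Fin.suc-injective)))
      (+-identityˡ 0#)

    toℕ-adjacent : ∀ {n} (i : Fin n) → sign (inject₁ i) * - 1# ≈ sign (suc i)
    toℕ-adjacent i rewrite Fin.toℕ-inject₁ i = *-comm _ _

  -- In the expansion along the first row, column i enters the term of j through the entry (j = i)
  -- or through the minor (j ≠ i, by induction), never through both.
  det-columnLinear : ∀ {n} (i : Fin n) a {X Y Z : Mat n} → (∀ j → X j i ≈ a * Y j i + Z j i) →
    (∀ k → k ≢ i → ∀ j → X j k ≈ Y j k) → (∀ k → k ≢ i → ∀ j → X j k ≈ Z j k) →
    D X ≈ a * D Y + D Z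
  det-columnLinear {suc n} i a {X} {Y} {Z} eᵢ eY eZ = trans (sum-cong-≋ term) (sum-linear a (t Y) (t Z))
    where
    t : Mat (suc n) → Vector Carrier (suc n)
    t M j = (sign j * M zero j) * D (minor M j)
    term : ∀ j → t X j ≈ a * t Y j + t Z j
    term j with j Fin.≟ i
    ... | yes ≡.refl = begin
      (sign j * X zero j) * D (minor X j)
        ≈⟨ *-congʳ (*-congˡ (eᵢ zero)) ⟩
      (sign j * (a * Y zero j + Z zero j)) * D (minor X j)
        ≈⟨ solve 5 (λ s a y z d → (s :* (a :* y :+ z)) :* d := a :* ((s :* y) :* d) :+ (s :* z) :* d)
             refl (sign j) a (Y zero j) (Z zero j) (D (minor X j)) ⟩
      a * ((sign j * Y zero j) * D (minor X j)) + (sign j * Z zero j) * D (minor X j)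
        ≈⟨ +-cong (*-congˡ (*-congˡ (det-cong λ p q → eY _ (Fin.punchInᵢ≢i j q) (suc p))))
                  (*-congˡ (det-cong λ p q → eZ _ (Fin.punchInᵢ≢i j q) (suc p))) ⟩
      a * t Y j + t Z j ∎
    ... | no j≢i = begin
      (sign j * X zero j) * D (minor X j)
        ≈⟨ *-congˡ minors ⟩
      (sign j * X zero j) * (a * D (minor Y j) + D (minor Z j))
        ≈⟨ solve 5 (λ s x a p q → (s :* x) :* (a :* p :+ q) := a :* ((s :* x) :* p) :+ (s :* x) :* q)
             refl (sign j) (X zero j) a (D (minor Y j)) (D (minor Z j)) ⟩
      a * ((sign j * X zero j) * D (minor Y j)) + (sign j * X zero j) * D (minor Z j)
        ≈⟨ +-cong (*-congˡ (*-congʳ (*-congˡ (eY j j≢i zero)))) (*-congʳ (*-congˡ (eZ j j≢i zero))) ⟩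
      a * t Y j + t Z j ∎
      where
      i′ = punchOut j≢i
      i′-eq : punchIn j i′ ≡ i
      i′-eq = Fin.punchIn-punchOut j≢i
      off : ∀ k → k ≢ i′ → punchIn j k ≢ i
      off k k≢ e = k≢ (Fin.punchIn-injective j k i′ (≡.trans e (≡.sym i′-eq)))
      minors : D (minor X j) ≈ a * D (minor Y j) + D (minor Z j)
      minors = det-columnLinear i′ a
        (λ p → ≡.subst (λ q → X (suc p) q ≈ a * Y (suc p) q + Z (suc p) q) (≡.sym i′-eq) (eᵢ (suc p)))
        (λ k k≢ p → eY _ (off k k≢) (suc p)) (λ k k≢ p → eZ _ (off k k≢) (suc p))

  -- The terms of the two equal columns have equal minors and opposite signs; every other minor
  -- again has two equal adjacent columns.
  det-adjacentColumns : ∀ {n} (i : Fin n) (X : Mat (suc n)) →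
    (∀ k → X k (inject₁ i) ≈ X k (suc i)) → D X ≈ 0#
  det-adjacentColumns {suc n} i X e = sum-adjacent _ i cancel vanish
    where
    minors : minor X (inject₁ i) ≋ minor X (suc i)
    minors p k with k Fin.≟ i
    ... | no k≢i     = reflexive (≡.cong (X (suc p)) (punchIn-inject₁ i k k≢i))
    ... | yes ≡.refl = begin
      X (suc p) (punchIn (inject₁ k) k) ≈⟨ reflexive (≡.cong (X (suc p)) (punchIn-inject₁-self k)) ⟩
      X (suc p) (suc k)                 ≈⟨ e (suc p) ⟨
      X (suc p) (inject₁ k)             ≈⟨ reflexive (≡.cong (X (suc p)) (punchIn-suc-self k)) ⟨
      X (suc p) (punchIn (suc k) k)     ∎
    cancel : (sign (inject₁ i) * X zero (inject₁ i)) * D (minor X (inject₁ i)) +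
             (sign (suc i) * X zero (suc i)) * D (minor X (suc i)) ≈ 0#
    cancel = begin
      (sign (inject₁ i) * X zero (inject₁ i)) * D (minor X (inject₁ i)) +
      (sign (suc i) * X zero (suc i)) * D (minor X (suc i))
        ≈⟨ +-cong (*-cong (*-congˡ (e zero)) (det-cong minors)) (*-congʳ (*-congʳ (sym (toℕ-adjacent i)))) ⟩
      (s * x) * d + ((s * - 1#) * x) * d
        ≈⟨ solve 4 (λ s x d m → (s :* x) :* d :+ ((s :* m) :* x) :* d := (con 1 :+ m) :* ((s :* x) :* d))
             refl s x d (- 1#) ⟩
      (1# + - 1#) * ((s * x) * d) ≈⟨ *-congʳ (-‿inverseʳ 1#) ⟩
      0# * ((s * x) * d)          ≈⟨ zeroˡ _ ⟩
      0#                          ∎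
      where
      s = sign (inject₁ i)
      x = X zero (suc i)
      d = D (minor X (suc i))
    vanish : ∀ k → k ≢ inject₁ i → k ≢ suc i → (sign k * X zero k) * D (minor X k) ≈ 0#
    vanish k p q =
      let (i′ , e₁ , e₂) = punchIn-adjacent k i p q in
      trans (*-congˡ (det-adjacent′ k i′ e₁ e₂)) (zeroʳ _)
      where
      det-adjacent′ : ∀ k i′ → punchIn k (inject₁ i′) ≡ inject₁ i → punchIn k (suc i′) ≡ suc i →
                      D (minor X k) ≈ 0#
      det-adjacent′ k i′ e₁ e₂ = det-adjacentColumns i′ (minor X k) λ p → begin
        X (suc p) (punchIn k (inject₁ i′)) ≡⟨ ≡.cong (X (suc p)) e₁ ⟩
        X (suc p) (inject₁ i)              ≈⟨ e (suc p) ⟩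
        X (suc p) (suc i)                  ≡⟨ ≡.cong (X (suc p)) e₂ ⟨
        X (suc p) (punchIn k (suc i′))     ∎

  infixl 6 _[_]≔_
  _[_]≔_ : ∀ {m n} → Matrix Carrier m n → Fin m → Vector Carrier n → Matrix Carrier m n
  (X [ i ]≔ v) k with k Fin.≟ i
  ... | yes _ = v
  ... | no  _ = X k

  set-at : ∀ {m n} (X : Matrix Carrier m n) i v j → (X [ i ]≔ v) i j ≈ v j
  set-at X i v j with i Fin.≟ i
  ... | yes _  = refl
  ... | no i≢i = contradiction ≡.refl i≢i

  set-off : ∀ {m n} (X : Matrix Carrier m n) {i k} v j → k ≢ i → (X [ i ]≔ v) k j ≈ X k j
  set-off X {i} {k} v j k≢i with k Fin.≟ i
  ... | yes k≡i = contradiction k≡i k≢i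
  ... | no  _   = refl

  module _ {n} {F : Mat n → Carrier}
    (F-cong : ∀ {M N} → M ≋ N → F M ≈ F N)
    (F-linear : ∀ i a {X Y Z} → (∀ j → X i j ≈ a * Y i j + Z i j) →
                (∀ k → k ≢ i → ∀ j → X k j ≈ Y k j) →
                (∀ k → k ≢ i → ∀ j → X k j ≈ Z k j) → F X ≈ a * F Y + F Z) where

    -- Expanding F at the matrix with u + v in both places leaves only the two mixed terms.
    -- Alternation is assumed for the pair i, j alone, because `adjacent⇒alternating` uses this
    -- before it is known for other pairs.
    swap-rows : ∀ {i j} → i ≢ j → (∀ X → (∀ k → X i k ≈ X j k) → F X ≈ 0#) →
      ∀ {X Y} → (∀ k → X i k ≈ Y j k) → (∀ k → X j k ≈ Y i k) →
      (∀ l → l ≢ i → l ≢ j → ∀ k → X l k ≈ Y l k) → F X ≈ - F Y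
    swap-rows {i} {j} i≢j alt {X} {Y} e₁ e₂ e₃ = begin
      F X                      ≈⟨ +-identityʳ _ ⟨
      F X + 0#                 ≈⟨ +-congˡ (-‿inverseʳ (F Y)) ⟨
      F X + (F Y + - F Y)      ≈⟨ +-assoc _ _ _ ⟨
      F X + F Y + - F Y        ≈⟨ +-congʳ X+Y≈0 ⟩
      0# + - F Y               ≈⟨ +-identityˡ _ ⟩
      - F Y                    ∎
      where
      u = X i
      v = X j
      P : Vector Carrier n → Vector Carrier n → Mat n
      P s t = X [ i ]≔ s [ j ]≔ t
      P-i : ∀ s t k → P s t i k ≈ s k
      P-i s t k = trans (set-off _ t k i≢j) (set-at X i s k)
      P-j : ∀ s t k → P s t j k ≈ t k
      P-j s t k = set-at _ j t k
      P-off : ∀ s t l → l ≢ i → l ≢ j → ∀ k → P s t l k ≈ X l k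
      P-off s t l l≢i l≢j k = trans (set-off _ t k l≢j) (set-off X s k l≢i)
      w : Vector Carrier n
      w k = 1# * u k + v k
      rows : ∀ {s s′ t t′} l → (l ≡ i → ∀ k → s k ≈ s′ k) → (l ≡ j → ∀ k → t k ≈ t′ k) →
             ∀ k → P s t l k ≈ P s′ t′ l k
      rows {s} {s′} {t} {t′} l p q k = go (l Fin.≟ j) (l Fin.≟ i)
        where
        go : Dec (l ≡ j) → Dec (l ≡ i) → P s t l k ≈ P s′ t′ l k
        go (yes ≡.refl) _ = trans (P-j s t k) (trans (q ≡.refl k) (sym (P-j s′ t′ k)))
        go (no _) (yes ≡.refl) = trans (P-i s t k) (trans (p ≡.refl k) (sym (P-i s′ t′ k)))
        go (no l≢j) (no l≢i) = trans (P-off s t l l≢i l≢j k) (sym (P-off s′ t′ l l≢i l≢j k))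
      split-i : ∀ t → F (P w t) ≈ F (P u t) + F (P v t)
      split-i t = trans
        (F-linear i 1# {P w t} {P u t} {P v t}
          (λ k → trans (P-i w t k) (sym (+-cong (*-congˡ (P-i u t k)) (P-i v t k))))
          (λ l l≢i → rows {w} {u} {t} {t} l (λ e → contradiction e l≢i) (λ _ _ → refl))
          (λ l l≢i → rows {w} {v} {t} {t} l (λ e → contradiction e l≢i) (λ _ _ → refl)))
        (+-congʳ (*-identityˡ _))
      split-j : ∀ s → F (P s w) ≈ F (P s u) + F (P s v)
      split-j s = trans
        (F-linear j 1# {P s w} {P s u} {P s v}
          (λ k → trans (P-j s w k) (sym (+-cong (*-congˡ (P-j s u k)) (P-j s v k))))
          (λ l l≢j → rows {s} {s} {w} {u} l (λ _ _ → refl) (λ e → contradiction e l≢j))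
          (λ l l≢j → rows {s} {s} {w} {v} l (λ _ _ → refl) (λ e → contradiction e l≢j)))
        (+-congʳ (*-identityˡ _))
      diagonal : ∀ s → F (P s s) ≈ 0#
      diagonal s = alt _ λ k → trans (P-i s s k) (sym (P-j s s k))
      F-uv : F (P u v) ≈ F X
      F-uv = F-cong λ l k → go l k (l Fin.≟ j) (l Fin.≟ i)
        where
        go : ∀ l k → Dec (l ≡ j) → Dec (l ≡ i) → P u v l k ≈ X l k
        go l k (yes ≡.refl) _ = P-j u v k
        go l k (no _) (yes ≡.refl) = P-i u v k
        go l k (no l≢j) (no l≢i) = P-off u v l l≢i l≢j k
      F-vu : F (P v u) ≈ F Y
      F-vu = F-cong λ l k → go l k (l Fin.≟ j) (l Fin.≟ i)
        where
        go : ∀ l k → Dec (l ≡ j) → Dec (l ≡ i) → P v u l k ≈ Y l k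
        go l k (yes ≡.refl) _ = trans (P-j v u k) (e₁ k)
        go l k (no _) (yes ≡.refl) = trans (P-i v u k) (e₂ k)
        go l k (no l≢j) (no l≢i) = trans (P-off v u l l≢i l≢j k) (e₃ l l≢i l≢j k)
      X+Y≈0 : F X + F Y ≈ 0#
      X+Y≈0 = begin
        F X + F Y                                             ≈⟨ +-cong F-uv F-vu ⟨
        F (P u v) + F (P v u)                                 ≈⟨ +-cong (+-identityˡ _) (+-identityʳ _) ⟨
        (0# + F (P u v)) + (F (P v u) + 0#)                   ≈⟨ +-cong (+-congʳ (diagonal u)) (+-congˡ (diagonal v)) ⟨
        (F (P u u) + F (P u v)) + (F (P v u) + F (P v v))     ≈⟨ +-cong (split-j u) (split-j v) ⟨
        F (P u w) + F (P v w)                                 ≈⟨ split-i w ⟨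
        F (P w w)                                             ≈⟨ diagonal w ⟩
        0#                                                    ∎

  -- It is enough to be alternating on adjacent rows: equal rows at a distance are
  -- moved together by adjacent swaps.
  adjacent⇒alternating : ∀ {n} {F : Mat (suc n) → Carrier} →
    (∀ {M N} → M ≋ N → F M ≈ F N) →
    (∀ i a {X Y Z} → (∀ j → X i j ≈ a * Y i j + Z i j) →
      (∀ k → k ≢ i → ∀ j → X k j ≈ Y k j) →
      (∀ k → k ≢ i → ∀ j → X k j ≈ Z k j) → F X ≈ a * F Y + F Z) →
    (∀ i X → (∀ k → X (inject₁ i) k ≈ X (suc i) k) → F X ≈ 0#) →
    Alternating F
  adjacent⇒alternating {n} {F} F-cong F-linear F-adjacent = record
    { cong = F-cong ; linear = F-linear ; alternating = λ {i} {j} → distinct {i} {j} }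
    where
    below : ∀ j i → toℕ i ℕ.< toℕ j → ∀ X → (∀ k → X i k ≈ X j k) → F X ≈ 0#
    below = <-weakInduction _ (λ _ ()) step
      where
      step : ∀ j → (∀ i → toℕ i ℕ.< toℕ (inject₁ j) → ∀ X → (∀ k → X i k ≈ X (inject₁ j) k) → F X ≈ 0#) →
             ∀ i → toℕ i ℕ.< suc (toℕ j) → ∀ X → (∀ k → X i k ≈ X (suc j) k) → F X ≈ 0#
      step j ih i i<j X e with i Fin.≟ inject₁ j
      ... | yes ≡.refl = F-adjacent j X e
      ... | no  i≢     = begin
        F X    ≈⟨ swap-rows F-cong F-linear j≢ (F-adjacent j) {X} {Y}
                    (λ k → sym (set-at _ (suc j) _ k))
                    (λ k → sym (trans (set-off _ _ k j≢) (set-at X (inject₁ j) _ k)))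
                    (λ l p q k → sym (trans (set-off _ _ k q) (set-off X _ k p))) ⟩
        - F Y  ≈⟨ -‿cong (ih i i<′ Y λ k → trans
                    (trans (set-off _ _ k i≢s) (set-off X _ k i≢))
                    (trans (e k) (sym (trans (set-off _ _ k j≢) (set-at X (inject₁ j) _ k))))) ⟩
        - 0#   ≈⟨ -0#≈0# ⟩
        0#     ∎
        where
        Y = X [ inject₁ j ]≔ X (suc j) [ suc j ]≔ X (inject₁ j)
        j≢ : inject₁ j ≢ suc j
        j≢ p = ℕ.m≢1+m+n (toℕ j) {0} (≡.trans (≡.sym (Fin.toℕ-inject₁ j))
                 (≡.trans (≡.cong toℕ p) (≡.cong suc (≡.sym (ℕ.+-identityʳ _)))))
        i≢s : i ≢ suc j
        i≢s ≡.refl = ℕ.<-irrefl ≡.refl i<j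
        i<′ : toℕ i ℕ.< toℕ (inject₁ j)
        i<′ = ℕ.≤∧≢⇒< (≡.subst (toℕ i ℕ.≤_) (≡.sym (Fin.toℕ-inject₁ j)) (ℕ.≤-pred i<j))
                (i≢ ∘ Fin.toℕ-injective)
    distinct : ∀ {i j} X → i ≢ j → (∀ k → X i k ≈ X j k) → F X ≈ 0#
    distinct {i} {j} X i≢j e with ℕ.<-cmp (toℕ i) (toℕ j)
    ... | tri< i<j _ _ = below j i i<j X e
    ... | tri≈ _ i≡j _ = contradiction (Fin.toℕ-injective i≡j) i≢j
    ... | tri> _ _ j<i = below i j j<i X (λ k → sym (e k))

  -- Expansion along the first row gives access to the columns, so the row properties are first
  -- shown for the transpose; `alternating-unique` then identifies this function with the
  -- determinant.
  det-transpose-alternating : ∀ {n} → Alternating {n} (λ M → D (transpose M))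
  det-transpose-alternating {zero} = record
    { cong        = λ _ → refl
    ; linear      = λ ()
    ; alternating = λ { {()} }
    }
  det-transpose-alternating {suc n} = adjacent⇒alternating
    (λ e → det-cong λ i j → e j i)
    (λ i a e p q → det-columnLinear i a e p q)
    (λ i X → det-adjacentColumns i (transpose X))

  insertAt-cong : ∀ {n} {u v : Vector Carrier n} (j : Fin (suc n)) → (∀ k → u k ≈ v k) →
    ∀ k → insertAt u j 0# k ≈ insertAt v j 0# k
  insertAt-cong zero            e zero    = refl
  insertAt-cong zero            e (suc k) = e k
  insertAt-cong {suc n} (suc j) e zero    = e zero
  insertAt-cong {suc n} (suc j) e (suc k) = insertAt-cong {n} j (λ l → e (suc l)) k

  insertAt-linear : ∀ {n} {u v w : Vector Carrier n} (j : Fin (suc n)) a →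
    (∀ k → u k ≈ a * v k + w k) →
    ∀ k → insertAt u j 0# k ≈ a * insertAt v j 0# k + insertAt w j 0# k
  insertAt-linear zero            a e zero    = sym (trans (+-identityʳ _) (zeroʳ a))
  insertAt-linear zero            a e (suc k) = e k
  insertAt-linear {suc n} (suc j) a e zero    = e zero
  insertAt-linear {suc n} (suc j) a e (suc k) = insertAt-linear {n} j a (λ l → e (suc l)) k

  insertAt-punchIn : ∀ {n} (u : Vector Carrier n) j (k : Fin n) → insertAt u j 0# (punchIn j k) ≈ u k
  insertAt-punchIn u zero    k       = refl
  insertAt-punchIn u (suc j) zero    = refl
  insertAt-punchIn u (suc j) (suc k) = insertAt-punchIn (tail u) j k

  private
    -- Rows are exchanged from the top; those already exchanged are absorbed into G.
    replace-rows : ∀ {m n} (G : Matrix Carrier m n → Carrier) →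
      (∀ {A B} → A ≋ B → G A ≈ G B) →
      (_~_ : Vector Carrier n → Vector Carrier n → Set ℓ) →
      (∀ i {A B} → A i ~ B i → (∀ k → k ≢ i → ∀ j → A k j ≈ B k j) → G A ≈ G B) →
      ∀ {A B} → (∀ i → A i ~ B i) → G A ≈ G B
    replace-rows {zero}  G G-cong _~_ step e = G-cong λ ()
    replace-rows {suc m} G G-cong _~_ step {A} {B} e = begin
      G A                      ≈⟨ step zero (e zero) (λ { zero p → contradiction ≡.refl p ; (suc k) p j → refl }) ⟩
      G (B zero Vec.∷ tail A)  ≈⟨ replace-rows (λ C → G (B zero Vec.∷ C))
                                    (λ e → G-cong λ { zero j → refl ; (suc i) → e i }) _~_
                                    (λ i r p → step (suc i) r λ { zero q j → refl ; (suc k) q → p k (q ∘ ≡.cong suc) })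
                                    (λ i → e (suc i)) ⟩
      G (B zero Vec.∷ tail B)  ≈⟨ G-cong (λ { zero j → refl ; (suc i) j → refl }) ⟩
      G B                      ∎

  module _ {n} {F : Mat (suc n) → Carrier} (alt : Alternating F) where
    open Alternating alt

    private
      -- Outside column j the rows of A and B agree, so they differ by multiples of the top row δ j.
      -- The term carrying such a multiple has two equal rows.
      clear : ∀ j {A B : Matrix Carrier n (suc n)} → (∀ i k → k ≢ j → A i k ≈ B i k) →
              F (δ j Vec.∷ A) ≈ F (δ j Vec.∷ B)
      clear j = replace-rows (λ A → F (δ j Vec.∷ A))
        (λ e → cong λ { zero k → refl ; (suc i) → e i })
        (λ u v → ∀ k → k ≢ j → u k ≈ v k) step
        where
        step : ∀ i {A B} → (∀ k → k ≢ j → A i k ≈ B i k) → (∀ k → k ≢ i → ∀ l → A k l ≈ B k l) →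
               F (δ j Vec.∷ A) ≈ F (δ j Vec.∷ B)
        step i {A} {B} e off = begin
          F (δ j Vec.∷ A)
            ≈⟨ linear (suc i) (A i j + - B i j) {δ j Vec.∷ A} {Y} {δ j Vec.∷ B}
                 row-i (λ { zero _ k → refl ; (suc l) p k → sym (set-off A (δ j) k (p ∘ ≡.cong suc)) })
                 (λ { zero _ k → refl ; (suc l) p k → off l (p ∘ ≡.cong suc) k }) ⟩
          (A i j + - B i j) * F Y + F (δ j Vec.∷ B)
            ≈⟨ +-congʳ (trans (*-congˡ (alternating {zero} {suc i} Y (λ ()) λ k → sym (set-at A i (δ j) k))) (zeroʳ _)) ⟩
          0# + F (δ j Vec.∷ B)
            ≈⟨ +-identityˡ _ ⟩
          F (δ j Vec.∷ B) ∎
          where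
          Y = δ j Vec.∷ (A [ i ]≔ δ j)
          row-i : ∀ k → A i k ≈ (A i j + - B i j) * Y (suc i) k + B i k
          row-i k = trans (go (k Fin.≟ j)) (+-congʳ (*-congˡ (sym (set-at A i (δ j) k))))
            where
            go : Dec (k ≡ j) → A i k ≈ (A i j + - B i j) * δ j k + B i k
            go (yes ≡.refl) = sym (begin
              (A i k + - B i k) * δ k k + B i k ≈⟨ +-congʳ (trans (*-congˡ (δ-diag k)) (*-identityʳ _)) ⟩
              A i k + - B i k + B i k           ≈⟨ +-assoc _ _ _ ⟩
              A i k + (- B i k + B i k)         ≈⟨ +-congˡ (-‿inverseˡ _) ⟩
              A i k + 0#                        ≈⟨ +-identityʳ _ ⟩
              A i k                             ∎)
            go (no k≢j) = trans (e k k≢j) (sym (trans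
              (+-congʳ (trans (*-congˡ (δ-off (k≢j ∘ ≡.sym))) (zeroʳ _))) (+-identityˡ _)))

    insert : Fin (suc n) → Mat n → Mat (suc n)
    insert j N = δ j Vec.∷ λ i → insertAt (N i) j 0#

    insert-alternating : ∀ j → Alternating (λ N → F (insert j N))
    insert-alternating j = record
      { cong = λ e → cong λ { zero k → refl ; (suc i) k → insertAt-cong j (e i) k }
      ; linear = λ i a {X} {Y} {Z} e p q → linear (suc i) a {insert j X} {insert j Y} {insert j Z} (insertAt-linear j a e)
          (λ { zero _ k → refl ; (suc l) r → insertAt-cong j (p l (r ∘ ≡.cong suc)) })
          (λ { zero _ k → refl ; (suc l) r → insertAt-cong j (q l (r ∘ ≡.cong suc)) })
      ; alternating = λ {i} {i′} X i≢i′ e →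
          alternating {suc i} {suc i′} (insert j X) (i≢i′ ∘ Fin.suc-injective) (insertAt-cong j e)
      }

    minor-insert : ∀ j (B : Matrix Carrier n (suc n)) →
      F (δ j Vec.∷ B) ≈ F (insert j λ i → removeAt (B i) j)
    minor-insert j B = clear j λ i k k≢j → go i k (k≢j ∘ ≡.sym)
      where
      go : ∀ i k (j≢k : j ≢ k) → B i k ≈ insertAt (removeAt (B i) j) j 0# k
      go i k j≢k = begin
        B i k
          ≡⟨ ≡.cong (B i) (Fin.punchIn-punchOut j≢k) ⟨
        B i (punchIn j (punchOut j≢k))
          ≈⟨ insertAt-punchIn (removeAt (B i) j) j (punchOut j≢k) ⟨
        insertAt (removeAt (B i) j) j 0# (punchIn j (punchOut j≢k))
          ≡⟨ ≡.cong (insertAt (removeAt (B i) j) j 0#) (Fin.punchIn-punchOut j≢k) ⟩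
        insertAt (removeAt (B i) j) j 0# k ∎

    -- The permutation matrix of a cycle through the first j + 1 indices, of sign (-1)^j: passing
    -- from j to j + 1 exchanges the top row with row j + 1.
    cycle : Fin (suc n) → Mat (suc n)
    cycle j = δ j Vec.∷ λ i → δ (punchIn j i)

    F-cycle : ∀ j → F (cycle j) ≈ sign j * F δ
    F-cycle = <-weakInduction _
      (trans (cong λ { zero k → refl ; (suc i) k → refl }) (sym (*-identityˡ _))) step
      where
      step : ∀ j → F (cycle (inject₁ j)) ≈ sign (inject₁ j) * F δ → F (cycle (suc j)) ≈ sign (suc j) * F δ
      step j ih = begin
        F (cycle (suc j))
          ≈⟨ swap-rows cong linear {zero} {suc j} (λ ()) (λ X → alternating {zero} {suc j} X (λ ()))
               (λ k → reflexive (≡.cong (λ i → δ i k) (≡.sym (punchIn-inject₁-self j))))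
               (λ k → reflexive (≡.cong (λ i → δ i k) (punchIn-suc-self j)))
               (λ { zero p _ k → contradiction ≡.refl p
                  ; (suc l) _ p k → reflexive (≡.cong (λ i → δ i k)
                      (≡.sym (punchIn-inject₁ j l (p ∘ ≡.cong suc)))) }) ⟩
        - F (cycle (inject₁ j))              ≈⟨ -1*x≈-x _ ⟨
        - 1# * F (cycle (inject₁ j))         ≈⟨ *-congˡ ih ⟩
        - 1# * (sign (inject₁ j) * F δ)      ≈⟨ *-assoc _ _ _ ⟨
        - 1# * sign (inject₁ j) * F δ        ≈⟨ *-congʳ (trans (*-comm _ _) (toℕ-adjacent j)) ⟩
        sign (suc j) * F δ                   ∎

    insert-δ : ∀ j → F (insert j δ) ≈ sign j * F δ
    insert-δ j = trans (sym (trans (minor-insert j (λ i → δ (punchIn j i)))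
        (cong λ { zero k → refl ; (suc i) → collapse i })))
      (F-cycle j)
      where
      collapse : ∀ i k → insertAt (removeAt (δ (punchIn j i)) j) j 0# k ≈ insertAt (δ i) j 0# k
      collapse i = insertAt-cong j (δ-injection (punchIn j) (λ {i} {k} → Fin.punchIn-injective j i k) i)

    row-expand : ∀ {m} (a : Vector Carrier m) (V : Vector (Vector Carrier (suc n)) m) (B : Matrix Carrier n (suc n)) →
      F ((λ k → sum λ j → a j * V j k) Vec.∷ B) ≈ sum λ j → a j * F (V j Vec.∷ B)
    row-expand {zero} a V B = begin
      -- The zero row is 1 · 0 + 0, so linearity makes the value equal to its own double.
      F (z Vec.∷ B)                                ≈⟨ x+x≈x⇒x≈0 _ (begin
        F (z Vec.∷ B) + F (z Vec.∷ B)               ≈⟨ +-congʳ (*-identityˡ _) ⟨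
        1# * F (z Vec.∷ B) + F (z Vec.∷ B)
          ≈⟨ linear zero 1# (λ j → sym (trans (+-identityʳ _) (zeroʳ _)))
               (λ { zero p k → contradiction ≡.refl p ; (suc i) p k → refl })
               (λ { zero p k → contradiction ≡.refl p ; (suc i) p k → refl }) ⟨
        F (z Vec.∷ B) ∎) ⟩
      0# ∎
      where
      z : Vector Carrier (suc n)
      z _ = 0#
    row-expand {suc m} a V B = begin
      F ((λ k → sum λ j → a j * V j k) Vec.∷ B)
        ≈⟨ linear zero (a zero) (λ j → refl)
             (λ { zero p k → contradiction ≡.refl p ; (suc i) p k → refl })
             (λ { zero p k → contradiction ≡.refl p ; (suc i) p k → refl }) ⟩
      a zero * F (V zero Vec.∷ B) + F ((λ k → sum λ j → a (suc j) * V (suc j) k) Vec.∷ B)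
        ≈⟨ +-congˡ (row-expand (tail a) (tail V) B) ⟩
      (sum λ j → a j * F (V j Vec.∷ B)) ∎

    laplace : ∀ M → F M ≈ sum λ j → M zero j * F (insert j (minor M j))
    laplace M = begin
      F M                                                   ≈⟨ cong (λ { zero k → sym (sum-δʳ (M zero) k) ; (suc i) k → refl }) ⟩
      F ((λ k → sum λ j → M zero j * δ j k) Vec.∷ tail M)   ≈⟨ row-expand (M zero) δ (tail M) ⟩
      (sum λ j → M zero j * F (δ j Vec.∷ tail M))           ≈⟨ sum-cong-≋ (λ j → *-congˡ {M zero j} (minor-insert j (tail M))) ⟩
      (sum λ j → M zero j * F (insert j (minor M j)))       ∎

  -- By `laplace`, F is a combination of the functions sending N to F (`insert` j N), which are
  -- alternating of smaller size; their values at δ differ from F δ by the sign of a cycle. Both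
  -- `det-transpose` and `det-⊡` are applications.
  alternating-unique : ∀ {n} {F : Mat n → Carrier} → Alternating F → ∀ M → F M ≈ D M * F δ
  alternating-unique {zero}  alt M = trans (Alternating.cong alt λ ()) (sym (*-identityˡ _))
  alternating-unique {suc n} {F} alt M = begin
    F M
      ≈⟨ laplace alt M ⟩
    (sum λ j → M zero j * F (insert alt j (minor M j)))
      ≈⟨ sum-cong-≋ (λ j → term j) ⟩
    (sum λ j → (sign j * M zero j) * D (minor M j) * F δ)
      ≈⟨ *-distribʳ-sum (F δ) (λ j → (sign j * M zero j) * D (minor M j)) ⟨
    D M * F δ ∎
    where
    term : ∀ j → M zero j * F (insert alt j (minor M j)) ≈ (sign j * M zero j) * D (minor M j) * F δ
    term j = begin
      M zero j * F (insert alt j (minor M j))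
        ≈⟨ *-congˡ (alternating-unique (insert-alternating alt j) (minor M j)) ⟩
      M zero j * (D (minor M j) * F (insert alt j δ))
        ≈⟨ *-congˡ (*-congˡ (insert-δ alt j)) ⟩
      M zero j * (D (minor M j) * (sign j * F δ))
        ≈⟨ solve 4 (λ m d s f → m :* (d :* (s :* f)) := (s :* m) :* d :* f)
             refl (M zero j) (D (minor M j)) (sign j) (F δ) ⟩
      (sign j * M zero j) * D (minor M j) * F δ ∎

  det-topRow : ∀ {n} (M : Mat (suc n)) a → (∀ j → M zero j ≈ a * δ zero j) → D M ≈ a * D (λ i j → M (suc i) (suc j))
  det-topRow M a e = begin
    D M
      ≈⟨ sum-single t zero (λ j j≢0 → trans (*-congʳ (trans (*-congˡ (trans (e j)
           (trans (*-congˡ (δ-off (j≢0 ∘ ≡.sym))) (zeroʳ a)))) (zeroʳ _))) (zeroˡ _)) ⟩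
    t zero
      ≈⟨ *-congʳ (trans (*-identityˡ _) (trans (e zero) (*-identityʳ a))) ⟩
    a * D (λ i j → M (suc i) (suc j)) ∎
    where
    t = λ j → (sign j * M zero j) * D (minor M j)

  det-δ : ∀ n → D (δ {n}) ≈ 1#
  det-δ zero    = refl
  det-δ (suc n) = begin
    D (δ {suc n})                                ≈⟨ det-topRow (δ {suc n}) 1# (λ j → sym (*-identityˡ _)) ⟩
    1# * D (λ (i j : Fin n) → δ (suc i) (suc j)) ≈⟨ *-identityˡ _ ⟩
    D (λ (i j : Fin n) → δ (suc i) (suc j))      ≈⟨ det-cong {n} (δ-injection suc Fin.suc-injective) ⟩
    D (δ {n})                                    ≈⟨ det-δ n ⟩
    1#                                           ∎

  det-transpose : ∀ {n} (M : Mat n) → D (transpose M) ≈ D M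
  det-transpose {n} M = begin
    D (transpose M)           ≈⟨ alternating-unique det-transpose-alternating M ⟩
    D M * D (transpose (δ {n})) ≈⟨ *-congˡ (trans (det-cong {n} (λ i j → δ-sym j i)) (det-δ n)) ⟩
    D M * 1#                  ≈⟨ *-identityʳ _ ⟩
    D M                       ∎

  det-alternating : ∀ {n} → Alternating {n} D
  det-alternating = record
    { cong        = det-cong
    ; linear      = λ i a {X} {Y} {Z} e p q → trans (sym (det-transpose X))
        (trans (linear i a {X} {Y} {Z} e p q) (+-cong (*-congˡ (det-transpose Y)) (det-transpose Z)))
    ; alternating = λ {i} {j} X i≢j e →
        trans (sym (det-transpose X)) (alternating {i} {j} X i≢j e)
    }
    where open Alternating det-transpose-alternating

  -- For fixed M, D (P ⊡ M) is alternating in the rows of P and has the value D M at P = δ.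
  det-⊡ : ∀ {n} (P M : Mat n) → D (P ⊡ M) ≈ D P * D M
  det-⊡ {n} P M = trans (alternating-unique alt P) (*-congˡ (det-cong λ i j → sum-δˡ (λ k → M k j) i))
    where
    module A = Alternating (det-alternating {n})
    row : ∀ {X Y : Mat n} {i} → (∀ j → X i j ≈ Y i j) → ∀ j → (X ⊡ M) i j ≈ (Y ⊡ M) i j
    row {X} {Y} {i} e j = sum-cong-≋ {x = λ k → X i k * M k j} λ k → *-congʳ (e k)
    alt : Alternating (λ X → D (X ⊡ M))
    alt = record
      { cong   = λ {X} {Y} e → det-cong λ i → row {X} {Y} (e i)
      ; linear = λ i a {X} {Y} {Z} e p q → A.linear i a {X ⊡ M} {Y ⊡ M} {Z ⊡ M}
          (λ j → trans (sum-cong-≋ {x = λ k → X i k * M k j} (λ k → trans (*-congʳ (e k))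
                   (trans (distribʳ _ _ _) (+-congʳ (*-assoc _ _ _)))))
                 (sum-linear a (λ k → Y i k * M k j) (λ k → Z i k * M k j)))
          (λ k k≢i → row {X} {Y} (p k k≢i)) (λ k k≢i → row {X} {Z} (q k k≢i))
      ; alternating = λ {i} {j} X i≢j e → A.alternating {i} {j} (X ⊡ M) i≢j
          λ k → sum-cong-≋ {x = λ l → X i l * M l k} λ l → *-congʳ (e l)
      }

-- Determinant identities and vanishing 2 × 2 minors

module DeterminantFormulas {c ℓ} (R : CommutativeRing c ℓ) where
  open CommutativeRing R hiding (zero)
  open SemiringSum semiring
  open Determinant R
  open Solver commutativeSemiring using (solve; _:=_; _:*_)
  open SetoidReasoning setoid

  product : ∀ {n} → Vector Carrier n → Carrier
  product = Vec.foldr _*_ 1#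

  det-scaleRows : ∀ {n} (d : Vector Carrier n) (M : Mat n) →
    D (λ i j → d i * M i j) ≈ product d * D M
  det-scaleRows {zero}  d M = sym (*-identityˡ _)
  det-scaleRows {suc n} d M = begin
    D (λ i j → d i * M i j)
      ≈⟨ sum-cong-≋ (λ j → trans
           (*-congˡ {sign j * (d zero * M zero j)} (det-scaleRows (tail d) (minor M j)))
           (solve 5 (λ s d m p x → (s :* (d :* m)) :* (p :* x) := (d :* p) :* ((s :* m) :* x))
             refl (sign j) (d zero) (M zero j) (product (tail d)) (D (minor M j)))) ⟩
    (sum λ j → product d * ((sign j * M zero j) * D (minor M j)))
      ≈⟨ *-distribˡ-sum (product d) (λ j → (sign j * M zero j) * D (minor M j)) ⟨
    product d * D M ∎

  det-scaleColumns : ∀ {n} (d : Vector Carrier n) (M : Mat n) →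
    D (λ i j → M i j * d j) ≈ product d * D M
  det-scaleColumns d M = begin
    D (λ i j → M i j * d j) ≈⟨ det-transpose (λ i j → M i j * d j) ⟨
    D (λ j i → M i j * d j) ≈⟨ det-cong (λ j i → *-comm (M i j) (d j)) ⟩
    D (λ j i → d j * M i j) ≈⟨ det-scaleRows d (transpose M) ⟩
    product d * D (transpose M) ≈⟨ *-congˡ (det-transpose M) ⟩
    product d * D M ∎

  det-leftColumn : ∀ {n} (M : Mat (suc n)) → (∀ i → M i zero ≈ δ zero i) →
    D M ≈ D (λ i j → M (suc i) (suc j))
  det-leftColumn M e = begin
    D M                                          ≈⟨ det-transpose M ⟨
    D (transpose M)                              ≈⟨ det-topRow (transpose M) 1# (λ i → trans (e i) (sym (*-identityˡ _))) ⟩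
    1# * D (λ i j → M (suc j) (suc i))           ≈⟨ *-identityˡ _ ⟩
    D (λ i j → M (suc j) (suc i))                ≈⟨ det-transpose (λ i j → M (suc i) (suc j)) ⟩
    D (λ i j → M (suc i) (suc j))                ∎

  -- The determinant is affine in its corner entry, with the complementary minor as slope. With x
  -- the first variable, this minor is the coefficient of x₁ in `contraction`.
  det-addCorner : ∀ {n} (M N : Mat (suc n)) x →
    (∀ i j → N i j ≈ M i j + x * (δ zero i * δ zero j)) →
    D N ≈ D M + x * D (λ i j → M (suc i) (suc j))
  det-addCorner M N x e = begin
    D N
      ≈⟨ Alternating.linear det-alternating zero x {N} {Y} {M}
           (λ j → trans (e zero j) (trans (+-comm _ _) (+-congʳ (*-congˡ (*-identityˡ _)))))
           (λ { zero p j → contradiction ≡.refl p ; (suc i) p j → rest i j })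
           (λ { zero p j → contradiction ≡.refl p ; (suc i) p j → rest i j }) ⟩
    x * D Y + D M
      ≈⟨ +-comm _ _ ⟩
    D M + x * D Y
      ≈⟨ +-congˡ (*-congˡ (trans (det-topRow Y 1# (λ j → sym (*-identityˡ _))) (*-identityˡ _))) ⟩
    D M + x * D (λ i j → M (suc i) (suc j)) ∎
    where
    Y = δ zero Vec.∷ tail M
    rest : ∀ i j → N (suc i) j ≈ M (suc i) j
    rest i j = trans (e (suc i) j)
      (trans (+-congˡ (trans (*-congˡ (zeroˡ _)) (zeroʳ x))) (+-identityʳ _))

  det-minor-zero : ∀ {n} (M : Mat (suc n)) → (∀ j → M zero j ≈ 1# * δ zero j) →
    D M ≈ 0# → D (λ i j → M (suc i) (suc j)) ≈ 0#
  det-minor-zero M e M≈0 = trans (sym (*-identityˡ _)) (trans (sym (det-topRow M 1# e)) M≈0)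

  det-⊡-zero : ∀ {n} (P A Q : Mat n) → D A ≈ 0# → D (P ⊡ A ⊡ Q) ≈ 0#
  det-⊡-zero P A Q e = begin
    D (P ⊡ A ⊡ Q)     ≈⟨ det-⊡ (P ⊡ A) Q ⟩
    D (P ⊡ A) * D Q   ≈⟨ *-congʳ (det-⊡ P A) ⟩
    D P * D A * D Q   ≈⟨ *-congʳ (trans (*-congˡ e) (zeroʳ _)) ⟩
    0# * D Q          ≈⟨ zeroˡ _ ⟩
    0#                ∎

  conjugate-zero : ∀ {k l m n} (P : Matrix Carrier k l) (A : Matrix Carrier l m) (Q : Matrix Carrier m n) →
    (∀ i j → A i j ≈ 0#) → ∀ i j → (P ⊡ A ⊡ Q) i j ≈ 0#
  conjugate-zero P A Q e i j = sum-zero _ λ k →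
    trans (*-congʳ (sum-zero _ λ l → trans (*-congˡ (e l k)) (zeroʳ _))) (zeroˡ _)

  ⊡-cong : ∀ {l m n} {A A′ : Matrix Carrier l m} {B B′ : Matrix Carrier m n} →
    A ≋ A′ → B ≋ B′ → A ⊡ B ≋ A′ ⊡ B′
  ⊡-cong {A = A} {B = B} e f i j = sum-cong-≋ {x = λ k → A i k * B k j} λ k → *-cong (e i k) (f k j)

  ⊡-assoc : ∀ {k l m n} (A : Matrix Carrier k l) (B : Matrix Carrier l m) (C : Matrix Carrier m n) →
    (A ⊡ B) ⊡ C ≋ A ⊡ (B ⊡ C)
  ⊡-assoc A B C i j = begin
    (sum λ q → (sum λ p → A i p * B p q) * C q j)
      ≈⟨ sum-cong-≋ (λ q → trans (*-distribʳ-sum (C q j) (λ p → A i p * B p q))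
           (sum-cong-≋ {x = λ p → A i p * B p q * C q j} λ p → *-assoc _ _ _)) ⟩
    (sum λ q → sum λ p → A i p * (B p q * C q j))
      ≈⟨ ∑-comm (λ q p → A i p * (B p q * C q j)) ⟩
    (sum λ p → sum λ q → A i p * (B p q * C q j))
      ≈⟨ sum-cong-≋ (λ p → *-distribˡ-sum (A i p) (λ q → B p q * C q j)) ⟨
    (sum λ p → A i p * (sum λ q → B p q * C q j)) ∎

  -- All 2 × 2 minors vanish, that is, the rank is at most one.
  MinorsVanish : ∀ {m n} → Matrix Carrier m n → Set ℓ
  MinorsVanish A = ∀ i j k l → A i j * A k l ≈ A i l * A k j

  -- A product of two entries of P A is a double sum in which the columns j and l enter only through
  -- a product of two entries of A, so they may be exchanged term by term.
  minorsVanish-⊡ˡ : ∀ {l m n} (P : Matrix Carrier l m) {A : Matrix Carrier m n} →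
    MinorsVanish A → MinorsVanish (P ⊡ A)
  minorsVanish-⊡ˡ P {A} v i j k l = begin
    (P ⊡ A) i j * (P ⊡ A) k l
      ≈⟨ expand j l ⟩
    (sum λ s → sum λ t → (P i s * P k t) * (A s j * A t l))
      ≈⟨ sum-cong-≋ (λ s → sum-cong-≋ (λ t → *-congˡ {P i s * P k t} (v s j t l))) ⟩
    (sum λ s → sum λ t → (P i s * P k t) * (A s l * A t j))
      ≈⟨ expand l j ⟨
    (P ⊡ A) i l * (P ⊡ A) k j ∎
    where
    expand : ∀ j l → (P ⊡ A) i j * (P ⊡ A) k l ≈ sum λ s → sum λ t → (P i s * P k t) * (A s j * A t l)
    expand j l = trans (*-distribʳ-sum ((P ⊡ A) k l) (λ s → P i s * A s j))
      (sum-cong-≋ λ s → trans (*-distribˡ-sum (P i s * A s j) (λ t → P k t * A t l))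
        (sum-cong-≋ λ t → solve 4 (λ p a q b → (p :* a) :* (q :* b) := (p :* q) :* (a :* b))
          refl (P i s) (A s j) (P k t) (A t l)))

  minorsVanish-transpose : ∀ {m n} {A : Matrix Carrier m n} → MinorsVanish A → MinorsVanish (transpose A)
  minorsVanish-transpose v i j k l = trans (v j i l k) (*-comm _ _)

  minorsVanish-cong : ∀ {m n} {A B : Matrix Carrier m n} → A ≋ B → MinorsVanish A → MinorsVanish B
  minorsVanish-cong e v i j k l =
    trans (sym (*-cong (e i j) (e k l))) (trans (v i j k l) (*-cong (e i l) (e k j)))

  minorsVanish-⊡ʳ : ∀ {l m n} {A : Matrix Carrier l m} (Q : Matrix Carrier m n) →
    MinorsVanish A → MinorsVanish (A ⊡ Q)
  minorsVanish-⊡ʳ {A = A} Q v = minorsVanish-cong {A = transpose (transpose Q ⊡ transpose A)}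
    (λ i j → sum-cong-≋ {x = λ k → Q k j * A i k} λ k → *-comm _ _)
    (minorsVanish-transpose {A = transpose Q ⊡ transpose A}
      (minorsVanish-⊡ˡ (transpose Q) {transpose A} (minorsVanish-transpose {A = A} v)))

-- Homomorphisms commute with determinants

module _ {c₁ ℓ₁ c₂ ℓ₂} (R : CommutativeRing c₁ ℓ₁) (S : CommutativeRing c₂ ℓ₂)
  {f : CommutativeRing.Carrier R → CommutativeRing.Carrier S} (f-hom : IsHomomorphism R S f) where
  private
    module R = CommutativeRing R
    module S = CommutativeRing S
    module f = Homomorphism R S f-hom
    module RD = Determinant R
    module SD = Determinant S
    open SemiringSum R.semiring using () renaming (sum to sumᴿ)
    open SemiringSum S.semiring using (sum-cong-≋) renaming (sum to sumˢ)
  open SetoidReasoning S.setoid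

  sum-homomorphism : ∀ {n} (v : Vector R.Carrier n) → f (sumᴿ v) S.≈ sumˢ (f ∘ v)
  sum-homomorphism {zero}  v = f.0#-homo
  sum-homomorphism {suc n} v =
    S.trans (f.+-homo _ _) (S.+-congˡ (sum-homomorphism (tail v)))

  sign-homomorphism : ∀ {n} (j : Fin n) → f (RD.sign j) S.≈ SD.sign j
  sign-homomorphism zero    = f.1#-homo
  sign-homomorphism (suc j) = S.trans (f.*-homo _ _)
    (S.*-cong (S.trans (f.-‿homo _) (S.-‿cong f.1#-homo)) (sign-homomorphism j))

  det-homomorphism : ∀ {n} (M : RD.Mat n) → f (RD.D M) S.≈ SD.D (λ i j → f (M i j))
  det-homomorphism {zero}  M = f.1#-homo
  det-homomorphism {suc n} M = S.trans (sum-homomorphism termᴿ) (sum-cong-≋ {x = f ∘ termᴿ} {y = termˢ} λ j → begin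
    f ((RD.sign j R.* M zero j) R.* RD.D (RD.minor M j))
      ≈⟨ f.*-homo _ _ ⟩
    f (RD.sign j R.* M zero j) S.* f (RD.D (RD.minor M j))
      ≈⟨ S.*-cong (S.trans (f.*-homo _ _) (S.*-congʳ (sign-homomorphism j))) (det-homomorphism (RD.minor M j)) ⟩
    (SD.sign j S.* f (M zero j)) S.* SD.D (λ i k → f (RD.minor M j i k)) ∎)
    where
    termᴿ : Vector R.Carrier (suc n)
    termᴿ j = (RD.sign j R.* M zero j) R.* RD.D (RD.minor M j)
    termˢ : Vector S.Carrier (suc n)
    termˢ j = (SD.sign j S.* f (M zero j)) S.* SD.D (λ i k → f (RD.minor M j i k))

  -- Here x plays the term of the first variable and f the embedding of the polynomials in the
  -- remaining ones; `pencil-suc` is this identity.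
  affine-homomorphism : ∀ {n} a₀ x (a v : Vector R.Carrier n) →
    f a₀ S.+ (x S.+ sumˢ (λ k → f (a k) S.* f (v k))) S.≈ f (a₀ R.+ sumᴿ (λ k → a k R.* v k)) S.+ x
  affine-homomorphism a₀ x a v = begin
    f a₀ S.+ (x S.+ sumˢ (λ k → f (a k) S.* f (v k)))
      ≈⟨ x∙yz≈xz∙y _ _ _ ⟩
    f a₀ S.+ sumˢ (λ k → f (a k) S.* f (v k)) S.+ x
      ≈⟨ S.+-congʳ (S.+-congˡ (S.trans (sum-homomorphism (λ k → a k R.* v k))
           (sum-cong-≋ λ k → f.*-homo (a k) (v k)))) ⟨
    f a₀ S.+ f (sumᴿ (λ k → a k R.* v k)) S.+ x
      ≈⟨ S.+-congʳ (f.+-homo _ _) ⟨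
    f (a₀ R.+ sumᴿ (λ k → a k R.* v k)) S.+ x ∎
    where open CommutativeSemigroupProperties S.+-commutativeSemigroup using (x∙yz≈xz∙y)

-- Pencils under row and column operations

module PencilProperties {c ℓ} (R : CommutativeRing c ℓ) where
  private module R = CommutativeRing R
  open MvPolynomial R.rawRing
  open MvRing R
  open SemiringSum R.semiring using () renaming (sum to sumᴿ)
  open Determinant R using (_⊡_) renaming (Mat to Matᴿ)

  Pencil : ∀ n {r} → Matᴿ r → Vector (Matᴿ r) n → Matrix (MvPoly n) r r
  Pencil n A₀ A = affinePencil R.rawRing A₀ A

  module _ (n : ℕ) where
    private
      module S = Mv n
      module c = Homomorphism R (mvRing n) (const-hom n)
    open SemiringSum S.semiring
    open Determinant (mvRing n) using (sum-linear) renaming (_⊡_ to _⊡ˢ_; _≋_ to _≋ˢ_)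
    open SetoidReasoning S.setoid

    -- The entries of `Pencil` have this form by definition, so a product with a constant matrix
    -- acts through linearity in the coefficients.
    affine : R.Carrier → Vector R.Carrier n → S.Carrier
    affine a₀ a = const n a₀ S.+ sum λ k → const n (a k) S.* var k

    affine-cong : ∀ {a₀ b₀ a b} → a₀ R.≈ b₀ → (∀ k → a k R.≈ b k) → affine a₀ a S.≈ affine b₀ b
    affine-cong e₀ e = S.+-cong (c.⟦⟧-cong e₀) (sum-cong-≋ λ k → S.*-congʳ {var {n} k} (c.⟦⟧-cong (e k)))

    affine-linear : ∀ p a₀ b₀ a b →
      affine (p R.* a₀ R.+ b₀) (λ k → p R.* a k R.+ b k) S.≈ const n p S.* affine a₀ a S.+ affine b₀ b
    affine-linear p a₀ b₀ a b = begin
      affine (p R.* a₀ R.+ b₀) (λ k → p R.* a k R.+ b k)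
        ≈⟨ S.+-cong (homo a₀ b₀) (sum-cong-≋ λ k → S.trans (S.*-congʳ (homo (a k) (b k)))
             (S.trans (S.distribʳ _ _ _) (S.+-congʳ (S.*-assoc (const n p) (const n (a k)) (var k))))) ⟩
      (const n p S.* const n a₀ S.+ const n b₀) S.+
      (sum λ k → const n p S.* (const n (a k) S.* var k) S.+ const n (b k) S.* var k)
        ≈⟨ S.+-congˡ (sum-linear (const n p) (λ k → const n (a k) S.* var k) (λ k → const n (b k) S.* var k)) ⟩
      (const n p S.* const n a₀ S.+ const n b₀) S.+ (const n p S.* s S.+ t)
        ≈⟨ Solver.solve S.commutativeSemiring 5 (λ p a b s t →
             (p :* a :+ b) :+ (p :* s :+ t) := p :* (a :+ s) :+ (b :+ t))
             S.refl (const n p) (const n a₀) (const n b₀) s t ⟩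
      const n p S.* affine a₀ a S.+ affine b₀ b ∎
      where
      open Solver S.commutativeSemiring using (_:=_; _:+_; _:*_)
      s = sum λ k → const n (a k) S.* var k
      t = sum λ k → const n (b k) S.* var k
      homo : ∀ x y → const n (p R.* x R.+ y) S.≈ const n p S.* const n x S.+ const n y
      homo x y = S.trans (c.+-homo _ _) (S.+-congʳ (c.*-homo _ _))

    affine-const : ∀ a₀ → affine a₀ (λ _ → R.0#) S.≈ const n a₀
    affine-const a₀ = S.trans (S.+-congˡ (S.trans
      (sum-cong-≋ {n} {x = λ k → const n R.0# S.* var k} {y = λ _ → S.0#} λ k →
        S.trans (S.*-congʳ {var {n} k} c.0#-homo) (S.zeroˡ (var {n} k)))
      (sum-replicate-zero n))) (S.+-identityʳ _)

    affine-0# : affine R.0# (λ _ → R.0#) S.≈ S.0#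
    affine-0# = S.trans (affine-const R.0#) c.0#-homo

    affine-scale : ∀ p a₀ a → affine (p R.* a₀) (λ k → p R.* a k) S.≈ const n p S.* affine a₀ a
    affine-scale p a₀ a = begin
      affine (p R.* a₀) (λ k → p R.* a k)
        ≈⟨ affine-cong (R.sym (R.+-identityʳ _)) (λ k → R.sym (R.+-identityʳ _)) ⟩
      affine (p R.* a₀ R.+ R.0#) (λ k → p R.* a k R.+ R.0#)
        ≈⟨ affine-linear p a₀ R.0# a (λ _ → R.0#) ⟩
      const n p S.* affine a₀ a S.+ affine R.0# (λ _ → R.0#)
        ≈⟨ S.trans (S.+-congˡ affine-0#) (S.+-identityʳ _) ⟩
      const n p S.* affine a₀ a ∎

    affine-sum : ∀ {m} (p : Vector R.Carrier m) (a₀ : Vector R.Carrier m) (a : Vector (Vector R.Carrier n) m) →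
      affine (sumᴿ λ s → p s R.* a₀ s) (λ k → sumᴿ λ s → p s R.* a s k) S.≈
      sum λ s → const n (p s) S.* affine (a₀ s) (a s)
    affine-sum {zero}  p a₀ a = affine-0#
    affine-sum {suc m} p a₀ a = S.trans
      (affine-linear (p zero) (a₀ zero) _ (a zero) _)
      (S.+-congˡ (affine-sum (tail p) (tail a₀) (tail a)))

    module _ {r : ℕ} (A₀ : Matᴿ r) (A : Vector (Matᴿ r) n) where

      pencil-⊡ˡ : (P : Matᴿ r) →
        Pencil n (P ⊡ A₀) (λ k → P ⊡ A k) ≋ˢ (λ i j → const n (P i j)) ⊡ˢ Pencil n A₀ A
      pencil-⊡ˡ P i j = affine-sum (P i) (λ s → A₀ s j) (λ s k → A k s j)

      pencil-⊡ʳ : (Q : Matᴿ r) →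
        Pencil n (A₀ ⊡ Q) (λ k → A k ⊡ Q) ≋ˢ Pencil n A₀ A ⊡ˢ (λ i j → const n (Q i j))
      pencil-⊡ʳ Q i j = begin
        affine (sumᴿ λ s → A₀ i s R.* Q s j) (λ k → sumᴿ λ s → A k i s R.* Q s j)
          ≈⟨ affine-cong (SR.sum-cong-≋ {x = λ s → A₀ i s R.* Q s j} λ s → R.*-comm _ _)
               (λ k → SR.sum-cong-≋ {x = λ s → A k i s R.* Q s j} λ s → R.*-comm _ _) ⟩
        affine (sumᴿ λ s → Q s j R.* A₀ i s) (λ k → sumᴿ λ s → Q s j R.* A k i s)
          ≈⟨ affine-sum (λ s → Q s j) (A₀ i) (λ s k → A k i s) ⟩
        (sum λ s → const n (Q s j) S.* Pencil n A₀ A i s)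
          ≈⟨ sum-cong-≋ {x = λ s → const n (Q s j) S.* Pencil n A₀ A i s} (λ s → S.*-comm _ _) ⟩
        (sum λ s → Pencil n A₀ A i s S.* const n (Q s j)) ∎
        where module SR = SemiringSum R.semiring

    det-pencil-⊡ : ∀ {r} (P : Matᴿ r) (A₀ : Matᴿ r) (A : Vector (Matᴿ r) n) (Q : Matᴿ r) →
      det S.rawRing (Pencil n (P ⊡ A₀ ⊡ Q) (λ k → P ⊡ A k ⊡ Q)) S.≈
      const n (det R.rawRing P) S.* det S.rawRing (Pencil n A₀ A) S.* const n (det R.rawRing Q)
    det-pencil-⊡ P A₀ A Q = begin
      det S.rawRing (Pencil n (P ⊡ A₀ ⊡ Q) (λ k → P ⊡ A k ⊡ Q))
        ≈⟨ det-cong (pencil-⊡ʳ (P ⊡ A₀) (λ k → P ⊡ A k) Q) ⟩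
      det S.rawRing (Pencil n (P ⊡ A₀) (λ k → P ⊡ A k) ⊡ˢ λ i j → const n (Q i j))
        ≈⟨ det-⊡ (Pencil n (P ⊡ A₀) (λ k → P ⊡ A k)) _ ⟩
      det S.rawRing (Pencil n (P ⊡ A₀) (λ k → P ⊡ A k)) S.* det S.rawRing (λ i j → const n (Q i j))
        ≈⟨ S.*-cong (S.trans (det-cong (pencil-⊡ˡ A₀ A P)) (det-⊡ (λ i j → const n (P i j)) (Pencil n A₀ A)))
             (S.sym (det-homomorphism R (mvRing n) (const-hom n) Q)) ⟩
      det S.rawRing (λ i j → const n (P i j)) S.* det S.rawRing (Pencil n A₀ A) S.* const n (det R.rawRing Q)
        ≈⟨ S.*-congʳ (S.*-congʳ (det-homomorphism R (mvRing n) (const-hom n) P)) ⟨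
      const n (det R.rawRing P) S.* det S.rawRing (Pencil n A₀ A) S.* const n (det R.rawRing Q) ∎
      where open Determinant (mvRing n) using (det-cong; det-⊡)

  pencil-suc : ∀ n {r} (A₀ : Matᴿ r) (A : Vector (Matᴿ r) (suc n)) i j →
    Mv._≈_ (suc n) (Pencil (suc n) A₀ A i j)
      (Mv._+_ (suc n) (Pencil n A₀ (tail A) i j L.∷ L.[])
                      (Mv._*_ (suc n) (const (suc n) (A zero i j)) (var {suc n} zero)))
  pencil-suc n A₀ A i j = affine-homomorphism (mvRing n) (mvRing (suc n))
    (PolynomialHomomorphisms.constant-hom (mvRing n)) (const n (A₀ i j))
    (Mv._*_ (suc n) (const (suc n) (A zero i j)) (var {suc n} zero))
    (λ k → const n (A (suc k) i j)) (var {n})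

module _ {c₁ ℓ₁ c₂ ℓ₂} (R : CommutativeRing c₁ ℓ₁) (S : CommutativeRing c₂ ℓ₂)
  {f : CommutativeRing.Carrier R → CommutativeRing.Carrier S} (f-hom : IsHomomorphism R S f) where
  private
    module R = CommutativeRing R
    module S = CommutativeRing S
    module RMv = MvRing R
    module SMv = MvRing S

  -- Serves both the evaluation at ε = 0 (`reduction`) and the passage from 𝔽[ε] to 𝔽(ε)
  -- (`cleared-det`).
  det-pencil-homomorphism : ∀ n {r} (A₀ : Matrix R.Carrier r r) (A : Vector (Matrix R.Carrier r r) n) →
    SMv.Mv._≈_ n (mvMap R S f n (det (R.rawRing [x₁⋯x n ]) (affinePencil R.rawRing A₀ A)))
      (det (S.rawRing [x₁⋯x n ]) (affinePencil S.rawRing (λ i j → f (A₀ i j)) (λ k i j → f (A k i j))))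
  det-pencil-homomorphism n A₀ A = Sₙ.trans
    (det-homomorphism (RMv.mvRing n) (SMv.mvRing n) hom (affinePencil R.rawRing A₀ A))
    (Determinant.det-cong (SMv.mvRing n) λ i j → Sₙ.trans (h.+-homo _ _) (Sₙ.+-cong
      (Sₙ.reflexive (mvMap-const R S f n (A₀ i j)))
      (Sₙ.trans (sum-homomorphism (RMv.mvRing n) (SMv.mvRing n) hom (termᴿ i j))
        (SemiringSum.sum-cong-≋ Sₙ.semiring {x = λ k → mvMap R S f n (termᴿ i j k)} {y = termˢ i j}
          λ k → Sₙ.trans (h.*-homo _ _)
          (Sₙ.*-cong (Sₙ.reflexive (mvMap-const R S f n (A k i j))) (mvMap-var R S f f-hom n k))))))
    where
    module Sₙ = SMv.Mv n
    hom = mvMap-hom R S f f-hom n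
    module h = Homomorphism (RMv.mvRing n) (SMv.mvRing n) hom
    termᴿ = λ i j k → RMv.Mv._*_ n (MvPolynomial.const R.rawRing n (A k i j)) (MvPolynomial.var R.rawRing k)
    termˢ = λ i j k → Sₙ._*_ (MvPolynomial.const S.rawRing n (f (A k i j))) (MvPolynomial.var S.rawRing k)

-- Linear algebra over a field: spans, bases, the modular law

count : ∀ {n} → Vector Bool n → ℕ
count {zero}  σ = 0
count {suc n} σ = (if σ zero then 1 else 0) ℕ.+ count (tail σ)

module LinearIndependence {c ℓ} (F : Field c ℓ) where
  open Field F hiding (zero)
  open SemiringSum semiring
  open Determinant commutativeRing
  open Solver commutativeSemiring using (solve; _:=_; _:+_; _:*_; con)
  open L using ([]; _∷_)
  open SetoidReasoning setoid

  private variable r s : ℕ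

  V : ℕ → Set c
  V r = Vector Carrier r

  infix 4 _≋ᵥ_
  _≋ᵥ_ : V r → V r → Set ℓ
  u ≋ᵥ v = ∀ i → u i ≈ v i

  0ᵥ : V r
  0ᵥ _ = 0#

  infix 6 _·_⊕_
  _·_⊕_ : Carrier → V r → V r → V r
  (a · u ⊕ v) i = a * u i + v i

  -- Multiples of the spanning vectors are added to v until 0 is reached, so the scalars stored are
  -- the negated coefficients of v.
  Span : List (V r) → V r → Set (c ⊔ ℓ)
  Span {r} [] v = Lift c (v ≋ᵥ 0ᵥ)
  Span (w ∷ ws) v = ∃ λ a → Span ws (a · w ⊕ v)

  Independent : List (V r) → Set (c ⊔ ℓ)
  Independent []       = Lift _ ⊤
  Independent (w ∷ ws) = ¬ Span ws w × Independent ws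

  span-cong : ∀ (ws : List (V r)) {u v} → u ≋ᵥ v → Span ws u → Span ws v
  span-cong []       e (lift u≋0) = lift λ i → trans (sym (e i)) (u≋0 i)
  span-cong (w ∷ ws) e (a , s)    = a , span-cong ws (λ i → +-congˡ (e i)) s

  span-linear : ∀ (ws : List (V r)) a {u v} → Span ws u → Span ws v → Span ws (a · u ⊕ v)
  span-linear []       a (lift p) (lift q) = lift λ i →
    trans (+-cong (trans (*-congˡ (p i)) (zeroʳ a)) (q i)) (+-identityˡ 0#)
  span-linear (w ∷ ws) a {u} {v} (b , s) (b′ , s′) = a * b + b′ , span-cong ws
    (λ i → solve 6 (λ a b b′ w u v → a :* (b :* w :+ u) :+ (b′ :* w :+ v) := (a :* b :+ b′) :* w :+ (a :* u :+ v))
      refl a b b′ (w i) (u i) (v i))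
    (span-linear ws a s s′)

  span-0ᵥ : ∀ (ws : List (V r)) → Span ws 0ᵥ
  span-0ᵥ []       = lift λ _ → refl
  span-0ᵥ (w ∷ ws) = 0# , span-cong ws (λ i → sym (trans (+-identityʳ _) (zeroˡ _))) (span-0ᵥ ws)

  span-tail : ∀ (w : V r) ws {v} → Span ws v → Span (w ∷ ws) v
  span-tail w ws s = 0# , span-cong ws (λ i → sym (trans (+-congʳ (zeroˡ _)) (+-identityˡ _))) s

  private
    cancel : ∀ a x → - a * x + a * x ≈ 0#
    cancel a x = trans (sym (distribʳ x (- a) a)) (trans (*-congʳ (-‿inverseˡ a)) (zeroˡ x))

    cancelʳ : ∀ a x y → - a * x + (a * x + y) ≈ y
    cancelʳ a x y = trans (sym (+-assoc _ _ _)) (trans (+-congʳ (cancel a x)) (+-identityˡ y))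

  span-head : ∀ (w : V r) ws → Span (w ∷ ws) w
  span-head w ws = - 1# , span-cong ws
    (λ i → sym (trans (+-congˡ (sym (*-identityˡ (w i)))) (cancel 1# (w i)))) (span-0ᵥ ws)

  span-sum : ∀ (ws : List (V r)) {m} (a : V m) (U : Vector (V r) m) →
    (∀ j → a j ≈ 0# ⊎ Span ws (U j)) → Span ws (λ i → sum λ j → a j * U j i)
  span-sum ws {zero}  a U h = span-0ᵥ ws
  span-sum ws {suc m} a U h with h zero | span-sum ws (tail a) (tail U) (λ j → h (suc j))
  ... | inj₂ s   | t = span-linear ws (a zero) s t
  ... | inj₁ a≈0 | t = span-cong ws
    (λ i → sym (trans (+-congʳ (trans (*-congʳ a≈0) (zeroˡ _))) (+-identityˡ _))) t

  record Subspace {p} (P : V r → Set p) : Set (c ⊔ ℓ ⊔ p) where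
    field
      resp    : ∀ {u v} → u ≋ᵥ v → P u → P v
      ∋-0ᵥ    : P 0ᵥ
      combine : ∀ a {u v} → P u → P v → P (a · u ⊕ v)

  span-subspace : ∀ (ws : List (V r)) → Subspace (Span ws)
  span-subspace ws = record
    { resp = span-cong ws ; ∋-0ᵥ = span-0ᵥ ws ; combine = span-linear ws }

  span-least : ∀ {p} {P : V r → Set p} → Subspace P → ∀ {ws} → All P ws → ∀ {v} → Span ws v → P v
  span-least S All.[]          (lift v≋0) = Subspace.resp S (λ i → sym (v≋0 i)) (Subspace.∋-0ᵥ S)
  span-least S (All._∷_ {x = w} p ps) {v} (a , s) = Subspace.resp S
    (λ i → cancelʳ a (w i) (v i)) (Subspace.combine S (- a) p (span-least S ps s))

  infixl 7 _⊳_
  _⊳_ : V r → Matrix Carrier r s → V s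
  (v ⊳ M) j = sum λ i → v i * M i j

  ⊳-linear : ∀ a (u v : V r) (M : Matrix Carrier r s) j → ((a · u ⊕ v) ⊳ M) j ≈ (a · u ⊳ M ⊕ v ⊳ M) j
  ⊳-linear a u v M j = trans
    (sum-cong-≋ λ i → trans (distribʳ (M i j) _ _) (+-congʳ (*-assoc a (u i) (M i j))))
    (sum-linear a (λ i → u i * M i j) (λ i → v i * M i j))

  ⊳-cong : ∀ {u v : V r} (M : Matrix Carrier r s) → u ≋ᵥ v → u ⊳ M ≋ᵥ v ⊳ M
  ⊳-cong {u = u} M e j = sum-cong-≋ {x = λ i → u i * M i j} λ i → *-congʳ (e i)

  ⊳-zero : ∀ (M : Matrix Carrier r s) → 0ᵥ ⊳ M ≋ᵥ 0ᵥ
  ⊳-zero M j = sum-zero _ λ i → zeroˡ (M i j)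

  ⊳-assoc : ∀ {t} (v : V r) (M : Matrix Carrier r s) (N : Matrix Carrier s t) →
    v ⊳ M ⊳ N ≋ᵥ v ⊳ (M ⊡ N)
  ⊳-assoc v M N j = DeterminantFormulas.⊡-assoc commutativeRing {k = 1} (λ _ → v) M N zero j

  ⊳-δ : ∀ (v : V r) → v ⊳ δ ≋ᵥ v
  ⊳-δ v = sum-δʳ v

  ⊳-subspace : ∀ (M : Matrix Carrier r s) (j : Fin s) → Subspace (λ v → (v ⊳ M) j ≈ 0#)
  ⊳-subspace M j = record
    { resp    = λ e p → trans (sym (⊳-cong M e j)) p
    ; ∋-0ᵥ    = ⊳-zero M j
    ; combine = λ a {u} {v} p q → trans (⊳-linear a u v M j)
        (trans (+-cong (trans (*-congˡ p) (zeroʳ a)) q) (+-identityˡ 0#))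
    }

  -- A basis (the rows of P) of the whole space, of which the rows selected by the mask
  -- span the same subspace as ws.
  record Completion (ws : List (V r)) : Set (c ⊔ ℓ) where
    field
      P Q    : Mat r
      PQ≋δ   : P ⊡ Q ≋ δ
      QP≋δ   : Q ⊡ P ≋ δ
      mask   : Vector Bool r
      outside : All (λ w → ∀ j → mask j ≡ false → (w ⊳ Q) j ≈ 0#) ws
      inside : ∀ j → mask j ≡ true → Span ws (P j)
      size   : count mask ≡ L.length ws

    coordinates : ∀ w → w ⊳ Q ⊳ P ≋ᵥ w
    coordinates w j = trans (⊳-assoc w Q P j)
      (trans (sum-cong-≋ {x = λ i → w i * (Q ⊡ P) i j} λ i → *-congˡ (QP≋δ i j)) (⊳-δ w j))

    span-outside : ∀ {w} → Span ws w → ∀ j → mask j ≡ false → (w ⊳ Q) j ≈ 0#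
    span-outside s j unmasked = span-least (⊳-subspace Q j) (All.map (λ h → h j unmasked) outside) s

    outside-span : ∀ {w} → (∀ j → mask j ≡ false → (w ⊳ Q) j ≈ 0#) → Span ws w
    outside-span {w} h = span-cong ws (coordinates w) (span-sum ws (w ⊳ Q) P coordinate)
      where
      coordinate : ∀ j → (w ⊳ Q) j ≈ 0# ⊎ Span ws (P j)
      coordinate j with mask j in eq
      ... | false = inj₁ (h j eq)
      ... | true  = inj₂ (inside j eq)

    -- The coordinates outside the mask decide membership in the span; one that does not vanish is a
    -- place at which w can be exchanged into the basis.
    new-coordinate : ∀ w → Span ws w ⊎ ∃ λ j → mask j ≡ false × ¬ ((w ⊳ Q) j ≈ 0#)
    new-coordinate w with Fin.any? (λ j → (mask j BoolP.≟ false) ×-dec ¬? ((w ⊳ Q) j ≟ 0#))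
    ... | yes j = inj₂ j
    ... | no ∄j = inj₁ (outside-span λ j e → decidable-stable ((w ⊳ Q) j ≟ 0#) λ ≉0 → ∄j (j , e , ≉0))

    span? : ∀ w → Dec (Span ws w)
    span? w with new-coordinate w
    ... | inj₁ s            = yes s
    ... | inj₂ (j , e , ≉0) = no λ s → ≉0 (span-outside s j e)

  private
    insert-mask : Fin r → Vector Bool r → Vector Bool r
    insert-mask j σ k = if does (k Fin.≟ j) then true else σ k

    count-insert : ∀ (j : Fin r) σ → σ j ≡ false → count (insert-mask j σ) ≡ suc (count σ)
    count-insert zero    σ e rewrite e = ≡.refl
    count-insert (suc j) σ e = ≡.trans
      (≡.cong ((if σ zero then 1 else 0) ℕ.+_) (count-insert j (tail σ) e)) (ℕ.+-suc _ _)

  -- Row j of the basis is replaced by w (Sherman–Morrison for the inverse).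
  extend : ∀ {ws : List (V r)} (C : Completion ws) w j → let open Completion C in
    mask j ≡ false → ¬ ((w ⊳ Q) j ≈ 0#) → Completion (w ∷ ws)
  extend {r} {ws} C w j unmasked c≉0 = record
    { P = P′ ; Q = Q′ ; PQ≋δ = P′Q′≋δ ; QP≋δ = Q′P′≋δ
    ; mask = insert-mask j mask
    ; outside = outside-w All.∷ All.map (λ {v} h k e → trans (v⊳Q′ v k)
        (trans (+-cong (trans (*-congʳ (h j unmasked)) (zeroˡ _)) (h k (unmasked′ k e))) (+-identityˡ 0#))) outside
    ; inside = inside′
    ; size = ≡.trans (count-insert j mask unmasked) (≡.cong suc size)
    }
    where
    open Completion C
    u : V r
    u i = w i + - P j i
    e : V r
    e = u ⊳ Q
    inv = inverse _ c≉0
    -- The Sherman-Morrison denominator e j + 1 equals the coordinate (w ⊳ Q) j; n is minus its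
    -- inverse.
    n = - proj₁ inv
    P′ Q′ : Mat r
    P′ k i = δ j k * u i + P k i
    Q′ i k = Q i j * (n * e k) + Q i k
    P+u≈w : ∀ i → u i + P j i ≈ w i
    P+u≈w i = trans (+-assoc _ _ _) (trans (+-congˡ (-‿inverseˡ _)) (+-identityʳ _))
    e+δ≈c : ∀ k → e k + δ j k ≈ (w ⊳ Q) k
    e+δ≈c k = begin
      e k + δ j k              ≈⟨ +-cong (*-identityˡ _) (PQ≋δ j k) ⟨
      1# * e k + (P j ⊳ Q) k   ≈⟨ ⊳-linear 1# u (P j) Q k ⟨
      ((1# · u ⊕ P j) ⊳ Q) k   ≈⟨ ⊳-cong Q (λ i → trans (+-congʳ (*-identityˡ _)) (P+u≈w i)) k ⟩
      (w ⊳ Q) k                ∎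
    n-eq : n * (e j + 1#) + 1# ≈ 0#
    n-eq = begin
      n * (e j + 1#) + 1#             ≈⟨ +-congʳ (*-congˡ (trans (+-congˡ (sym (δ-diag j))) (e+δ≈c j))) ⟩
      n * (w ⊳ Q) j + 1#              ≈⟨ +-congˡ (trans (*-comm _ _) (proj₂ inv)) ⟨
      n * (w ⊳ Q) j + proj₁ inv * (w ⊳ Q) j ≈⟨ cancel (proj₁ inv) ((w ⊳ Q) j) ⟩
      0#                              ∎
    v⊳Q′ : ∀ v k → (v ⊳ Q′) k ≈ (v ⊳ Q) j * (n * e k) + (v ⊳ Q) k
    v⊳Q′ v k = begin
      (v ⊳ Q′) k
        ≈⟨ sum-cong-≋ {y = λ i → n * e k * (v i * Q i j) + v i * Q i k} (λ i →
             solve 4 (λ v q d q′ → v :* (q :* d :+ q′) := d :* (v :* q) :+ v :* q′)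
               refl (v i) (Q i j) (n * e k) (Q i k)) ⟩
      (sum λ i → n * e k * (v i * Q i j) + v i * Q i k)
        ≈⟨ sum-linear (n * e k) (λ i → v i * Q i j) (λ i → v i * Q i k) ⟩
      n * e k * (v ⊳ Q) j + (v ⊳ Q) k
        ≈⟨ +-congʳ (*-comm _ _) ⟩
      (v ⊳ Q) j * (n * e k) + (v ⊳ Q) k ∎
    v⊳P′ : ∀ v k → (v ⊳ P′) k ≈ v j * u k + (v ⊳ P) k
    v⊳P′ v k = begin
      (v ⊳ P′) k
        ≈⟨ sum-cong-≋ {y = λ i → u k * (δ j i * v i) + v i * P i k} (λ i →
             solve 4 (λ v d u p → v :* (d :* u :+ p) := u :* (d :* v) :+ v :* p)
               refl (v i) (δ j i) (u k) (P i k)) ⟩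
      (sum λ i → u k * (δ j i * v i) + v i * P i k)
        ≈⟨ sum-linear (u k) (λ i → δ j i * v i) (λ i → v i * P i k) ⟩
      u k * (sum λ i → δ j i * v i) + (v ⊳ P) k
        ≈⟨ +-congʳ (trans (*-congˡ (sum-δˡ v j)) (*-comm _ _)) ⟩
      v j * u k + (v ⊳ P) k ∎
    P′⊳Q : ∀ k l → (P′ k ⊳ Q) l ≈ δ j k * e l + δ k l
    P′⊳Q k l = trans (⊳-linear (δ j k) u (P k) Q l) (+-congˡ (PQ≋δ k l))
    P′Q′≋δ : P′ ⊡ Q′ ≋ δ
    P′Q′≋δ k l = begin
      (P′ k ⊳ Q′) l
        ≈⟨ v⊳Q′ (P′ k) l ⟩
      (P′ k ⊳ Q) j * (n * e l) + (P′ k ⊳ Q) l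
        ≈⟨ +-cong (*-congʳ (trans (P′⊳Q k j) (+-congˡ (δ-sym k j)))) (P′⊳Q k l) ⟩
      (δ j k * e j + δ j k) * (n * e l) + (δ j k * e l + δ k l)
        ≈⟨ solve 5 (λ d ej n el t → (d :* ej :+ d) :* (n :* el) :+ (d :* el :+ t) :=
             (n :* (ej :+ con 1) :+ con 1) :* (d :* el) :+ t) refl (δ j k) (e j) n (e l) (δ k l) ⟩
      (n * (e j + 1#) + 1#) * (δ j k * e l) + δ k l
        ≈⟨ trans (+-congʳ (trans (*-congʳ n-eq) (zeroˡ _))) (+-identityˡ _) ⟩
      δ k l ∎
    Q′P′≋δ : Q′ ⊡ P′ ≋ δ
    Q′P′≋δ i l = begin
      (Q′ i ⊳ P′) l
        ≈⟨ v⊳P′ (Q′ i) l ⟩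
      Q′ i j * u l + (Q′ i ⊳ P) l
        ≈⟨ +-congˡ (trans (⊳-linear (Q i j) (λ k → n * e k) (Q i) P l)
             (+-cong (*-congˡ d⊳P) (QP≋δ i l))) ⟩
      (Q i j * (n * e j) + Q i j) * u l + (Q i j * (n * u l) + δ i l)
        ≈⟨ solve 5 (λ q n ej u t → (q :* (n :* ej) :+ q) :* u :+ (q :* (n :* u) :+ t) :=
             (n :* (ej :+ con 1) :+ con 1) :* (q :* u) :+ t) refl (Q i j) n (e j) (u l) (δ i l) ⟩
      (n * (e j + 1#) + 1#) * (Q i j * u l) + δ i l
        ≈⟨ trans (+-congʳ (trans (*-congʳ n-eq) (zeroˡ _))) (+-identityˡ _) ⟩
      δ i l ∎
      where
      d⊳P : ((λ k → n * e k) ⊳ P) l ≈ n * u l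
      d⊳P = begin
        ((λ k → n * e k) ⊳ P) l      ≈⟨ sum-cong-≋ (λ k → *-assoc n (e k) (P k l)) ⟩
        (sum λ k → n * (e k * P k l)) ≈⟨ *-distribˡ-sum n (λ k → e k * P k l) ⟨
        n * (e ⊳ P) l                ≈⟨ *-congˡ (coordinates u l) ⟩
        n * u l                      ∎
    w≋P′ : P′ j ≋ᵥ w
    w≋P′ i = trans (+-congʳ (trans (*-congʳ (δ-diag j)) (*-identityˡ _))) (P+u≈w i)
    unmasked′ : ∀ k → insert-mask j mask k ≡ false → mask k ≡ false
    unmasked′ k e with k Fin.≟ j
    ... | no _ = e
    ≢j : ∀ k → insert-mask j mask k ≡ false → j ≢ k
    ≢j k e j≡k with k Fin.≟ j
    ... | no k≢j = k≢j (≡.sym j≡k)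
    outside-w : ∀ k → insert-mask j mask k ≡ false → (w ⊳ Q′) k ≈ 0#
    outside-w k e = trans (sym (⊳-cong Q′ w≋P′ k)) (trans (P′Q′≋δ j k) (δ-off (≢j k e)))
    inside′ : ∀ k → insert-mask j mask k ≡ true → Span (w ∷ ws) (P′ k)
    inside′ k e with k Fin.≟ j
    ... | yes ≡.refl = span-cong (w ∷ ws) (λ i → sym (w≋P′ i)) (span-head w ws)
    ... | no k≢j     = span-tail w ws (span-cong ws
      (λ i → sym (trans (+-congʳ (trans (*-congʳ (δ-off (k≢j ∘ ≡.sym))) (zeroˡ _))) (+-identityˡ _)))
      (inside k e))

  complete : ∀ {ws : List (V r)} → Independent ws → Completion ws
  complete {r} {[]} _ = record
    { P = δ ; Q = δ ; PQ≋δ = λ i j → sum-δʳ (δ i) j ; QP≋δ = λ i j → sum-δʳ (δ i) j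
    ; mask = λ _ → false ; outside = All.[] ; inside = λ _ () ; size = count-false r
    }
    where
    count-false : ∀ r → count {r} (λ _ → false) ≡ 0
    count-false zero    = ≡.refl
    count-false (suc r) = count-false r
  complete {ws = w ∷ ws} (w∉ , ind) with Completion.new-coordinate (complete ind) w
  ... | inj₁ s            = contradiction s w∉
  ... | inj₂ (j , e , ≉0) = extend (complete ind) w j e ≉0

  -- The meet lies in both spans and the join in their sum. With independence and `sizes`, this is
  -- the dimension formula for sum and intersection in the form that `uncross` uses.
  record Modular (ws₁ ws₂ : List (V r)) : Set (c ⊔ ℓ) where
    field
      meet join  : List (V r)
      meet-ind   : Independent meet
      join-ind   : Independent join
      sizes      : L.length meet ℕ.+ L.length join ≡ L.length ws₁ ℕ.+ L.length ws₂
      meet⊆₁     : All (Span ws₁) meet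
      meet⊆₂     : All (Span ws₂) meet
      join⊆      : ∀ {v} → Span join v → ∃₂ λ y₁ y₂ → Span ws₁ y₁ × Span ws₂ y₂ × (1# · y₁ ⊕ y₂) ≋ᵥ v

  -- Induction on the second list. A vector w outside the join enlarges the join. Otherwise w = y₁ +
  -- y₂, and y₁ = w - y₂ lies in both spans. It is new in the meet: if the old meet spanned y₁, then
  -- w would lie in the span of `ws₂`.
  modular : ∀ {ws₁ ws₂ : List (V r)} → Independent ws₁ → Independent ws₂ → Modular ws₁ ws₂
  modular {ws₁ = ws₁} {[]} ind₁ _ = record
    { meet = [] ; join = ws₁ ; meet-ind = _ ; join-ind = ind₁ ; sizes = ≡.sym (ℕ.+-identityʳ _)
    ; meet⊆₁ = All.[] ; meet⊆₂ = All.[]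
    ; join⊆ = λ {v} s → v , 0ᵥ , s , span-0ᵥ [] , λ i → trans (+-identityʳ _) (*-identityˡ _)
    }
  modular {ws₁ = ws₁} {w ∷ ws₂} ind₁ (w∉ , ind₂) with modular ind₁ ind₂
  ... | record { meet = I ; join = J ; meet-ind = I-ind ; join-ind = J-ind ; sizes = sizes
               ; meet⊆₁ = I⊆₁ ; meet⊆₂ = I⊆₂ ; join⊆ = J⊆ }
    with Completion.span? (complete J-ind) w
  ... | no w∉J = record
    { meet = I ; join = w ∷ J ; meet-ind = I-ind ; join-ind = w∉J , J-ind
    ; sizes = ≡.trans (ℕ.+-suc _ _) (≡.trans (≡.cong suc sizes) (≡.sym (ℕ.+-suc _ _)))
    ; meet⊆₁ = I⊆₁ ; meet⊆₂ = All.map (span-tail w ws₂) I⊆₂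
    ; join⊆ = λ {v} (a , s) → let (y₁ , y₂ , s₁ , s₂ , e) = J⊆ s in
        y₁ , (- a · w ⊕ y₂) , s₁ ,
        span-linear (w ∷ ws₂) (- a) (span-head w ws₂) (span-tail w ws₂ s₂) ,
        λ i → begin
          1# * y₁ i + (- a * w i + y₂ i) ≈⟨ x∙yz≈y∙xz _ _ _ ⟩
          - a * w i + (1# * y₁ i + y₂ i) ≈⟨ +-congˡ (e i) ⟩
          - a * w i + (a * w i + v i)    ≈⟨ cancelʳ a (w i) (v i) ⟩
          v i                            ∎
    }
    where open CommutativeSemigroupProperties +-commutativeSemigroup using (x∙yz≈y∙xz)
  ... | yes w∈J = let (y₁ , y₂ , s₁ , s₂ , e) = J⊆ w∈J in record
    { meet = y₁ ∷ I ; join = J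
    ; meet-ind = (λ y₁∈I → w∉ (span-cong ws₂ e
        (span-linear ws₂ 1# (span-least (span-subspace ws₂) I⊆₂ y₁∈I) s₂))) , I-ind
    ; join-ind = J-ind
    ; sizes = ≡.trans (≡.cong suc sizes) (≡.sym (ℕ.+-suc _ _))
    ; meet⊆₁ = s₁ All.∷ I⊆₁
    -- Membership of y₁ in the encoding of `Span`: the scalar -1 on w leaves y₁ - w = -y₂.
    ; meet⊆₂ = (- 1# , span-cong ws₂ (difference e) (span-linear ws₂ (- 1#) s₂ (span-0ᵥ ws₂)))
               All.∷ All.map (span-tail w ws₂) I⊆₂
    ; join⊆ = λ s → let (z₁ , z₂ , t₁ , t₂ , e′) = J⊆ s in z₁ , z₂ , t₁ , span-tail w ws₂ t₂ , e′
    }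
    where
    difference : ∀ {y₁ y₂} → (1# · y₁ ⊕ y₂) ≋ᵥ w → (- 1# · y₂ ⊕ 0ᵥ) ≋ᵥ (- 1# · w ⊕ y₁)
    difference {y₁} {y₂} e i = begin
      - 1# * y₂ i + 0#
        ≈⟨ +-congˡ (cancel 1# (y₁ i)) ⟨
      - 1# * y₂ i + (- 1# * y₁ i + 1# * y₁ i)
        ≈⟨ solve 3 (λ m y z → m :* z :+ (m :* y :+ con 1 :* y) := m :* (con 1 :* y :+ z) :+ y) refl (- 1#) (y₁ i) (y₂ i) ⟩
      - 1# * (1# * y₁ i + y₂ i) + y₁ i
        ≈⟨ +-congʳ (*-congˡ (e i)) ⟩
      - 1# * w i + y₁ i ∎

  record Embedding (f : V r → V s) : Set (c ⊔ ℓ) where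
    field
      linear : ∀ a u v → f (a · u ⊕ v) ≋ᵥ a · f u ⊕ f v
      kernel : ∀ {v} → f v ≋ᵥ 0ᵥ → v ≋ᵥ 0ᵥ

  module _ {f : V r → V s} (f-emb : Embedding f) where
    open Embedding f-emb

    span-map⁻ : ∀ ws {v} → Span (L.map f ws) (f v) → Span ws v
    span-map⁻ []       (lift e) = lift (kernel e)
    span-map⁻ (w ∷ ws) {v} (a , s)  = a ,
      span-map⁻ ws (span-cong (L.map f ws) (λ i → sym (linear a w v i)) s)

    independent-map : ∀ ws → Independent ws → Independent (L.map f ws)
    independent-map []       _          = _
    independent-map (w ∷ ws) (w∉ , ind) = w∉ ∘ span-map⁻ ws , independent-map ws ind

  standardBasis : ∀ r → List (V r)
  standardBasis zero    = []
  standardBasis (suc r) = δ zero ∷ L.map (0# Vec.∷_) (standardBasis r)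

  standardBasis-length : ∀ r → L.length (standardBasis r) ≡ r
  standardBasis-length zero    = ≡.refl
  standardBasis-length (suc r) = ≡.cong suc
    (≡.trans (LP.length-map _ (standardBasis r)) (standardBasis-length r))

  standardBasis-independent : ∀ r → Independent (standardBasis r)
  standardBasis-independent zero    = _
  standardBasis-independent (suc r) =
      (λ s → 1≉0 (span-least first-zero (AllP.map⁺ (All.universal (λ _ → refl) (standardBasis r))) s))
    , independent-map emb (standardBasis r) (standardBasis-independent r)
    where
    first-zero : Subspace (λ (v : V (suc r)) → v zero ≈ 0#)
    first-zero = record
      { resp    = λ e p → trans (sym (e zero)) p
      ; ∋-0ᵥ    = refl
      ; combine = λ a p q → trans (+-cong (trans (*-congˡ p) (zeroʳ a)) q) (+-identityˡ 0#)
      }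
    emb : Embedding (λ (v : V r) → 0# Vec.∷ v)
    emb = record
      { linear = λ { a u v zero → sym (trans (+-identityʳ _) (zeroʳ a)) ; a u v (suc i) → refl }
      ; kernel = λ e i → e (suc i)
      }

-- Row operations taking a vector a with a k ≉ 0 to the first standard basis vector.
module Elimination {c ℓ} (F : Field c ℓ) {r : ℕ}
  (a : Vector (Field.Carrier F) (suc r)) (k : Fin (suc r)) (i : Field.Carrier F)
  (a*i≈1 : Field._≈_ F (Field._*_ F (a k) i) (Field.1# F)) where
  open Field F hiding (zero)
  open SemiringSum semiring
  open Determinant commutativeRing
  open LinearIndependence F
  open SetoidReasoning setoid

  S : Mat (suc r)
  S zero    j = δ k j * i
  S (suc p) j = δ k j * - (a (punchIn k p) * i) + δ (punchIn k p) j

  S-top : ∀ (v : V (suc r)) → sum (λ j → S zero j * v j) ≈ i * v k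
  S-top v = trans (sum-cong-≋ {x = λ j → S zero j * v j} {y = λ j → δ k j * (i * v j)} λ j → *-assoc (δ k j) i (v j))
    (sum-δˡ (λ j → i * v j) k)

  S-a : ∀ p → sum (λ j → S p j * a j) ≈ δ zero p
  S-a zero    = trans (S-top a) (trans (*-comm _ _) a*i≈1)
  S-a (suc p) = begin
    sum (λ j → (δ k j * m + δ k′ j) * a j)
      ≈⟨ sum-cong-≋ {y = λ j → m * (δ k j * a j) + δ k′ j * a j}
           (λ j → trans (distribʳ _ _ _) (+-congʳ (trans (*-congʳ (*-comm _ _)) (*-assoc _ _ _)))) ⟩
    sum (λ j → m * (δ k j * a j) + δ k′ j * a j)
      ≈⟨ sum-linear m (λ j → δ k j * a j) (λ j → δ k′ j * a j) ⟩
    m * sum (λ j → δ k j * a j) + sum (λ j → δ k′ j * a j)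
      ≈⟨ +-cong (*-congˡ (sum-δˡ a k)) (sum-δˡ a k′) ⟩
    m * a k + a k′
      ≈⟨ +-congʳ (trans (sym (-‿distribˡ-* _ _)) (-‿cong (trans (*-assoc _ _ _)
           (trans (*-congˡ (trans (*-comm _ _) a*i≈1)) (*-identityʳ _))))) ⟩
    - a k′ + a k′
      ≈⟨ -‿inverseˡ _ ⟩
    0# ∎
    where
    open RingProperties ring using (-‿distribˡ-*)
    k′ = punchIn k p
    m = - (a k′ * i)

  -- The rows of `tail S` form a basis of the hyperplane orthogonal to a, and `lower` turns
  -- coordinates into vectors of it. Dropping the entry at k recovers the coordinates, which gives
  -- injectivity.
  lower : V r → V (suc r)
  lower y = y ⊳ tail S

  lower-embedding : Embedding lower
  lower-embedding = record
    { linear = λ b u v → ⊳-linear b u v (tail S)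
    ; kernel = λ {y} e p → trans (sym (lower-punchIn y p)) (e (punchIn k p))
    }
    where
    lower-punchIn : ∀ y p → lower y (punchIn k p) ≈ y p
    lower-punchIn y p = trans (sum-cong-≋ {y = λ q → y q * δ q p} λ q → *-congˡ {y q} (trans
      (+-cong (trans (*-congʳ (δ-off (Fin.punchInᵢ≢i k p ∘ ≡.sym))) (zeroˡ _))
        (δ-injection (punchIn k) (λ {i} {j} → Fin.punchIn-injective k i j) q p))
      (+-identityˡ _))) (sum-δʳ y p)

  lower-orthogonal : ∀ y → sum (λ j → lower y j * a j) ≈ 0#
  lower-orthogonal y = begin
    sum (λ j → lower y j * a j)                    ≈⟨ ⊳-assoc y (tail S) (λ j (_ : Fin 1) → a j) zero ⟩
    sum (λ q → y q * sum (λ j → S (suc q) j * a j)) ≈⟨ sum-zero _ (λ q → trans (*-congˡ (S-a (suc q))) (zeroʳ _)) ⟩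
    0#                                             ∎

-- Blocks of zeros in singular matrices and pencils

-- The two candidates together have size (y₁ + z₁) + (y₂ + z₂) > 2r, so one of them exceeds r. One
-- strict inequality is enough, which allows the second block to be smaller by one.
some-large : ∀ {r a b c d y₁ z₁ y₂ z₂} → a ℕ.+ b ≡ y₁ ℕ.+ y₂ → c ℕ.+ d ≡ z₁ ℕ.+ z₂ →
  r ℕ.< y₁ ℕ.+ z₁ → r ℕ.≤ y₂ ℕ.+ z₂ → r ℕ.< a ℕ.+ d ⊎ r ℕ.< b ℕ.+ c
some-large {r} {a} {b} {c} {d} {y₁} {z₁} {y₂} {z₂} e e′ p q with r ℕ.<? a ℕ.+ d
... | yes r<  = inj₁ r<
... | no r≮ = inj₂ (ℕ.+-cancelˡ-< r r (b ℕ.+ c) (begin-strict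
  r ℕ.+ r                         <⟨ ℕ.+-mono-<-≤ p q ⟩
  (y₁ ℕ.+ z₁) ℕ.+ (y₂ ℕ.+ z₂)     ≡⟨ interchange y₁ z₁ y₂ z₂ ⟩
  (y₁ ℕ.+ y₂) ℕ.+ (z₁ ℕ.+ z₂)     ≡⟨ ≡.cong₂ ℕ._+_ (≡.sym e) (≡.trans (≡.sym e′) (ℕ.+-comm c d)) ⟩
  (a ℕ.+ b) ℕ.+ (d ℕ.+ c)         ≡⟨ interchange a b d c ⟩
  (a ℕ.+ d) ℕ.+ (b ℕ.+ c)         ≤⟨ ℕ.+-monoˡ-≤ (b ℕ.+ c) (ℕ.≮⇒≥ r≮) ⟩
  r ℕ.+ (b ℕ.+ c)                 ∎))
  where
  open ℕ.≤-Reasoning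
  open CommutativeSemigroupProperties ℕ.+-commutativeSemigroup using (interchange)

module SingularPencils {c ℓ} (F : Field c ℓ) where
  open Field F hiding (zero)
  open SemiringSum semiring
  open Determinant commutativeRing
  open DeterminantFormulas commutativeRing
  open LinearIndependence F
  open L using ([]; _∷_)
  open SetoidReasoning setoid

  private variable r s : ℕ

  infix 8 _∙_
  _∙_ : V r → V r → Carrier
  u ∙ v = sum λ j → u j * v j

  ⟨_∣_∣_⟩ : V r → Matrix Carrier r s → V s → Carrier
  ⟨ y ∣ A ∣ z ⟩ = (y ⊳ A) ∙ z

  ∙-subspaceˡ : ∀ (z : V r) → Subspace (λ y → y ∙ z ≈ 0#)
  ∙-subspaceˡ z = ⊳-subspace (λ j (_ : Fin 1) → z j) zero

  ∙-comm : ∀ (u v : V r) → u ∙ v ≈ v ∙ u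
  ∙-comm u v = sum-cong-≋ λ j → *-comm (u j) (v j)

  form-subspaceˡ : ∀ (A : Matrix Carrier r s) z → Subspace (λ y → ⟨ y ∣ A ∣ z ⟩ ≈ 0#)
  form-subspaceˡ A z = record
    { resp    = λ e → S.resp (⊳-cong A e)
    ; ∋-0ᵥ    = S.resp (λ j → sym (⊳-zero A j)) S.∋-0ᵥ
    ; combine = λ a {u} {v} p q → S.resp (λ j → sym (⊳-linear a u v A j)) (S.combine a p q)
    }
    where module S = Subspace (∙-subspaceˡ z)

  form-subspaceʳ : ∀ (A : Matrix Carrier r s) y → Subspace (λ z → ⟨ y ∣ A ∣ z ⟩ ≈ 0#)
  form-subspaceʳ A y = record
    { resp    = λ {u} {v} e p → trans (∙-comm w v) (S.resp e (trans (∙-comm u w) p))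
    ; ∋-0ᵥ    = trans (∙-comm w 0ᵥ) S.∋-0ᵥ
    ; combine = λ a {u} {v} p q → trans (∙-comm w (a · u ⊕ v))
        (S.combine a (trans (∙-comm u w) p) (trans (∙-comm v w) q))
    }
    where
    w = y ⊳ A
    module S = Subspace (∙-subspaceˡ w)

  Orthogonal : Matrix Carrier r s → List (V r) → List (V s) → Set (c ⊔ ℓ)
  Orthogonal A Y Z = ∀ {y z} → Span Y y → Span Z z → ⟨ y ∣ A ∣ z ⟩ ≈ 0#

  orthogonal : ∀ {A : Matrix Carrier r s} {Y Z} → All (λ y → All (λ z → ⟨ y ∣ A ∣ z ⟩ ≈ 0#) Z) Y →
    Orthogonal A Y Z
  orthogonal {A = A} h {y} {z} y∈ z∈ = span-least (form-subspaceˡ A z)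
    (All.map (λ {y} hz → span-least (form-subspaceʳ A y) hz z∈) h) y∈

  -- The block of zeros without a choice of basis: Y and Z stand for row and column subspaces, and
  -- independence makes their lengths dimensions. The bound m is separate from the size, because a
  -- block coming from the contraction is short by one.
  record LargeBlock {a} (As : Matrix Carrier r s → Set a) (m : ℕ) : Set (a ⊔ c ⊔ ℓ) where
    field
      Y      : List (V r)
      Z      : List (V s)
      Y-ind  : Independent Y
      Z-ind  : Independent Z
      large  : m ℕ.< L.length Y ℕ.+ L.length Z
      zeros  : ∀ {A} → As A → Orthogonal A Y Z

  module _ {a} {As : Matrix Carrier r s → Set a} {m : ℕ} (E : Matrix Carrier r s)
    (B₁ : LargeBlock As (suc m)) (B₂ : LargeBlock As m) where
    private
      module B₁ = LargeBlock B₁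
      module B₂ = LargeBlock B₂
      module Y = Modular (modular B₁.Y-ind B₂.Y-ind)
      module Z = Modular (modular B₁.Z-ind B₂.Z-ind)

    -- The candidates are (Y₁ ∩ Y₂, Z₁ + Z₂) and (Y₁ + Y₂, Z₁ ∩ Z₂). A form in `As` vanishes on them
    -- because each summand falls into one of the given blocks; E vanishes because the meet lies in
    -- a side of B₂ that annihilates it. The sizes of the candidates add up to those of B₁ and B₂.
    uncross : (∀ {y} → Span B₂.Y y → ∀ z → ⟨ y ∣ E ∣ z ⟩ ≈ 0#) →
      (∀ {z} → Span B₂.Z z → ∀ y → ⟨ y ∣ E ∣ z ⟩ ≈ 0#) →
      LargeBlock (λ A → As A ⊎ A ≡ E) (suc m)
    uncross E-left E-right
      with some-large {a = L.length Y.meet} {b = L.length Y.join} {c = L.length Z.meet} {d = L.length Z.join}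
        {y₁ = L.length B₁.Y} {y₂ = L.length B₂.Y} Y.sizes Z.sizes B₁.large B₂.large
    ... | inj₁ big = record
      { Y = Y.meet ; Z = Z.join ; Y-ind = Y.meet-ind ; Z-ind = Z.join-ind ; large = big
      ; zeros = λ
        { {A} (inj₁ A∈) {y} y∈ z∈ → let (z₁ , z₂ , s₁ , s₂ , e) = Z.join⊆ z∈
                                        open Subspace (form-subspaceʳ A y) in
            resp e (combine 1#
              (B₁.zeros A∈ (span-least (span-subspace B₁.Y) Y.meet⊆₁ y∈) s₁)
              (B₂.zeros A∈ (span-least (span-subspace B₂.Y) Y.meet⊆₂ y∈) s₂))
        ; (inj₂ ≡.refl) y∈ z∈ → E-left (span-least (span-subspace B₂.Y) Y.meet⊆₂ y∈) _
        }
      }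
    ... | inj₂ big = record
      { Y = Y.join ; Z = Z.meet ; Y-ind = Y.join-ind ; Z-ind = Z.meet-ind ; large = big
      ; zeros = λ
        { {A} (inj₁ A∈) {y} {z} y∈ z∈ → let (y₁ , y₂ , s₁ , s₂ , e) = Y.join⊆ y∈
                                            open Subspace (form-subspaceˡ A z) in
            resp e (combine 1#
              (B₁.zeros A∈ s₁ (span-least (span-subspace B₁.Z) Z.meet⊆₁ z∈))
              (B₂.zeros A∈ s₂ (span-least (span-subspace B₂.Z) Z.meet⊆₂ z∈)))
        ; (inj₂ ≡.refl) y∈ z∈ → E-right (span-least (span-subspace B₂.Z) Z.meet⊆₂ z∈) _
        }
      }

  form-⊡ : ∀ {r′ s′} (S : Matrix Carrier r′ r) (A : Matrix Carrier r s) (T : Matrix Carrier s′ s) y z →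
    ⟨ y ∣ S ⊡ A ⊡ transpose T ∣ z ⟩ ≈ ⟨ y ⊳ S ∣ A ∣ z ⊳ T ⟩
  form-⊡ S A T y z = begin
    sum (λ q → (y ⊳ (S ⊡ A ⊡ transpose T)) q * z q)
      ≈⟨ sum-cong-≋ (λ q → *-congʳ {z q} (trans (sym (⊳-assoc y (S ⊡ A) (transpose T) q))
           (⊳-cong (transpose T) (λ j → sym (⊳-assoc y S A j)) q))) ⟩
    sum (λ q → (y ⊳ S ⊳ A ⊳ transpose T) q * z q)
      ≈⟨ ⊳-assoc (y ⊳ S ⊳ A) (transpose T) (λ q (_ : Fin 1) → z q) zero ⟩
    sum (λ j → (y ⊳ S ⊳ A) j * sum (λ q → T q j * z q))
      ≈⟨ sum-cong-≋ (λ j → *-congˡ {(y ⊳ S ⊳ A) j} (sum-cong-≋ {x = λ q → T q j * z q} λ q → *-comm _ _)) ⟩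
    ⟨ y ⊳ S ∣ A ∣ z ⊳ T ⟩ ∎

  form-outer : ∀ (a : V r) (b : V s) y z → ⟨ y ∣ (λ i j → a i * b j) ∣ z ⟩ ≈ (y ∙ a) * (z ∙ b)
  form-outer a b y z = begin
    sum (λ j → sum (λ i → y i * (a i * b j)) * z j)
      ≈⟨ sum-cong-≋ {y = λ j → (y ∙ a) * (z j * b j)} (λ j → trans (*-congʳ (trans
           (sum-cong-≋ {x = λ i → y i * (a i * b j)} λ i → sym (*-assoc _ _ _))
           (sym (*-distribʳ-sum (b j) (λ i → y i * a i)))))
           (trans (*-assoc _ _ _) (*-congˡ (*-comm _ _)))) ⟩
    sum (λ j → (y ∙ a) * (z j * b j))
      ≈⟨ *-distribˡ-sum (y ∙ a) (λ j → z j * b j) ⟨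
    (y ∙ a) * (z ∙ b) ∎

  form-cong : ∀ {A B : Matrix Carrier r s} → A ≋ B → ∀ y z → ⟨ y ∣ A ∣ z ⟩ ≈ ⟨ y ∣ B ∣ z ⟩
  form-cong {A = A} {B} e y z = sum-cong-≋ λ j → *-congʳ {z j}
    (sum-cong-≋ {x = λ i → y i * A i j} λ i → *-congˡ (e i j))

  pivot? : (A : Matrix Carrier r s) → (∀ i j → A i j ≈ 0#) ⊎ ∃₂ λ k l → ¬ (A k l ≈ 0#)
  pivot? A with Fin.any? (λ k → Fin.any? (λ l → ¬? (A k l ≟ 0#)))
  ... | yes p = inj₂ p
  ... | no ∄p = inj₁ λ i j → decidable-stable (A i j ≟ 0#) λ ≉0 → ∄p (i , j , ≉0)

  form-zero : ∀ {A : Matrix Carrier r s} → (∀ i j → A i j ≈ 0#) → ∀ y z → ⟨ y ∣ A ∣ z ⟩ ≈ 0#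
  form-zero {A = A} e y z = sum-zero (λ j → (y ⊳ A) j * z j) λ j →
    trans (*-congʳ (sum-zero (λ i → y i * A i j) λ i → trans (*-congˡ (e i j)) (zeroʳ _))) (zeroˡ _)

  module Pivot {r : ℕ} (A : Mat (suc r)) (k l : Fin (suc r)) (A≉0 : ¬ (A k l ≈ 0#)) where
    private
      i = proj₁ (inverse _ A≉0)
      A*i≈1 = proj₂ (inverse _ A≉0)

    -- The column through the pivot, and the row through the pivot divided by it. If the minors of A
    -- vanish, then A = a bᵀ (`outer`); for any A, elimination along a and b turns the first row
    -- into a unit vector (`eliminate-top`).
    a b : V (suc r)
    a p = A p l
    b q = A k q * i

    bₗ≈1 : b l * 1# ≈ 1#
    bₗ≈1 = trans (*-identityʳ _) A*i≈1

    module Sₐ = Elimination F a k i A*i≈1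
    module Sᵇ = Elimination F b l 1# bₗ≈1

    eliminate : Mat (suc r) → Mat (suc r)
    eliminate B = Sₐ.S ⊡ B ⊡ transpose Sᵇ.S

    -- The form B restricted to aᗮ × bᗮ, in the bases `tail Sₐ.S` and `tail Sᵇ.S`. For B = A it is
    -- the Schur complement of the pivot.
    reduce : Mat (suc r) → Mat r
    reduce B p q = eliminate B (suc p) (suc q)

    eliminate-top : ∀ q → eliminate A zero q ≈ 1# * δ zero q
    eliminate-top q = begin
      sum (λ j → sum (λ p → Sₐ.S zero p * A p j) * Sᵇ.S q j)
        ≈⟨ sum-cong-≋ {x = λ j → sum (λ p → Sₐ.S zero p * A p j) * Sᵇ.S q j} {y = λ j → Sᵇ.S q j * b j}
             (λ j → trans (*-congʳ (trans (Sₐ.S-top (λ p → A p j)) (*-comm i (A k j)))) (*-comm (b j) (Sᵇ.S q j))) ⟩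
      sum (λ j → Sᵇ.S q j * b j)
        ≈⟨ trans (Sᵇ.S-a q) (sym (*-identityˡ _)) ⟩
      1# * δ zero q ∎

    outer : MinorsVanish A → A ≋ λ p q → a p * b q
    outer v p q = begin
      A p q               ≈⟨ *-identityʳ _ ⟨
      A p q * 1#          ≈⟨ *-congˡ A*i≈1 ⟨
      A p q * (A k l * i) ≈⟨ *-assoc _ _ _ ⟨
      A p q * A k l * i   ≈⟨ *-congʳ (v p q k l) ⟩
      A p l * A k q * i   ≈⟨ *-assoc _ _ _ ⟩
      a p * b q           ∎

    eliminate-outer : MinorsVanish A → ∀ p q → eliminate A p q ≈ δ zero p * δ zero q
    eliminate-outer v p q = begin
      sum (λ j → sum (λ t → Sₐ.S p t * A t j) * Sᵇ.S q j)
        ≈⟨ form-cong (outer v) (Sₐ.S p) (Sᵇ.S q) ⟩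
      ⟨ Sₐ.S p ∣ (λ p q → a p * b q) ∣ Sᵇ.S q ⟩
        ≈⟨ form-outer a b (Sₐ.S p) (Sᵇ.S q) ⟩
      (Sₐ.S p ∙ a) * (Sᵇ.S q ∙ b)
        ≈⟨ *-cong (Sₐ.S-a p) (Sᵇ.S-a q) ⟩
      δ zero p * δ zero q ∎

    module Lowered {a′} {As : Mat r → Set a′} {m} (B : LargeBlock As m) where
      open LargeBlock B

      Y↑ Z↑ : List (V (suc r))
      Y↑ = L.map Sₐ.lower Y
      Z↑ = L.map Sᵇ.lower Z

      Y↑-ind : Independent Y↑
      Y↑-ind = independent-map Sₐ.lower-embedding Y Y-ind

      Z↑-ind : Independent Z↑
      Z↑-ind = independent-map Sᵇ.lower-embedding Z Z-ind

      Y↑-a : ∀ {y} → Span Y↑ y → y ∙ a ≈ 0#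
      Y↑-a = span-least (∙-subspaceˡ a) (AllP.map⁺ (All.universal Sₐ.lower-orthogonal Y))

      Z↑-b : ∀ {z} → Span Z↑ z → z ∙ b ≈ 0#
      Z↑-b = span-least (∙-subspaceˡ b) (AllP.map⁺ (All.universal Sᵇ.lower-orthogonal Z))

      all-span : ∀ {t} (ws : List (V t)) → All (Span ws) ws
      all-span []       = All.[]
      all-span (w ∷ ws) = span-head w ws All.∷ All.map (span-tail w ws) (all-span ws)

      zeros↑ : ∀ {A} → As (reduce A) → Orthogonal A Y↑ Z↑
      zeros↑ {A} A∈ = orthogonal {A = A} (AllP.map⁺ (All.map (λ {y} y∈ → AllP.map⁺ (All.map (λ {z} z∈ →
        trans (sym (form-⊡ (tail Sₐ.S) A (tail Sᵇ.S) y z)) (zeros {reduce A} A∈ y∈ z∈)) (all-span Z))) (all-span Y)))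

  module _ {r} (A : Mat (suc r)) (k l : Fin (suc r)) (A≉0 : ¬ (A k l ≈ 0#)) where
    open Pivot A k l A≉0

    reduce-singular : D A ≈ 0# → D (reduce A) ≈ 0#
    reduce-singular e = det-minor-zero (eliminate A) eliminate-top
      (det-⊡-zero Sₐ.S A (transpose Sᵇ.S) e)

    -- The vectors of Y↑ are orthogonal to a, which is A applied to δ l, so δ l may join Z↑. It is
    -- independent of Z↑, which is orthogonal to b, while b l = 1. The gain of one makes up for the
    -- larger size.
    grow-block : LargeBlock (_≡ reduce A) r → LargeBlock (_≡ A) (suc r)
    grow-block B = record
      { Y = Y↑ ; Z = δ l ∷ Z↑ ; Y-ind = Y↑-ind
      ; Z-ind = (λ s → 1≉0 (trans (sym bₗ≈1) (trans (*-identityʳ _) (trans (sym (sum-δˡ b l)) (Z↑-b s)))))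
              , Z↑-ind
      ; large = ≡.subst₂ (λ m n → suc r ℕ.< m ℕ.+ suc n)
          (≡.sym (LP.length-map Sₐ.lower Y)) (≡.sym (LP.length-map Sᵇ.lower Z))
          (≡.subst (suc r ℕ.<_) (≡.sym (ℕ.+-suc _ _)) (s≤s large))
      ; zeros = λ { ≡.refl {y} {z} y∈ z∈ → span-least (form-subspaceʳ A y)
          (δl-zero y∈ All.∷ All.map (λ z∈ → zeros↑ {A} ≡.refl y∈ z∈) (all-span Z↑)) z∈ }
      }
      where
      open LargeBlock B using (Y; Z; large)
      open Lowered B
      δl-zero : ∀ {y} → Span Y↑ y → ⟨ y ∣ A ∣ δ l ⟩ ≈ 0#
      δl-zero {y} y∈ = trans (sum-cong-≋ {x = λ j → (y ⊳ A) j * δ l j} λ j → *-congˡ (δ-sym l j))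
        (trans (sum-δʳ (y ⊳ A) l) (Y↑-a y∈))

  -- Gaussian elimination: every pivot passes singularity on to a smaller matrix, until a zero
  -- matrix of positive size is left, for which both full spaces serve.
  singular-block : ∀ {r} (A : Mat r) → D A ≈ 0# → LargeBlock (_≡ A) r
  singular-block {zero}  A e = contradiction e 1≉0
  singular-block {suc r} A e with pivot? A
  ... | inj₁ A≈0 = record
    { Y = standardBasis (suc r) ; Z = standardBasis (suc r)
    ; Y-ind = standardBasis-independent (suc r) ; Z-ind = standardBasis-independent (suc r)
    ; large = ≡.subst (λ d → suc r ℕ.< d ℕ.+ d) (≡.sym (standardBasis-length (suc r)))
        (ℕ.m<m+n (suc r) (s≤s z≤n))
    ; zeros = λ { ≡.refl {y} {z} _ _ → form-zero A≈0 y z }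
    }
  ... | inj₂ (k , l , A≉0) = grow-block A k l A≉0
    (singular-block (Pivot.reduce A k l A≉0 A) (reduce-singular A k l A≉0 e))

module PencilSingularity {c ℓ} (F : Field c ℓ) where
  open Field F hiding (zero)
  open Determinant commutativeRing
  open DeterminantFormulas commutativeRing
  open LinearIndependence F
  open SingularPencils F
  open PencilProperties commutativeRing
  open MvRing commutativeRing
  open MvPolynomial rawRing

  detₙ : ∀ n {r} → Mat r → Vector (Mat r) n → MvPoly n
  detₙ n A₀ A = det (rawRing [x₁⋯x n ]) (Pencil n A₀ A)

  -- Setting x₁ = 0, that is, taking the constant term in x₁.
  deletion : ∀ n {r} (A₀ : Mat r) (A : Vector (Mat r) (suc n)) →
    Mv._≈_ (suc n) (detₙ (suc n) A₀ A) (Mv.0# (suc n)) → Mv._≈_ n (detₙ n A₀ (tail A)) (Mv.0# n)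
  deletion n A₀ A e = S.trans (S.sym (S.trans
      (det-homomorphism (mvRing (suc n)) (mvRing n) (PolynomialHomomorphisms.coeff₀-hom (mvRing n)) (Pencil (suc n) A₀ A))
      (Determinant.det-cong (mvRing n) λ i j → S.trans (pencil-suc n A₀ A i j 0)
        (PolynomialHomomorphisms.coeff₀-linear (mvRing n) (Pencil n A₀ (tail A) i j) (const n (A zero i j))))))
    (e 0)
    where module S = Mv n

  -- The coefficient of x₁ when A₁ = e₁ e₁ᵀ.
  contraction : ∀ n {r} (A₀ : Mat (suc r)) (A : Vector (Mat (suc r)) (suc n)) →
    (∀ i j → A zero i j ≈ δ zero i * δ zero j) →
    Mv._≈_ (suc n) (detₙ (suc n) A₀ A) (Mv.0# (suc n)) →
    Mv._≈_ n (detₙ n (λ i j → A₀ (suc i) (suc j)) (λ k i j → A (suc k) (suc i) (suc j))) (Mv.0# n)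
  contraction n {r} A₀ A corner e = S.trans (S.sym (PolynomialHomomorphisms.coeff₁-linear (mvRing n) d₁ d₂))
      (S.trans (S.sym (det-eq 1)) (e 1))
    where
    module S = Mv n
    module S[x] = CommutativeRing (mvRing (suc n))
    module D[x] = Determinant (mvRing (suc n))
    x : MvPoly (suc n)
    x = var {suc n} zero
    C : MvPoly n → MvPoly (suc n)
    C p = p L.∷ L.[]
    C-hom = PolynomialHomomorphisms.constant-hom (mvRing n)
    M : Matrix (MvPoly n) (suc r) (suc r)
    M = Pencil n A₀ (tail A)
    d₁ d₂ : MvPoly n
    d₁ = det (rawRing [x₁⋯x n ]) M
    d₂ = det (rawRing [x₁⋯x n ]) (λ i j → M (suc i) (suc j))
    κ : Carrier → MvPoly (suc n)
    κ = const (suc n)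
    const-δ : ∀ i j → κ (δ {suc r} i j) S[x].≈ D[x].δ i j
    const-δ i j = go (i Fin.≟ j)
      where
      module c = Homomorphism commutativeRing (mvRing (suc n)) (const-hom (suc n))
      go : Dec (i ≡ j) → κ (δ i j) S[x].≈ D[x].δ i j
      go (yes ≡.refl) m = S.trans (c.⟦⟧-cong (δ-diag i) m) (S.trans (c.1#-homo m) (S.sym (D[x].δ-diag i m)))
      go (no i≢j)     m = S.trans (c.⟦⟧-cong (δ-off i≢j) m) (S.trans (c.0#-homo m) (S.sym (D[x].δ-off i≢j m)))
    corner[x] : ∀ i j → κ (A zero i j) S[x].≈ D[x].δ zero i S[x].* D[x].δ zero j
    corner[x] i j = begin
      κ (A zero i j)                      ≈⟨ c.⟦⟧-cong (corner i j) ⟩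
      κ (δ zero i * δ zero j)             ≈⟨ c.*-homo (δ zero i) (δ zero j) ⟩
      κ (δ zero i) S[x].* κ (δ zero j)    ≈⟨ S[x].*-cong {κ (δ zero i)} {D[x].δ zero i} {κ (δ zero j)} {D[x].δ zero j}
                                               (const-δ zero i) (const-δ zero j) ⟩
      D[x].δ zero i S[x].* D[x].δ zero j  ∎
      where
      module c = Homomorphism commutativeRing (mvRing (suc n)) (const-hom (suc n))
      open SetoidReasoning S[x].setoid
    entries : ∀ i j → Pencil (suc n) A₀ A i j S[x].≈ C (M i j) S[x].+ x S[x].* (D[x].δ zero i S[x].* D[x].δ zero j)
    entries i j = begin
      Pencil (suc n) A₀ A i j
        ≈⟨ pencil-suc n A₀ A i j ⟩
      C (M i j) S[x].+ κ (A zero i j) S[x].* x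
        ≈⟨ S[x].+-congˡ {C (M i j)} {κ (A zero i j) S[x].* x} {x S[x].* d}
             (λ m → S.trans (S[x].*-congʳ {x} {κ (A zero i j)} {d} (corner[x] i j) m) (S[x].*-comm d x m)) ⟩
      C (M i j) S[x].+ x S[x].* d ∎
      where
      open SetoidReasoning S[x].setoid
      d = D[x].δ zero i S[x].* D[x].δ zero j
    det-eq : detₙ (suc n) A₀ A S[x].≈ C d₁ S[x].+ x S[x].* C d₂
    det-eq = begin
      detₙ (suc n) A₀ A
        ≈⟨ DeterminantFormulas.det-addCorner (mvRing (suc n)) (λ i j → C (M i j)) (Pencil (suc n) A₀ A) x entries ⟩
      D₁ S[x].+ x S[x].* D₂
        ≈⟨ S[x].+-cong {C d₁} {D₁} {x S[x].* C d₂} {x S[x].* D₂}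
             (det-homomorphism (mvRing n) (mvRing (suc n)) C-hom M)
             (S[x].*-congˡ {x} {C d₂} {D₂}
               (det-homomorphism (mvRing n) (mvRing (suc n)) C-hom (λ i j → M (suc i) (suc j)))) ⟨
      C d₁ S[x].+ x S[x].* C d₂ ∎
      where
      open SetoidReasoning S[x].setoid
      D₁ = D[x].D (λ i j → C (M i j))
      D₂ = D[x].D (λ i j → C (M (suc i) (suc j)))

  weaken : ∀ {a b r s m} {As : Matrix Carrier r s → Set a} {Bs : Matrix Carrier r s → Set b} →
    (∀ {A} → Bs A → As A) → LargeBlock As m → LargeBlock Bs m
  weaken Bs⊆As B = record
    { Y = Y ; Z = Z ; Y-ind = Y-ind ; Z-ind = Z-ind ; large = large ; zeros = λ A∈ → zeros (Bs⊆As A∈) }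
    where open LargeBlock B

  Coefficient : ∀ {n r} → Mat r → Vector (Mat r) n → Mat r → Set c
  Coefficient A₀ A B = B ≡ A₀ ⊎ ∃ λ k → B ≡ A k

  private
    -- B₁ comes from deleting the variable of E and B₂ from contracting it. Lifted into aᗮ × bᗮ, B₂
    -- annihilates E = a bᵀ from either side, as `uncross` requires; its bound is r because the
    -- contracted matrices have size r.
    raise : ∀ {n r} (A₀ : Mat (suc r)) (A : Vector (Mat (suc r)) n) (E : Mat (suc r)) k l E≉0 →
      let open Pivot E k l E≉0 in
      MinorsVanish E →
      LargeBlock (Coefficient A₀ A) (suc r) →
      LargeBlock (Coefficient (reduce A₀) (λ k → reduce (A k))) r →
      LargeBlock (λ B → Coefficient A₀ A B ⊎ B ≡ E) (suc r)
    raise {r = r} A₀ A E k l E≉0 E-minors B₁ B₂ = uncross E B₁ raised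
      (λ {y} y∈ z → trans (form-cong (outer E-minors) y z) (trans (form-outer a b y z)
        (trans (*-congʳ (Y↑-a y∈)) (zeroˡ _))))
      (λ {z} z∈ y → trans (form-cong (outer E-minors) y z) (trans (form-outer a b y z)
        (trans (*-congˡ (Z↑-b z∈)) (zeroʳ _))))
      where
      open Pivot E k l E≉0
      open Lowered B₂
      raised : LargeBlock (Coefficient A₀ A) r
      raised = record
        { Y = Y↑ ; Z = Z↑ ; Y-ind = Y↑-ind ; Z-ind = Z↑-ind
        ; large = ≡.subst₂ (λ m n → r ℕ.< m ℕ.+ n)
            (≡.sym (LP.length-map Sₐ.lower (LargeBlock.Y B₂))) (≡.sym (LP.length-map Sᵇ.lower (LargeBlock.Z B₂)))
            (LargeBlock.large B₂)
        ; zeros = λ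
          { {A} (inj₁ ≡.refl)       → zeros↑ {A} (inj₁ ≡.refl)
          ; {A} (inj₂ (k , ≡.refl)) → zeros↑ {A} (inj₂ (k , ≡.refl))
          }
        }

    reduce-minors : ∀ {r} (A B : Mat (suc r)) k l A≉0 → MinorsVanish B →
      MinorsVanish (Pivot.reduce A k l A≉0 B)
    reduce-minors A B k l A≉0 v p q s t = minorsVanish-⊡ʳ {A = Sₐ.S ⊡ B} (transpose Sᵇ.S)
      (minorsVanish-⊡ˡ Sₐ.S {B} v) (suc p) (suc q) (suc s) (suc t)
      where open Pivot A k l A≉0

    eliminate-singular : ∀ n {r} (A₀ : Mat r) (A : Vector (Mat r) n) P Q →
      Mv._≈_ n (detₙ n A₀ A) (Mv.0# n) →
      Mv._≈_ n (detₙ n (P ⊡ A₀ ⊡ Q) (λ k → P ⊡ A k ⊡ Q)) (Mv.0# n)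
    eliminate-singular n A₀ A P Q e = S.trans (det-pencil-⊡ n P A₀ A Q)
      (S.trans (S.*-congʳ (S.trans (S.*-congˡ e) (S.zeroʳ _))) (S.zeroˡ _))
      where module S = Mv n

  -- For an arbitrary A₀ and A₁,…,Aₙ of rank at most one, a singular pencil has, in suitable
  -- bases, a common p × q block of zeros with p + q > r (a form of Edmonds' matroid
  -- intersection theorem).  Deleting x₁ and, with A₁ = a bᵀ, restricting the forms to
  -- aᗮ × bᗮ give two blocks, which are uncrossed by the modular law for dimensions.
  singular-pencil : ∀ n {r} (A₀ : Mat r) (A : Vector (Mat r) n) → (∀ k → MinorsVanish (A k)) →
    Mv._≈_ n (detₙ n A₀ A) (Mv.0# n) → LargeBlock (Coefficient A₀ A) r
  singular-pencil zero A₀ A v e = weaken (λ { (inj₁ A≡) → A≡ ; (inj₂ (() , _)) })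
    (singular-block A₀ (trans (det-cong λ i j → sym (+-identityʳ (A₀ i j))) e))
  singular-pencil (suc n) {zero} A₀ A v e = contradiction e (nontrivial 1≉0 (suc n))
  singular-pencil (suc n) {suc r} A₀ A v e with pivot? (A zero)
  ... | inj₁ A≈0 = record
    { Y = Y ; Z = Z ; Y-ind = Y-ind ; Z-ind = Z-ind ; large = large
    ; zeros = λ
      { (inj₁ A≡)                  → zeros (inj₁ A≡)
      ; (inj₂ (zero , ≡.refl)) {y} {z} _ _ → form-zero A≈0 y z
      ; (inj₂ (suc k , A≡))        → zeros (inj₂ (k , A≡))
      }
    }
    where open LargeBlock (singular-pencil n A₀ (tail A) (λ k → v (suc k)) (deletion n A₀ A e))
  ... | inj₂ (k , l , A≉0) = weaken
    (λ { (inj₁ A≡)             → inj₁ (inj₁ A≡)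
       ; (inj₂ (zero , A≡))    → inj₂ A≡
       ; (inj₂ (suc k , A≡))   → inj₁ (inj₂ (k , A≡))
       })
    (raise A₀ (tail A) (A zero) k l A≉0 (v zero)
      (singular-pencil n A₀ (tail A) (λ k → v (suc k)) (deletion n A₀ A e))
      (singular-pencil n (reduce A₀) (λ i → reduce (A (suc i)))
        (λ i → reduce-minors (A zero) (A (suc i)) k l A≉0 (v (suc i)))
        -- Multiplying by `Sₐ.S` and the transpose of `Sᵇ.S` turns A₁ into e₁ e₁ᵀ, the form that
        -- `contraction` expects. The minors it leaves are the `reduce`d matrices by definition.
        (contraction n (eliminate A₀) (λ i → eliminate (A i)) (eliminate-outer (v zero))
          (eliminate-singular (suc n) A₀ A Sₐ.S (transpose Sᵇ.S) e))))
    where open Pivot (A zero) k l A≉0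

-- Scaling rows and columns by powers of ε

module _ {c₁ ℓ₁ c₂ ℓ₂} (R : CommutativeRing c₁ ℓ₁) (S : CommutativeRing c₂ ℓ₂)
  {f : CommutativeRing.Carrier R → CommutativeRing.Carrier S} (f-hom : IsHomomorphism R S f) where
  private
    module R = CommutativeRing R
    module S = CommutativeRing S
    module RD = Determinant R
    module SD = Determinant S
    module f = Homomorphism R S f-hom

  ⊡-homomorphism : ∀ {l m n} (A : Matrix R.Carrier l m) (B : Matrix R.Carrier m n) i j →
    f ((A RD.⊡ B) i j) S.≈ ((λ i j → f (A i j)) SD.⊡ (λ i j → f (B i j))) i j
  ⊡-homomorphism A B i j = S.trans (sum-homomorphism R S f-hom (λ k → A i k R.* B k j))
    (SemiringSum.sum-cong-≋ S.semiring {x = λ k → f (A i k R.* B k j)} λ k → f.*-homo (A i k) (B k j))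

  product-homomorphism : ∀ {n} (d : Vector R.Carrier n) →
    f (DeterminantFormulas.product R d) S.≈ DeterminantFormulas.product S (f ∘ d)
  product-homomorphism {zero}  d = f.1#-homo
  product-homomorphism {suc n} d = S.trans (f.*-homo _ _) (S.*-congˡ (product-homomorphism (tail d)))

module PencilScaling {c ℓ} (E : CommutativeRing c ℓ) where
  open CommutativeRing E hiding (zero)
  open Determinant E
  open DeterminantFormulas E
  open PencilProperties E
  open MvRing E
  open MvPolynomial rawRing

  det-scalePencil : ∀ n {r} (d : Vector Carrier r) (A₀ : Mat r) (A : Vector (Mat r) n) →
    Mv._≈_ n (det (rawRing [x₁⋯x n ]) (Pencil n (λ i j → d i * A₀ i j) (λ k i j → d i * A k i j)))
             (Mv._*_ n (const n (product d)) (det (rawRing [x₁⋯x n ]) (Pencil n A₀ A)))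
  det-scalePencil n d A₀ A = S.trans
    (Determinant.det-cong (mvRing n) λ i j → affine-scale n (d i) (A₀ i j) (λ k → A k i j))
    (S.trans (DeterminantFormulas.det-scaleRows (mvRing n) (const n ∘ d) (Pencil n A₀ A))
      (S.*-congʳ (S.sym (product-homomorphism E (mvRing n) (const-hom n) d))))
    where module S = Mv n

  det-scalePencilColumns : ∀ n {r} (d : Vector Carrier r) (A₀ : Mat r) (A : Vector (Mat r) n) →
    Mv._≈_ n (det (rawRing [x₁⋯x n ]) (Pencil n (λ i j → d j * A₀ i j) (λ k i j → d j * A k i j)))
             (Mv._*_ n (const n (product d)) (det (rawRing [x₁⋯x n ]) (Pencil n A₀ A)))
  det-scalePencilColumns n d A₀ A = S.trans
    (Determinant.det-cong (mvRing n) λ i j →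
      S.trans (affine-scale n (d j) (A₀ i j) (λ k → A k i j)) (S.*-comm _ _))
    (S.trans (DeterminantFormulas.det-scaleColumns (mvRing n) (const n ∘ d) (Pencil n A₀ A))
      (S.*-congʳ (S.sym (product-homomorphism E (mvRing n) (const-hom n) d))))
    where module S = Mv n

  scale-minors : ∀ {r} (d : Vector Carrier r) {A : Mat r} → MinorsVanish A → MinorsVanish (λ i j → d i * A i j)
  scale-minors d {A} v i j k l = trans (interchange _ _ _ _)
    (trans (*-congˡ (v i j k l)) (interchange _ _ _ _))
    where open CommutativeSemigroupProperties *-commutativeSemigroup using (interchange)

  -- Scaling a single row multiplies the determinant by exactly a and keeps the minors zero; a
  -- descent step returns its surplus factor in this way.
  firstRow : ∀ {r} → Carrier → Vector Carrier (suc r)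
  firstRow a = a Vec.∷ λ _ → 1#

  product-firstRow : ∀ {r} a → product (firstRow {r} a) ≈ a
  product-firstRow {r} a = trans (*-congˡ (ones r)) (*-identityʳ a)
    where
    ones : ∀ r → product {r} (λ _ → 1#) ≈ 1#
    ones zero    = refl
    ones (suc r) = trans (*-identityˡ _) (ones r)

module Rescaling {c ℓ} (E : CommutativeRing c ℓ) (ε : CommutativeRing.Carrier E)
  (ε-cancel : ∀ {x y} → CommutativeRing._≈_ E (CommutativeRing._*_ E ε x) (CommutativeRing._*_ E ε y) →
              CommutativeRing._≈_ E x y) where
  open CommutativeRing E hiding (zero)
  open Determinant E
  open DeterminantFormulas E
  open PencilProperties E
  open MvRing E
  open MvPolynomial rawRing
  open PencilScaling E public

  pow : ℕ → Carrier
  pow zero    = 1#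
  pow (suc m) = ε * pow m

  pow-+ : ∀ m n → pow (m ℕ.+ n) ≈ pow m * pow n
  pow-+ zero    n = sym (*-identityˡ _)
  pow-+ (suc m) n = trans (*-congˡ (pow-+ m n)) (sym (*-assoc _ _ _))

  gather : ∀ p e u q {t} → t ≈ p * (e * q) → (p * e) * (u * q) ≈ u * t
  gather p e u q t≈ = trans
    (solve 4 (λ p e u q → (p :* e) :* (u :* q) := u :* (p :* (e :* q))) refl p e u q) (*-congˡ (sym t≈))
    where open Solver commutativeSemiring using (solve; _:=_; _:*_)

  product-eq : ∀ {s p p′ q q′ t u} → p ≈ p′ → q ≈ q′ → t ≈ p′ * q′ → u ≈ s * t → s * (p * q) ≈ u
  product-eq p≈ q≈ t≈ u≈ = trans (*-congˡ (trans (*-cong p≈ q≈) (sym t≈))) (sym u≈)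

  rowScale columnScale : Bool → Carrier
  rowScale    b = if b then ε else 1#
  columnScale b = if b then 1# else ε

  product-rowScale : ∀ {r} (σ : Vector Bool r) → product (rowScale ∘ σ) ≈ pow (count σ)
  product-rowScale {zero}  σ = refl
  product-rowScale {suc r} σ with σ zero
  ... | true  = *-congˡ (product-rowScale (tail σ))
  ... | false = trans (*-identityˡ _) (product-rowScale (tail σ))

  -- The unselected columns contribute ε to the power r - `count` τ; multiplying by the
  -- complementary power avoids the subtraction.
  product-columnScale : ∀ {r} (τ : Vector Bool r) → product (columnScale ∘ τ) * pow (count τ) ≈ pow r
  product-columnScale {zero}  τ = *-identityˡ 1#
  product-columnScale {suc r} τ with τ zero
  ... | true  = trans (*-congʳ (*-identityˡ _)) (trans (x∙yz≈y∙xz _ _ _) (*-congˡ (product-columnScale (tail τ))))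
    where open CommutativeSemigroupProperties *-commutativeSemigroup using (x∙yz≈y∙xz)
  ... | false = trans (*-assoc _ _ _) (*-congˡ (product-columnScale (tail τ)))

  rowScale-cancel : ∀ b {x y} → rowScale b * x ≈ rowScale b * y → x ≈ y
  rowScale-cancel true  e = ε-cancel e
  rowScale-cancel false e = trans (sym (*-identityˡ _)) (trans e (*-identityˡ _))

  -- A′ arises from B by dividing the rows selected by σ by ε and multiplying the
  -- columns not selected by τ by ε; stated without division.
  Rescaled : ∀ {r} → Vector Bool r → Vector Bool r → Mat r → Mat r → Set ℓ
  Rescaled σ τ B A′ = ∀ i j → rowScale (σ i) * A′ i j ≈ columnScale (τ j) * B i j

  module _ {r} {σ τ : Vector Bool r} where

    -- In division-free form: the determinant is multiplied by ε to the power r - `count` σ -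
    -- `count` τ, so it loses factors ε as soon as the two counts together exceed r.
    det-rescaled : ∀ n {B₀ A₀′ : Mat r} {B A′ : Vector (Mat r) n} →
      Rescaled σ τ B₀ A₀′ → (∀ k → Rescaled σ τ (B k) (A′ k)) →
      Mv._≈_ n
        (Mv._*_ n (const n (pow (count σ ℕ.+ count τ))) (det (rawRing [x₁⋯x n ]) (Pencil n A₀′ A′)))
        (Mv._*_ n (const n (pow r)) (det (rawRing [x₁⋯x n ]) (Pencil n B₀ B)))
    det-rescaled n {B₀} {A₀′} {B} {A′} e₀ e = begin
      const n (pow (count σ ℕ.+ count τ)) S.* d′
        ≈⟨ S.*-congʳ (c.⟦⟧-cong (trans (pow-+ (count σ) (count τ)) (trans (*-comm _ _)
             (*-congˡ (sym (product-rowScale σ)))))) ⟩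
      const n (pow (count τ) * product (rowScale ∘ σ)) S.* d′
        ≈⟨ S.trans (S.*-congʳ (c.*-homo _ _)) (S.*-assoc _ _ _) ⟩
      const n (pow (count τ)) S.* (const n (product (rowScale ∘ σ)) S.* d′)
        ≈⟨ S.*-congˡ (det-scalePencil n (rowScale ∘ σ) A₀′ A′) ⟨
      const n (pow (count τ)) S.* det (rawRing [x₁⋯x n ])
        (Pencil n (λ i j → rowScale (σ i) * A₀′ i j) (λ k i j → rowScale (σ i) * A′ k i j))
        ≈⟨ S.*-congˡ (Determinant.det-cong (mvRing n) λ i j → affine-cong n (e₀ i j) (λ k → e k i j)) ⟩
      const n (pow (count τ)) S.* det (rawRing [x₁⋯x n ])
        (Pencil n (λ i j → columnScale (τ j) * B₀ i j) (λ k i j → columnScale (τ j) * B k i j))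
        ≈⟨ S.*-congˡ (det-scalePencilColumns n (columnScale ∘ τ) B₀ B) ⟩
      const n (pow (count τ)) S.* (const n (product (columnScale ∘ τ)) S.* d)
        ≈⟨ S.trans (S.*-congʳ (c.*-homo _ _)) (S.*-assoc _ _ _) ⟨
      const n (pow (count τ) * product (columnScale ∘ τ)) S.* d
        ≈⟨ S.*-congʳ (c.⟦⟧-cong (trans (*-comm _ _) (product-columnScale τ))) ⟩
      const n (pow r) S.* d ∎
      where
      module S = Mv n
      module c = Homomorphism E (mvRing n) (const-hom n)
      open SetoidReasoning S.setoid
      d = det (rawRing [x₁⋯x n ]) (Pencil n B₀ B)
      d′ = det (rawRing [x₁⋯x n ]) (Pencil n A₀′ A′)

    -- Both products of entries acquire the same row and column factors, and the row factors can be
    -- cancelled.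
    rescaled-minors : ∀ {B A′ : Mat r} → Rescaled σ τ B A′ → MinorsVanish B → MinorsVanish A′
    rescaled-minors {B} {A′} e v i j k l = rowScale-cancel (σ k) (rowScale-cancel (σ i) (begin
      ρ i * (ρ k * (A′ i j * A′ k l))
        ≈⟨ expand j l ⟩
      (κ j * κ l) * (B i j * B k l)
        ≈⟨ *-cong (*-comm _ _) (v i j k l) ⟩
      (κ l * κ j) * (B i l * B k j)
        ≈⟨ expand l j ⟨
      ρ i * (ρ k * (A′ i l * A′ k j)) ∎))
      where
      open Solver commutativeSemiring using (solve; _:=_; _:*_)
      open SetoidReasoning setoid
      ρ = λ i → rowScale (σ i)
      κ = λ j → columnScale (τ j)
      expand : ∀ j l → ρ i * (ρ k * (A′ i j * A′ k l)) ≈ (κ j * κ l) * (B i j * B k l)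
      expand j l = trans
        (solve 4 (λ a b x y → a :* (b :* (x :* y)) := (a :* x) :* (b :* y)) refl (ρ i) (ρ k) (A′ i j) (A′ k l))
        (trans (*-cong (e i j) (e k l))
          (solve 4 (λ a b x y → (a :* x) :* (b :* y) := (a :* b) :* (x :* y)) refl (κ j) (κ l) (B i j) (B k l)))

    rescaled-zero : ∀ {B A′ : Mat r} → Rescaled σ τ B A′ → (∀ i j → B i j ≈ 0#) → ∀ i j → A′ i j ≈ 0#
    rescaled-zero e B≈0 i j = rowScale-cancel (σ i)
      (trans (e i j) (trans (*-congˡ (B≈0 i j)) (trans (zeroʳ _) (sym (zeroʳ _)))))

-- Descent on the order in ε

module PowerSeriesOrder {c ℓ} (R : CommutativeRing c ℓ) where
  open CommutativeRing R hiding (zero)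
  open Polynomial rawRing
  open PolynomialRing R
  open L using ([]; _∷_)

  ε : List Carrier
  ε = 0# ∷ 1# ∷ []

  ε-⊠ : ∀ p → ε ⊠ p ≈ₚ shift p
  ε-⊠ p k = trans (shift-⊠ (1# ∷ []) p k) (shift-cong {(1# ∷ []) ⊠ p} {p} (⊠-identityˡ p) k)

  ε-cancel : ∀ {p q} → ε ⊠ p ≈ₚ ε ⊠ q → p ≈ₚ q
  ε-cancel {p} {q} e k = trans (sym (ε-⊠ p (suc k))) (trans (e (suc k)) (ε-⊠ q (suc k)))

  open Rescaling (PolynomialRing.commutativeRing R) ε (λ {p} {q} → ε-cancel {p} {q}) public

module Descent {c ℓ} (F : Field c ℓ) where
  open Field F hiding (zero)
  open Polynomial rawRing using (coeff; _⊠_)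
  open PolynomialRing commutativeRing using (_≈ₚ_; shift; ⊠-identityˡ; ⊠-assoc)
  open PowerSeriesOrder commutativeRing
  open L using ([]; _∷_)

  E = PolynomialRing.commutativeRing commutativeRing
  module E = CommutativeRing E
  module Eₙ = MvRing E
  module Fₙ = MvRing commutativeRing
  open MvPolynomial using (MvPoly; const; coefficient)
  open Determinant commutativeRing using (_⊡_; D; δ; det-⊡; det-cong; det-δ)
  open Determinant E using () renaming (_⊡_ to _⊡ᴱ_; D to Dᴱ)
  open DeterminantFormulas E using (MinorsVanish; minorsVanish-⊡ˡ; minorsVanish-⊡ʳ; product; conjugate-zero)
  open DeterminantFormulas commutativeRing using () renaming (MinorsVanish to MinorsVanishᶠ)

  Matᴱ Matᶠ : ℕ → Set c
  Matᴱ r = Matrix E.Carrier r r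
  Matᶠ r = Matrix Carrier r r

  constant-hom = PolynomialHomomorphisms.constant-hom commutativeRing
  coeff₀-hom = PolynomialHomomorphisms.coeff₀-hom commutativeRing

  κ : Carrier → E.Carrier
  κ a = a ∷ []

  coeff₀ : E.Carrier → Carrier
  coeff₀ p = coeff p 0

  detᴱ : ∀ n {r} → Matᴱ r → Vector (Matᴱ r) n → MvPoly E.rawRing n
  detᴱ n A₀ A = det (E.rawRing [x₁⋯x n ]) (affinePencil E.rawRing A₀ A)

  detᶠ : ∀ n {r} → Matᶠ r → Vector (Matᶠ r) n → MvPoly rawRing n
  detᶠ n A₀ A = det (rawRing [x₁⋯x n ]) (affinePencil rawRing A₀ A)

  coeff-pow : ∀ m p k → coeff (pow m ⊠ p) (m ℕ.+ k) ≈ coeff p k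
  coeff-pow zero    p k = ⊠-identityˡ p k
  coeff-pow (suc m) p k = trans (⊠-assoc ε (pow m) p (suc m ℕ.+ k))
    (trans (ε-⊠ (pow m ⊠ p) (suc m ℕ.+ k)) (coeff-pow m p k))

  -- G = εᴺ (f + O(ε))
  record Leading (N : ℕ) {n} (f : MvPoly rawRing n) (G : MvPoly E.rawRing n) : Set (c ⊔ ℓ) where
    field
      below : ∀ α k → k ℕ.< N → coeff (coefficient E.rawRing n G α) k ≈ 0#
      at    : ∀ α → coeff (coefficient E.rawRing n G α) N ≈ coefficient rawRing n f α

  -- Up to the cancellable factor `pow m` the hypothesis is ε G′ = G, so the coefficients of G′ are
  -- those of G moved down by one.
  leading-shift : ∀ {N n} {f : MvPoly rawRing n} {G G′ : MvPoly E.rawRing n} m →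
    Eₙ.Mv._≈_ n (Eₙ.Mv._*_ n (const E.rawRing n (pow m ⊠ ε)) G′) (Eₙ.Mv._*_ n (const E.rawRing n (pow m)) G) →
    Leading (suc N) f G → Leading N f G′
  leading-shift {N} {n} {f} {G} {G′} m e L = record
    { below = λ α k k<N → trans (coeffs α k) (below α (suc k) (s≤s k<N))
    ; at    = λ α → trans (coeffs α N) (at α)
    }
    where
    open Leading L
    open SetoidReasoning setoid
    coeffs : ∀ α k → coeff (coefficient E.rawRing n G′ α) k ≈ coeff (coefficient E.rawRing n G α) (suc k)
    coeffs α k = begin
      coeff g′ k                          ≈⟨ ε-⊠ g′ (suc k) ⟨
      coeff (ε ⊠ g′) (suc k)              ≈⟨ coeff-pow m (ε ⊠ g′) (suc k) ⟨
      coeff (pow m ⊠ (ε ⊠ g′)) (m ℕ.+ suc k) ≈⟨ ⊠-assoc (pow m) ε g′ (m ℕ.+ suc k) ⟨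
      coeff (pow m ⊠ ε ⊠ g′) (m ℕ.+ suc k) ≈⟨ Eₙ.coefficient-scale n (pow m ⊠ ε) G′ α (m ℕ.+ suc k) ⟨
      coeff (coefficient E.rawRing n (Eₙ.Mv._*_ n (const E.rawRing n (pow m ⊠ ε)) G′) α) (m ℕ.+ suc k)
                                          ≈⟨ Eₙ.coefficient-cong n e α (m ℕ.+ suc k) ⟩
      coeff (coefficient E.rawRing n (Eₙ.Mv._*_ n (const E.rawRing n (pow m)) G) α) (m ℕ.+ suc k)
                                          ≈⟨ Eₙ.coefficient-scale n (pow m) G α (m ℕ.+ suc k) ⟩
      coeff (pow m ⊠ g) (m ℕ.+ suc k)     ≈⟨ coeff-pow m g (suc k) ⟩
      coeff g (suc k)                     ∎
      where
      g = coefficient E.rawRing n G α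
      g′ = coefficient E.rawRing n G′ α

  -- For a selected row and a selected column the constant coefficient is dropped. This is division
  -- by ε because that coefficient vanishes on the block. For a selected row and an unselected
  -- column the factors ε⁻¹ and ε cancel.
  rescale : Bool → Bool → E.Carrier → E.Carrier
  rescale true  true  p = L.drop 1 p
  rescale true  false p = p
  rescale false true  p = p
  rescale false false p = ε ⊠ p

  rescale-correct : ∀ b b′ p → (b ≡ true → b′ ≡ true → coeff₀ p ≈ 0#) →
    rowScale b ⊠ rescale b b′ p ≈ₚ columnScale b′ ⊠ p
  rescale-correct true true p p₀≈0 k = trans (ε-⊠ (L.drop 1 p) k)
    (trans (drop-coeff p (p₀≈0 ≡.refl ≡.refl) k) (sym (⊠-identityˡ p k)))
    where
    drop-coeff : ∀ p → coeff₀ p ≈ 0# → shift (L.drop 1 p) ≈ₚ p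
    drop-coeff []      e zero    = refl
    drop-coeff []      e (suc k) = refl
    drop-coeff (a ∷ p) e zero    = sym e
    drop-coeff (a ∷ p) e (suc k) = refl
  rescale-correct true  false p _ k = refl
  rescale-correct false true  p _ k = refl
  rescale-correct false false p _ k = ⊠-identityˡ (ε ⊠ p) k

  reduction : ∀ n {r} (A₀ : Matᴱ r) (A : Vector (Matᴱ r) n) α →
    coefficient rawRing n (detᶠ n (λ i j → coeff₀ (A₀ i j)) (λ k i j → coeff₀ (A k i j))) α ≈
    coeff₀ (coefficient E.rawRing n (detᴱ n A₀ A) α)
  reduction n A₀ A α = trans
    (sym (Fₙ.coefficient-cong n (det-pencil-homomorphism E commutativeRing coeff₀-hom n A₀ A) α))
    (coefficient-mvMap E commutativeRing coeff₀ coeff₀-hom n (detᴱ n A₀ A) α)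

  -- `zero₀` travels through the descent as an implication, so that one descent serves both halves
  -- of the theorem.
  record Step (N : ℕ) {n r} (A₀ : Matᴱ r) (f : MvPoly rawRing n) : Set (c ⊔ ℓ) where
    field
      A₀′     : Matᴱ r
      A′      : Vector (Matᴱ r) n
      minors  : ∀ k → MinorsVanish (A′ k)
      zero₀   : (∀ i j → A₀ i j E.≈ E.0#) → ∀ i j → A₀′ i j E.≈ E.0#
      leading : Leading N {n} f (detᴱ n A₀′ A′)

  module _ {n r} (A₀ : Matᴱ (suc r)) (A : Vector (Matᴱ (suc r)) n)
    (A-minors : ∀ k → MinorsVanish (A k)) where
    open LinearIndependence F using (Completion; complete)
    open SingularPencils F using (LargeBlock)
    open PencilSingularity F using (Coefficient)

    bar : Matᴱ (suc r) → Matᶠ (suc r)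
    bar B i j = coeff₀ (B i j)

    module _ (B : LargeBlock (Coefficient (bar A₀) (λ k → bar (A k))) (suc r)) where
      open LargeBlock B
      module CY = Completion (complete Y-ind)
      module CZ = Completion (complete Z-ind)
      σ = CY.mask
      τ = CZ.mask

      P Q : Matᴱ (suc r)
      P i j = κ (CY.P i j)
      -- Transposed because the rows of `CZ.P` are the basis on the column side: at ε = 0 the
      -- entries of `conjugate C` are the values of the form C on pairs of basis vectors.
      Q i j = κ (CZ.P j i)

      conjugate : Matᴱ (suc r) → Matᴱ (suc r)
      conjugate C = P ⊡ᴱ C ⊡ᴱ Q

      conjugate-bar : ∀ C i j → coeff₀ (conjugate C i j) ≈ (CY.P ⊡ bar C ⊡ transpose CZ.P) i j
      conjugate-bar C i j = trans (⊡-homomorphism E commutativeRing coeff₀-hom (P ⊡ᴱ C) Q i j)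
        (DeterminantFormulas.⊡-cong commutativeRing
          {A = λ i j → coeff₀ ((P ⊡ᴱ C) i j)} {B = transpose CZ.P}
          (⊡-homomorphism E commutativeRing coeff₀-hom P C) (λ i j → refl) i j)

      divide : Matᴱ (suc r) → Matᴱ (suc r)
      divide C i j = rescale (σ i) (τ j) (conjugate C i j)

      divide-rescaled : ∀ C → Coefficient (bar A₀) (λ k → bar (A k)) (bar C) →
        Rescaled σ τ (conjugate C) (divide C)
      divide-rescaled C C∈ i j = rescale-correct (σ i) (τ j) (conjugate C i j) λ σᵢ τⱼ →
        trans (conjugate-bar C i j) (zeros C∈ (CY.inside i σᵢ) (CZ.inside j τⱼ))

      -- The block exceeds the size `suc r` by s + 1: one power of ε is the gain of the step, the
      -- other s are surplus.
      excess : ∃ λ s → suc r ℕ.+ suc s ≡ count σ ℕ.+ count τ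
      excess = let (s , e) = ℕ.m≤n⇒∃[o]m+o≡n large in
        s , ≡.trans (ℕ.+-suc (suc r) s) (≡.trans e (≡.sym (≡.cong₂ ℕ._+_ CY.size CZ.size)))

      s = proj₁ excess

      -- The inverse of det P · det Q, since `CY.Q` and `CZ.Q` are the inverses of `CY.P` and
      -- `CZ.P`.
      scalar : Carrier
      scalar = D CY.Q * D CZ.Q

      -- Gives back the surplus ε^s and undoes the determinants of the base changes, so that the
      -- order drops by exactly one and the leading polynomial stays f.
      scale : E.Carrier
      scale = κ scalar ⊠ pow s

      d : Vector E.Carrier (suc r)
      d = firstRow scale

      A₀″ : Matᴱ (suc r)
      A₀″ i j = d i ⊠ divide A₀ i j

      A″ : Vector (Matᴱ (suc r)) n
      A″ k i j = d i ⊠ divide (A k) i j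

      κ-det : ∀ (M : Matᶠ (suc r)) → Dᴱ (λ i j → κ (M i j)) E.≈ κ (D M)
      κ-det M k = sym (det-homomorphism commutativeRing E constant-hom M k)

      unit : κ scalar E.* (Dᴱ P E.* Dᴱ Q) E.≈ E.1#
      unit = E.trans {κ scalar E.* (Dᴱ P E.* Dᴱ Q)} {κ (scalar * (D CY.P * D CZ.P))} {E.1#}
        (product-eq {κ scalar} {Dᴱ P} {κ (D CY.P)} {Dᴱ Q} {κ (D CZ.P)} {κ (D CY.P * D CZ.P)} {κ (scalar * (D CY.P * D CZ.P))}
          (κ-det CY.P)
          (λ k → trans (κ-det (transpose CZ.P) k) (κ.⟦⟧-cong (Determinant.det-transpose commutativeRing CZ.P) k))
          (κ.*-homo (D CY.P) (D CZ.P)) (κ.*-homo scalar (D CY.P * D CZ.P)))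
        (κ.⟦⟧-cong (trans (interchange (D CY.Q) (D CZ.Q) (D CY.P) (D CZ.P))
          (trans (*-cong (inverse-det CY.Q CY.P CY.QP≋δ) (inverse-det CZ.Q CZ.P CZ.QP≋δ)) (*-identityˡ 1#))))
        where
        module κ = Homomorphism commutativeRing E constant-hom
        open CommutativeSemigroupProperties *-commutativeSemigroup using (interchange)
        inverse-det : ∀ (M N : Matᶠ (suc r)) → (∀ i j → (M ⊡ N) i j ≈ δ i j) → D M * D N ≈ 1#
        inverse-det M N e = trans (sym (det-⊡ M N)) (trans (det-cong e) (det-δ (suc r)))

      -- Up to the factor `pow (suc r)`, which stems from `det-rescaled`, the old determinant is ε
      -- times the new one.
      det-step : Eₙ.Mv._≈_ n
        (Eₙ.Mv._*_ n (const E.rawRing n (pow (suc r) ⊠ ε)) (detᴱ n A₀″ A″))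
        (Eₙ.Mv._*_ n (const E.rawRing n (pow (suc r))) (detᴱ n A₀ A))
      det-step = begin
        κₙ (pow (suc r) ⊠ ε) Mv.* detᴱ n A₀″ A″
          ≈⟨ Mv.*-congˡ (Mv.trans (det-scalePencil n d (divide A₀) (λ k → divide (A k)))
               (Mv.*-congʳ (c.⟦⟧-cong {product d} {scale} (product-firstRow {r} scale)))) ⟩
        κₙ (pow (suc r) ⊠ ε) Mv.* (κₙ scale Mv.* d′)
          ≈⟨ Mv.trans (Mv.*-congʳ (c.*-homo (pow (suc r) ⊠ ε) scale)) (Mv.*-assoc _ _ _) ⟨
        κₙ ((pow (suc r) ⊠ ε) ⊠ scale) Mv.* d′
          ≈⟨ Mv.*-congʳ (c.⟦⟧-cong {(pow (suc r) ⊠ ε) ⊠ scale} {κ scalar ⊠ pow (suc r ℕ.+ suc s)} powers) ⟩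
        κₙ (κ scalar ⊠ pow (suc r ℕ.+ suc s)) Mv.* d′
          ≈⟨ Mv.trans (Mv.*-congʳ (c.*-homo (κ scalar) (pow (suc r ℕ.+ suc s)))) (Mv.*-assoc _ _ _) ⟩
        κₙ (κ scalar) Mv.* (κₙ (pow (suc r ℕ.+ suc s)) Mv.* d′)
          ≈⟨ Mv.*-congˡ (≡.subst (λ m → κₙ (pow m) Mv.* d′ Mv.≈ κₙ (pow (suc r)) Mv.* detᴱ n (conjugate A₀) (λ k → conjugate (A k)))
               (≡.sym (proj₂ excess))
               (det-rescaled {σ = σ} {τ} n {conjugate A₀} {divide A₀} {λ k → conjugate (A k)} {λ k → divide (A k)}
                 (divide-rescaled A₀ (inj₁ ≡.refl)) (λ k → divide-rescaled (A k) (inj₂ (k , ≡.refl))))) ⟩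
        κₙ (κ scalar) Mv.* (κₙ (pow (suc r)) Mv.* detᴱ n (conjugate A₀) (λ k → conjugate (A k)))
          ≈⟨ Mv.*-congˡ (Mv.*-congˡ (PencilProperties.det-pencil-⊡ E n P A₀ A Q)) ⟩
        κₙ (κ scalar) Mv.* (κₙ (pow (suc r)) Mv.* (κₙ (Dᴱ P) Mv.* detᴱ n A₀ A Mv.* κₙ (Dᴱ Q)))
          ≈⟨ solve 5 (λ u p x a y → u :* (p :* (x :* a :* y)) := u :* (x :* y) :* (p :* a))
               Mv.refl (κₙ (κ scalar)) (κₙ (pow (suc r))) (κₙ (Dᴱ P)) (detᴱ n A₀ A) (κₙ (Dᴱ Q)) ⟩
        κₙ (κ scalar) Mv.* (κₙ (Dᴱ P) Mv.* κₙ (Dᴱ Q)) Mv.* (κₙ (pow (suc r)) Mv.* detᴱ n A₀ A)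
          ≈⟨ Mv.*-congʳ (Mv.trans (Mv.*-congˡ (Mv.sym (c.*-homo (Dᴱ P) (Dᴱ Q))))
               (Mv.trans (Mv.sym (c.*-homo (κ scalar) (Dᴱ P E.* Dᴱ Q)))
               (Mv.trans (c.⟦⟧-cong {κ scalar E.* (Dᴱ P E.* Dᴱ Q)} {E.1#} unit) c.1#-homo))) ⟩
        Mv.1# Mv.* (κₙ (pow (suc r)) Mv.* detᴱ n A₀ A)
          ≈⟨ Mv.*-identityˡ _ ⟩
        κₙ (pow (suc r)) Mv.* detᴱ n A₀ A ∎
        where
        module Mv = CommutativeRing (Eₙ.mvRing n)
        module c = Homomorphism E (Eₙ.mvRing n) (Eₙ.const-hom n)
        open SetoidReasoning Mv.setoid
        open Solver Mv.commutativeSemiring using (solve; _:=_; _:*_)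
        κₙ = const E.rawRing n
        d′ = detᴱ n (divide A₀) (λ k → divide (A k))
        powers : (pow (suc r) ⊠ ε) ⊠ scale ≈ₚ κ scalar ⊠ pow (suc r ℕ.+ suc s)
        powers = gather (pow (suc r)) ε (κ scalar) (pow s) {pow (suc r ℕ.+ suc s)} (pow-+ (suc r) (suc s))

      step : ∀ {N} {f : MvPoly rawRing n} → Leading (suc N) {n} f (detᴱ n A₀ A) → Step N {n} A₀ f
      step L = record
        { A₀′ = A₀″ ; A′ = A″
        ; minors = λ k → scale-minors d {divide (A k)} (rescaled-minors {σ = σ} {τ} {conjugate (A k)} {divide (A k)}
            (divide-rescaled (A k) (inj₂ (k , ≡.refl)))
            (minorsVanish-⊡ʳ {A = P ⊡ᴱ A k} Q (minorsVanish-⊡ˡ P {A k} (A-minors k))))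
        ; zero₀ = λ A₀≈0 i j k → trans
            (E.*-congˡ {d i} {divide A₀ i j} {E.0#}
              (rescaled-zero {σ = σ} {τ} {conjugate A₀} {divide A₀} (divide-rescaled A₀ (inj₁ ≡.refl))
                (conjugate-zero P A₀ Q A₀≈0) i j) k)
            (E.zeroʳ (d i) k)
        ; leading = leading-shift (suc r) det-step L
        }

  bar-minors : ∀ {r} {A : Matᴱ r} → MinorsVanish A → MinorsVanishᶠ (λ i j → coeff₀ (A i j))
  bar-minors {A = A} v i j k l = trans (sym (c.*-homo (A i j) (A k l))) (trans (v i j k l 0) (c.*-homo (A i l) (A k j)))
    where module c = Homomorphism E commutativeRing coeff₀-hom

  record Specialisation {n r} (A₀ : Matᴱ r) (f : MvPoly rawRing n) : Set (c ⊔ ℓ) where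
    field
      B₀     : Matᶠ r
      B      : Vector (Matᶠ r) n
      minors : ∀ k → MinorsVanishᶠ (B k)
      zero₀  : (∀ i j → A₀ i j E.≈ E.0#) → ∀ i j → B₀ i j ≈ 0#
      value  : Fₙ.Mv._≈_ n f (detᶠ n B₀ B)

  specialise : ∀ N {n r} (A₀ : Matᴱ r) (A : Vector (Matᴱ r) n) → (∀ k → MinorsVanish (A k)) →
    (f : MvPoly rawRing n) → Leading N {n} f (detᴱ n A₀ A) → Specialisation {n} A₀ f
  specialise zero {n} A₀ A v f L = record
    { B₀     = λ i j → coeff₀ (A₀ i j)
    ; B      = λ k i j → coeff₀ (A k i j)
    ; minors = λ k → bar-minors {A = A k} (v k)
    ; zero₀  = λ e i j → e i j 0
    ; value  = Fₙ.coefficient-ext n λ α → trans (sym (Leading.at L α)) (sym (reduction n A₀ A α))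
    }
  specialise (suc N) {n} {r} A₀ A v f L = go r A₀ A v L singular
    where
    singular : Fₙ.Mv._≈_ n (detᶠ n (λ i j → coeff₀ (A₀ i j)) (λ k i j → coeff₀ (A k i j))) (Fₙ.Mv.0# n)
    singular = Fₙ.coefficient-ext n λ α →
      trans (reduction n A₀ A α) (trans (Leading.below L α 0 (s≤s z≤n)) (sym (Fₙ.coefficient-0# n α)))
    go : ∀ r (A₀ : Matᴱ r) (A : Vector (Matᴱ r) n) → (∀ k → MinorsVanish (A k)) →
      Leading (suc N) {n} f (detᴱ n A₀ A) →
      Fₙ.Mv._≈_ n (detᶠ n (λ i j → coeff₀ (A₀ i j)) (λ k i j → coeff₀ (A k i j))) (Fₙ.Mv.0# n) →
      Specialisation {n} A₀ f
    go zero    A₀ A v L e = contradiction e (Fₙ.nontrivial 1≉0 n)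
    go (suc r) A₀ A v L e = record
      { B₀ = S.B₀ ; B = S.B ; minors = S.minors ; zero₀ = S.zero₀ ∘ next.zero₀ ; value = S.value }
      where
      next : Step N {n} A₀ f
      next = step {n = n} A₀ A v (PencilSingularity.singular-pencil F n _ _ (λ k → bar-minors {A = A k} (v k)) e) {N} {f} L
      module next = Step {n = n} next
      module S = Specialisation {n} (specialise N {n} next.A₀′ next.A′ next.minors f next.leading)

-- Fractions as a commutative ring

module FractionIdentities {c ℓ} (E : CommutativeRing c ℓ) where
  open CommutativeRing E hiding (zero)
  open Solver commutativeSemiring using (solve; _:=_; _:+_; _:*_; con)
  open RingProperties ring using (-‿distribˡ-*)
  open SetoidReasoning setoid

  -- The cross-multiplied equality of `F⟨ε⟩`, with numerators and denominators as separate elements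
  -- of an abstract ring, so that the laws of fractions become ring identities.
  _/_≈_/_ : Carrier → Carrier → Carrier → Carrier → Set ℓ
  x / y ≈ z / w = x * w ≈ z * y

  -- Chaining the two equalities leaves the middle denominator w as a common factor, hence the
  -- cancellation hypothesis; in 𝔽[ε] it comes from `⊠-nonzero`.
  trans-/ : ∀ {x y z w u v} → (∀ {a b} → w * a ≈ w * b → a ≈ b) →
    x / y ≈ z / w → z / w ≈ u / v → x / y ≈ u / v
  trans-/ {x} {y} {z} {w} {u} {v} cancel e f = cancel (begin
    w * (x * v) ≈⟨ solve 3 (λ w x v → w :* (x :* v) := (x :* w) :* v) refl w x v ⟩
    x * w * v   ≈⟨ *-congʳ e ⟩
    z * y * v   ≈⟨ solve 3 (λ z y v → z :* y :* v := (z :* v) :* y) refl z y v ⟩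
    z * v * y   ≈⟨ *-congʳ f ⟩
    u * w * y   ≈⟨ solve 3 (λ u w y → u :* w :* y := w :* (u :* y)) refl u w y ⟩
    w * (u * y) ∎)

  +-cong-/ : ∀ x y x′ y′ z w z′ w′ → x / y ≈ x′ / y′ → z / w ≈ z′ / w′ →
    (x * w + z * y) / (y * w) ≈ (x′ * w′ + z′ * y′) / (y′ * w′)
  +-cong-/ x y x′ y′ z w z′ w′ e f = begin
    (x * w + z * y) * (y′ * w′)
      ≈⟨ solve 6 (λ x w z y y′ w′ → (x :* w :+ z :* y) :* (y′ :* w′) :=
           (x :* y′) :* (w :* w′) :+ (z :* w′) :* (y :* y′)) refl x w z y y′ w′ ⟩
    (x * y′) * (w * w′) + (z * w′) * (y * y′)
      ≈⟨ +-cong (*-congʳ e) (*-congʳ f) ⟩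
    (x′ * y) * (w * w′) + (z′ * w) * (y * y′)
      ≈⟨ solve 6 (λ x′ w z′ y y′ w′ → (x′ :* y) :* (w :* w′) :+ (z′ :* w) :* (y :* y′) :=
           (x′ :* w′ :+ z′ :* y′) :* (y :* w)) refl x′ w z′ y y′ w′ ⟩
    (x′ * w′ + z′ * y′) * (y * w) ∎

  *-cong-/ : ∀ x y x′ y′ z w z′ w′ → x / y ≈ x′ / y′ → z / w ≈ z′ / w′ →
    (x * z) / (y * w) ≈ (x′ * z′) / (y′ * w′)
  *-cong-/ x y x′ y′ z w z′ w′ e f = begin
    x * z * (y′ * w′)   ≈⟨ interchange x z y′ w′ ⟩
    x * y′ * (z * w′)   ≈⟨ *-cong e f ⟩
    x′ * y * (z′ * w)   ≈⟨ interchange x′ y z′ w ⟩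
    x′ * z′ * (y * w)   ∎
    where open CommutativeSemigroupProperties *-commutativeSemigroup using (interchange)

  neg-cong-/ : ∀ x y x′ y′ → x / y ≈ x′ / y′ → (- x) / y ≈ (- x′) / y′
  neg-cong-/ x y x′ y′ e = trans (sym (-‿distribˡ-* x y′)) (trans (-‿cong e) (-‿distribˡ-* x′ y))

  +-assoc-/ : ∀ x y z w u v →
    ((x * w + z * y) * v + u * (y * w)) / ((y * w) * v) ≈ (x * (w * v) + (z * v + u * w) * y) / (y * (w * v))
  +-assoc-/ x y z w u v = solve 6 (λ x y z w u v →
    ((x :* w :+ z :* y) :* v :+ u :* (y :* w)) :* (y :* (w :* v)) :=
    (x :* (w :* v) :+ (z :* v :+ u :* w) :* y) :* ((y :* w) :* v)) refl x y z w u v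

  +-comm-/ : ∀ x y z w → (x * w + z * y) / (y * w) ≈ (z * y + x * w) / (w * y)
  +-comm-/ x y z w = *-cong (+-comm _ _) (*-comm _ _)

  +-identityˡ-/ : ∀ x y → (0# * y + x * 1#) / (1# * y) ≈ x / y
  +-identityˡ-/ = solve 2 (λ x y → (con 0 :* y :+ x :* con 1) :* y := x :* (con 1 :* y)) refl

  -‿inverseˡ-/ : ∀ x y → (- x * y + x * y) / (y * y) ≈ 0# / 1#
  -‿inverseˡ-/ x y = trans (*-identityʳ _) (trans (sym (distribʳ y (- x) x))
    (trans (*-congʳ (-‿inverseˡ x)) (trans (zeroˡ y) (sym (zeroˡ _)))))

  +-identityʳ-/ : ∀ x y → (x * 1# + 0# * y) / (y * 1#) ≈ x / y
  +-identityʳ-/ = solve 2 (λ x y → (x :* con 1 :+ con 0 :* y) :* y := x :* (y :* con 1)) refl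

  -‿inverseʳ-/ : ∀ x y → (x * y + - x * y) / (y * y) ≈ 0# / 1#
  -‿inverseʳ-/ x y = trans (*-congʳ (+-comm _ _)) (-‿inverseˡ-/ x y)

  *-assoc-/ : ∀ x y z w u v → ((x * z) * u) / ((y * w) * v) ≈ (x * (z * u)) / (y * (w * v))
  *-assoc-/ x y z w u v = *-cong (*-assoc _ _ _) (sym (*-assoc _ _ _))

  *-comm-/ : ∀ x y z w → (x * z) / (y * w) ≈ (z * x) / (w * y)
  *-comm-/ x y z w = *-cong (*-comm _ _) (*-comm _ _)

  *-identityˡ-/ : ∀ x y → (1# * x) / (1# * y) ≈ x / y
  *-identityˡ-/ = solve 2 (λ x y → (con 1 :* x) :* y := x :* (con 1 :* y)) refl

  *-identityʳ-/ : ∀ x y → (x * 1#) / (y * 1#) ≈ x / y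
  *-identityʳ-/ = solve 2 (λ x y → (x :* con 1) :* y := x :* (y :* con 1)) refl

  distribˡ-/ : ∀ x y z w u v →
    (x * (z * v + u * w)) / (y * (w * v)) ≈ ((x * z) * (y * v) + (x * u) * (y * w)) / ((y * w) * (y * v))
  distribˡ-/ = solve 6 (λ x y z w u v →
    (x :* (z :* v :+ u :* w)) :* ((y :* w) :* (y :* v)) :=
    ((x :* z) :* (y :* v) :+ (x :* u) :* (y :* w)) :* (y :* (w :* v))) refl

  distribʳ-/ : ∀ x y z w u v →
    ((z * v + u * w) * x) / ((w * v) * y) ≈ ((z * x) * (v * y) + (u * x) * (w * y)) / ((w * y) * (v * y))
  distribʳ-/ = solve 6 (λ x y z w u v →
    ((z :* v :+ u :* w) :* x) :* ((w :* y) :* (v :* y)) :=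
    ((z :* x) :* (v :* y) :+ (u :* x) :* (w :* y)) :* ((w :* v) :* y)) refl

  ι-+ : ∀ x y → (x + y) / 1# ≈ (x * 1# + y * 1#) / (1# * 1#)
  ι-+ = solve 2 (λ x y → (x :+ y) :* (con 1 :* con 1) := (x :* con 1 :+ y :* con 1) :* con 1) refl

  ι-* : ∀ x y → (x * y) / 1# ≈ (x * y) / (1# * 1#)
  ι-* = solve 2 (λ x y → (x :* y) :* (con 1 :* con 1) := (x :* y) :* con 1) refl

  ι-/ : ∀ g h x y → g / 1# ≈ (x * y) / (1# * h) → g * h ≈ x * y
  ι-/ g h x y e = trans (*-congˡ (sym (*-identityˡ h))) (trans e (*-identityʳ _))

  cancel-zero : ∀ d → (∀ x → d * x ≈ 0# → x ≈ 0#) → ∀ {x y} → d * x ≈ d * y → x ≈ y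
  cancel-zero d regular {x} {y} e = x-y≈0⇒x≈y (regular (x - y) (begin
    d * (x - y)        ≈⟨ distribˡ d x (- y) ⟩
    d * x + d * - y    ≈⟨ +-congʳ e ⟩
    d * y + d * - y    ≈⟨ distribˡ d y (- y) ⟨
    d * (y - y)        ≈⟨ *-congˡ (-‿inverseʳ y) ⟩
    d * 0#             ≈⟨ zeroʳ d ⟩
    0#                 ∎))
    where
    x-y≈0⇒x≈y : ∀ {x y} → x - y ≈ 0# → x ≈ y
    x-y≈0⇒x≈y {x} {y} e = begin
      x              ≈⟨ +-identityʳ x ⟨
      x + 0#         ≈⟨ +-congˡ (-‿inverseˡ y) ⟨
      x + (- y + y)  ≈⟨ +-assoc x (- y) y ⟨
      x - y + y      ≈⟨ +-congʳ e ⟩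
      0# + y         ≈⟨ +-identityˡ y ⟩
      y              ∎

  ι-den : ∀ x y → x / 1# ≈ (y * x) / (1# * y)
  ι-den = solve 2 (λ x y → x :* (con 1 :* y) := (y :* x) :* con 1) refl

module FractionField {c ℓ} (F : Field c ℓ) where
  open Field F hiding (zero)
  open RationalFunctions F

  E = PolynomialRing.commutativeRing commutativeRing
  module E = CommutativeRing E
  module K = RawRing F⟨ε⟩
  open FractionIdentities E

  cancelᴱ : ∀ d → ¬ (d E.≈ E.0#) → ∀ {p q} → d E.* p E.≈ d E.* q → p E.≈ q
  cancelᴱ d d≉0 {p} {q} = cancel-zero d (λ x dx≈0 → decidable-stable (x ≟0) λ x≉0 → ⊠-nonzero d x d≉0 x≉0 dx≈0) {p} {q}

  fractionRing : CommutativeRing (c ⊔ ℓ) ℓ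
  fractionRing = record
    { RawRing F⟨ε⟩
    ; isCommutativeRing = record
      { isRing = record
        { +-isAbelianGroup = record
          { isGroup = record
            { isMonoid = record
              { isSemigroup = record
                { isMagma = record
                  { isEquivalence = record
                    { refl  = λ {x} → E.refl {num x E.* den x}
                    ; sym   = λ {x} {y} e → E.sym {num x E.* den y} {num y E.* den x} e
                    ; trans = λ {x} {y} {z} e f → trans-/ {num x} {den x} {num y} {den y} {num z} {den z}
                        (λ {p} {q} → cancelᴱ (den y) (den≉0 y) {p} {q}) e f
                    }
                  ; ∙-cong = λ {x} {x′} {y} {y′} e f →
                      +-cong-/ (num x) (den x) (num x′) (den x′) (num y) (den y) (num y′) (den y′) e f
                  }
                ; assoc = λ x y z → +-assoc-/ (num x) (den x) (num y) (den y) (num z) (den z)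
                }
              ; identity = (λ x → +-identityˡ-/ (num x) (den x)) , λ x → +-identityʳ-/ (num x) (den x)
              }
            ; inverse = (λ x → -‿inverseˡ-/ (num x) (den x)) , λ x → -‿inverseʳ-/ (num x) (den x)
            ; ⁻¹-cong = λ {x} {y} e → neg-cong-/ (num x) (den x) (num y) (den y) e
            }
          ; comm = λ x y → +-comm-/ (num x) (den x) (num y) (den y)
          }
        ; *-cong = λ {x} {x′} {y} {y′} e f →
            *-cong-/ (num x) (den x) (num x′) (den x′) (num y) (den y) (num y′) (den y′) e f
        ; *-assoc = λ x y z → *-assoc-/ (num x) (den x) (num y) (den y) (num z) (den z)
        ; *-identity = (λ x → *-identityˡ-/ (num x) (den x)) , λ x → *-identityʳ-/ (num x) (den x)
        ; distrib = (λ x y z → distribˡ-/ (num x) (den x) (num y) (den y) (num z) (den z))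
                  , λ x y z → distribʳ-/ (num x) (den x) (num y) (den y) (num z) (den z)
        }
      ; *-comm = λ x y → *-comm-/ (num x) (den x) (num y) (den y)
      }
    }

  1≉0ᴱ : ¬ (E.1# E.≈ E.0#)
  1≉0ᴱ e = 1≉0 (e 0)

  ι : E.Carrier → K.Carrier
  ι p = fraction p E.1# 1≉0ᴱ

  ι-hom : IsHomomorphism E fractionRing ι
  ι-hom = isHomomorphism E fractionRing ι
    (λ {p} {q} e → E.*-congʳ {E.1#} {p} {q} e) ι-+ ι-*
    (E.refl {E.0# E.* E.1#}) (E.refl {E.1# E.* E.1#}) (λ p → E.refl {(E.- p) E.* E.1#})

  ι-injective : ∀ {p q} → ι p K.≈ ι q → p E.≈ q
  ι-injective {p} {q} e k = trans (sym (E.*-identityʳ p k)) (trans (e k) (E.*-identityʳ q k))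

-- Clearing denominators

module CommonDenominator {c₁ ℓ₁ c₂ ℓ₂} (E : CommutativeRing c₁ ℓ₁) (K : CommutativeRing c₂ ℓ₂)
  {ι : CommutativeRing.Carrier E → CommutativeRing.Carrier K} (ι-hom : IsHomomorphism E K ι) where
  private
    module E = CommutativeRing E
    module K = CommutativeRing K
    module ι = Homomorphism E K ι-hom
    module Eₙ = MvRing E
    module Kₙ = MvRing K
  open MvPolynomial using (const; coefficient)
  open DeterminantFormulas E using (product) renaming (MinorsVanish to MinorsVanishᴱ)
  open DeterminantFormulas K using () renaming (MinorsVanish to MinorsVanishᴷ)
  open SetoidReasoning K.setoid

  Cleared : E.Carrier → E.Carrier → K.Carrier → Set ℓ₂
  Cleared d p x = ι p K.≈ ι d K.* x

  cleared-multiple : ∀ e {d p x} d′ → d′ E.≈ e E.* d → Cleared d p x → Cleared d′ (e E.* p) x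
  cleared-multiple e {d} {p} {x} d′ d′≈ h = begin
    ι (e E.* p)             ≈⟨ ι.*-homo e p ⟩
    ι e K.* ι p             ≈⟨ K.*-congˡ h ⟩
    ι e K.* (ι d K.* x)     ≈⟨ K.*-assoc _ _ _ ⟨
    ι e K.* ι d K.* x       ≈⟨ K.*-congʳ (K.trans (ι.⟦⟧-cong d′≈) (ι.*-homo e d)) ⟨
    ι d′ K.* x              ∎

  cleared-minors : (∀ {p q} → ι p K.≈ ι q → p E.≈ q) →
    ∀ {m n d} {B : Matrix E.Carrier m n} {A : Matrix K.Carrier m n} →
    (∀ i j → Cleared d (B i j) (A i j)) → MinorsVanishᴷ A → MinorsVanishᴱ B
  cleared-minors ι-injective {d = d} {B} {A} h v i j k l = ι-injective (begin
    ι (B i j E.* B k l)                        ≈⟨ expand j l ⟩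
    (ι d K.* ι d) K.* (A i j K.* A k l)        ≈⟨ K.*-congˡ (v i j k l) ⟩
    (ι d K.* ι d) K.* (A i l K.* A k j)        ≈⟨ expand l j ⟨
    ι (B i l E.* B k j)                        ∎)
    where
    open CommutativeSemigroupProperties K.*-commutativeSemigroup using (interchange)
    expand : ∀ j l → ι (B i j E.* B k l) K.≈ (ι d K.* ι d) K.* (A i j K.* A k l)
    expand j l = K.trans (ι.*-homo _ _) (K.trans (K.*-cong (h i j) (h k l)) (interchange _ _ _ _))

  -- A single denominator d for all the matrices multiplies each of the r rows of the pencil by d,
  -- hence the determinant by d^r.
  cleared-det : ∀ n {r d} {B₀ : Matrix E.Carrier r r} {B : Vector (Matrix E.Carrier r r) n}
    {A₀ : Matrix K.Carrier r r} {A : Vector (Matrix K.Carrier r r) n} →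
    (∀ i j → Cleared d (B₀ i j) (A₀ i j)) → (∀ k i j → Cleared d (B k i j) (A k i j)) → ∀ α →
    Cleared (product {r} λ _ → d)
      (coefficient E.rawRing n (det (E.rawRing [x₁⋯x n ]) (affinePencil E.rawRing B₀ B)) α)
      (coefficient K.rawRing n (det (K.rawRing [x₁⋯x n ]) (affinePencil K.rawRing A₀ A)) α)
  cleared-det n {r} {d} {B₀} {B} {A₀} {A} h₀ h α = begin
    ι (coefficient E.rawRing n detB α)
      ≈⟨ coefficient-mvMap E K ι ι-hom n detB α ⟨
    coefficient K.rawRing n (mvMap E K ι n detB) α
      ≈⟨ Kₙ.coefficient-cong n (Mv.trans (det-pencil-homomorphism E K ι-hom n B₀ B)
           (Mv.trans (Determinant.det-cong (Kₙ.mvRing n) λ i j →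
             PencilProperties.affine-cong K n (h₀ i j) (λ k → h k i j))
             (PencilScaling.det-scalePencil K n (λ _ → ι d) A₀ A))) α ⟩
    coefficient K.rawRing n (const K.rawRing n (productᴷ (λ (_ : Fin r) → ι d)) Mv.* detA) α
      ≈⟨ Kₙ.coefficient-scale n (productᴷ (λ (_ : Fin r) → ι d)) detA α ⟩
    productᴷ (λ (_ : Fin r) → ι d) K.* coefficient K.rawRing n detA α
      ≈⟨ K.*-congʳ (product-homomorphism E K ι-hom (λ (_ : Fin r) → d)) ⟨
    ι (product {r} λ _ → d) K.* coefficient K.rawRing n detA α ∎
    where
    module Mv = CommutativeRing (Kₙ.mvRing n)
    open DeterminantFormulas K using () renaming (product to productᴷ)
    detB = det (E.rawRing [x₁⋯x n ]) (affinePencil E.rawRing B₀ B)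
    detA = det (K.rawRing [x₁⋯x n ]) (affinePencil K.rawRing A₀ A)

  cleared-zero : (∀ {p q} → ι p K.≈ ι q → p E.≈ q) → ∀ {d p x} → Cleared d p x → x K.≈ K.0# → p E.≈ E.0#
  cleared-zero ι-injective h x≈0 = ι-injective (K.trans h
    (K.trans (K.*-congˡ x≈0) (K.trans (K.zeroʳ _) (K.sym ι.0#-homo))))

-- Limits as orders of vanishing

module Limits {c ℓ} (F : Field c ℓ) where
  open Field F hiding (zero)
  open RationalFunctions F
  open Polynomial rawRing using (_⊠_)
  open PolynomialRing commutativeRing using (_≈ₚ_; shift; shift-⊠; ⊠-shift; ⊠-congˡ; coeff-⊠-zero)
  open FractionField F using (E; module E; module K; fractionRing; ι-hom; ι-injective; 1≉0ᴱ)
  open CommonDenominator E fractionRing ι-hom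
  open DeterminantFormulas E using (product) renaming (MinorsVanish to MinorsVanishᴱ)
  open DeterminantFormulas fractionRing using () renaming (MinorsVanish to MinorsVanishᴷ)
  open Descent F using (Leading; detᴱ; κ)
  open MvPolynomial using (MvPoly; coefficient)
  open L using ([]; _∷_)

  -- p = a εᴺ + O(εᴺ⁺¹)
  record Order (N : ℕ) (a : Carrier) (p : E.Carrier) : Set ℓ where
    constructor order
    field
      below : ∀ k → k ℕ.< N → coeff p k ≈ 0#
      at    : coeff p N ≈ a

  order-cong : ∀ {N a b p q} → a ≈ b → p ≈ₚ q → Order N a p → Order N b q
  order-cong a≈b e (order below at) = order (λ k k<N → trans (sym (e k)) (below k k<N)) (trans (sym (e _)) (trans at a≈b))

  order-shift : ∀ {N a} p → Order N a p → Order (suc N) a (shift p)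
  order-shift p (order below at) = order (λ { zero _ → refl ; (suc k) (s≤s k<N) → below k k<N }) at

  order-drop : ∀ {N a} p → Order (suc N) a p → Order N a (L.drop 1 p) × (p ≈ₚ shift (L.drop 1 p))
  order-drop []      (order below at) = order (λ _ _ → refl) at , λ { zero → refl ; (suc k) → refl }
  order-drop (b ∷ p) (order below at) = order (λ k k<N → below (suc k) (s≤s k<N)) at
    , λ { zero → below 0 (s≤s z≤n) ; (suc k) → refl }

  -- Factors ε are stripped from either polynomial until both prescribed coefficients are constant
  -- terms.
  order-⊠ : ∀ M {N a b} p q → Order M a p → Order N b q → Order (M ℕ.+ N) (a * b) (p ⊠ q)
  order-⊠ zero {zero} p q (order _ p₀) (order _ q₀) =
    order (λ _ ()) (trans (coeff-⊠-zero p q) (*-cong p₀ q₀))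
  order-⊠ zero {suc N} p q P Q = let (Q′ , e) = order-drop q Q in
    order-cong refl (λ k → sym (trans (⊠-congˡ p e k) (⊠-shift p (L.drop 1 q) k)))
      (order-shift (p ⊠ L.drop 1 q) (order-⊠ zero p (L.drop 1 q) P Q′))
  order-⊠ (suc M) p q P Q = let (P′ , e) = order-drop p P in
    order-cong refl (λ k → sym (trans (E.*-congʳ {q} {p} {shift (L.drop 1 p)} e k) (shift-⊠ (L.drop 1 p) q k)))
      (order-shift (L.drop 1 p ⊠ q) (order-⊠ M (L.drop 1 p) q P′ Q))

  order-product : ∀ r {e d} → Order e 1# d → ∃ λ N → Order N 1# (product {r} λ _ → d)
  order-product zero        D = 0 , order (λ _ ()) refl
  order-product (suc r) {e} {d} D = let (N , P) = order-product r D in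
    e ℕ.+ N , order-cong (*-identityˡ 1#) (λ k → refl) (order-⊠ e d (product {r} λ _ → d) D P)

  -- As long as g vanishes below k, the coefficient of g h at k + m is b times that of g at k;
  -- comparing with D q determines g up to exponent N. Since a may be 0, vanishing limits need no
  -- separate treatment.
  order-quotient : ∀ {N m b a} (g h D q : E.Carrier) → (b≉0 : ¬ (b ≈ 0#)) →
    g ⊠ h ≈ₚ D ⊠ q → Order N 1# D → Order m b h → Order m a q → Order N (a * (b ⁻¹[ b≉0 ])) g
  order-quotient {N} {m} {b} {a} g h D q b≉0 e P H Q =
    order-cong leading-coeff (λ k → refl) (vanish N ℕ.≤-refl)
    where
    Dq : Order (N ℕ.+ m) (1# * a) (D ⊠ q)
    Dq = order-⊠ N D q P Q
    vanish : ∀ k → k ℕ.≤ N → Order k (coeff g k) g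
    vanish zero    _   = order (λ _ ()) refl
    vanish (suc k) k<N = order below refl
      where
      ih = vanish k (ℕ.<⇒≤ k<N)
      next≈0 : coeff g k ≈ 0#
      next≈0 = xy≈0⇒y≈0 b≉0 (trans (*-comm b _) (trans (sym (Order.at (order-⊠ k g h ih H)))
        (trans (e (k ℕ.+ m)) (Order.below Dq (k ℕ.+ m) (ℕ.+-monoˡ-< m k<N)))))
      below : ∀ i → i ℕ.< suc k → coeff g i ≈ 0#
      below i (s≤s i≤k) with ℕ.m≤n⇒m<n∨m≡n i≤k
      ... | inj₁ i<k    = Order.below ih i i<k
      ... | inj₂ ≡.refl = next≈0
    b⁻¹ = b ⁻¹[ b≉0 ]
    leading-coeff : coeff g N ≈ a * b⁻¹
    leading-coeff = begin
      coeff g N                            ≈⟨ *-identityʳ _ ⟨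
      coeff g N * 1#                       ≈⟨ *-congˡ (proj₂ (inverse b b≉0)) ⟨
      coeff g N * (b * b⁻¹)      ≈⟨ *-assoc _ _ _ ⟨
      coeff g N * b * b⁻¹        ≈⟨ *-congʳ (trans (sym (Order.at (order-⊠ N g h (vanish N ℕ.≤-refl) H)))
                                                (trans (e (N ℕ.+ m)) (trans (Order.at Dq) (*-identityˡ a)))) ⟩
      a * b⁻¹                    ∎
      where open SetoidReasoning setoid

  order-mindeg : ∀ p p≉0 → Order (mindeg p p≉0) (coeff p (mindeg p p≉0)) p
  order-mindeg p p≉0 = order (below p p≉0) refl
    where
    below : ∀ p p≉0 k → k ℕ.< mindeg p p≉0 → coeff p k ≈ 0#
    below []      p≉0 k       _ = refl
    below (a ∷ p) p≉0 k       k< with a ≟ 0#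
    below (a ∷ p) p≉0 zero    k<       | yes a≈0 = a≈0
    below (a ∷ p) p≉0 (suc k) (s≤s k<) | yes a≈0 = below p _ k k<

  -- Nonnegative valuation says that the numerator has no term below m, the least degree of the
  -- denominator. The limit is then a quotient of coefficients at m, and no degrees have to be
  -- subtracted.
  limit-order : ∀ x → LimitExists x → let m = mindeg (den x) (den≉0 x) in Order m (coeff (num x) m) (num x)
  limit-order (fraction g h h≉0) exists with g ≟0
  ... | yes g≈0 = order (λ k _ → g≈0 k) refl
  ... | no  g≉0 = order (λ k k<m → Order.below (order-mindeg g g≉0) k (ℕ.<-≤-trans k<m m≤)) refl
    where
    m≤ : mindeg h h≉0 ℕ.≤ mindeg g g≉0
    m≤ = ℤ.drop‿+≤+ (ℤ.0≤i-j⇒j≤i (≡.subst (ℤ.0ℤ ℤ.≤_) (≡.sym (ℤ.m-n≡m⊖n (mindeg g g≉0) (mindeg h h≉0)))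
      (Supremum.[≤]-injective ℤ._≤_ exists)))

  -- The product of the single denominators serves for all, since P is closed under multiples. It is
  -- nested three times: over matrices, rows and columns.
  common : ∀ {a m} (P : Fin m → E.Carrier → Set a) →
    (∀ i {d} e d′ → d′ E.≈ e E.* d → P i d → P i d′) →
    (∀ i → ∃ λ d → ¬ (d E.≈ E.0#) × P i d) → ∃ λ d → ¬ (d E.≈ E.0#) × ∀ i → P i d
  common {m = zero}  P closed h = E.1# , 1≉0ᴱ , λ ()
  common {m = suc m} P closed h =
    let (d₀ , d₀≉0 , p₀) = h zero
        (d , d≉0 , p) = common (λ i → P (suc i)) (λ i → closed (suc i)) (λ i → h (suc i))
    in d₀ E.* d , ⊠-nonzero d₀ d d₀≉0 d≉0 , λ
      { zero    → closed zero d (d₀ E.* d) (E.*-comm d₀ d) p₀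
      ; (suc i) → closed (suc i) d₀ (d₀ E.* d) (E.refl {d₀ E.* d}) (p i)
      }

  Clearable : E.Carrier → Fraction → Set (c ⊔ ℓ)
  Clearable d x = ∃ λ p → Lift c (Cleared d p x)

  common-denominator : ∀ {m r s} (X : Vector (Matrix Fraction r s) m) →
    ∃ λ d → ¬ (d E.≈ E.0#) × ∀ k i j → Clearable d (X k i j)
  common-denominator X = common (λ k d → ∀ i j → Clearable d (X k i j))
    (λ k e d′ d′≈ h i j → multiple {x = X k i j} e d′ d′≈ (h i j)) λ k →
    common (λ i d → ∀ j → Clearable d (X k i j))
      (λ i e d′ d′≈ h j → multiple {x = X k i j} e d′ d′≈ (h j)) λ i →
    common (λ j d → Clearable d (X k i j)) (λ j e d′ d′≈ h → multiple {x = X k i j} e d′ d′≈ h) λ j →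
    den (X k i j) , den≉0 (X k i j) , num (X k i j) , lift (own (X k i j))
    where
    multiple : ∀ {d x} e d′ → d′ E.≈ e E.* d → Clearable d x → Clearable d′ x
    multiple {d} {x} e d′ d′≈ (p , lift h) = e E.* p , lift (cleared-multiple e {d} {p} {x} d′ d′≈ h)
    own : ∀ x → Cleared (den x) (num x) x
    own x = FractionIdentities.ι-den E (num x) (den x)

  record Clearing {n r} (A₀ : Matrix Fraction r r) (f : MvPoly rawRing n) : Set (c ⊔ ℓ) where
    field
      N       : ℕ
      B₀      : Matrix E.Carrier r r
      B       : Vector (Matrix E.Carrier r r) n
      minors  : ∀ k → MinorsVanishᴱ (B k)
      zero₀   : (∀ i j → A₀ i j K.≈ K.0#) → ∀ i j → B₀ i j E.≈ E.0#
      leading : Leading N {n} f (detᴱ n B₀ B)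

  clear : ∀ n {r} (A₀ : Matrix Fraction r r) (A : Vector (Matrix Fraction r r) n) →
    (∀ k → MinorsVanishᴷ (A k)) → (f : MvPoly rawRing n) →
    IsLimit n (det (F⟨ε⟩ [x₁⋯x n ]) (affinePencil F⟨ε⟩ A₀ A)) f →
    (∃ λ d → ¬ (d E.≈ E.0#) × ∀ k i j → Clearable d ((A₀ Vec.∷ A) k i j)) → Clearing {n} A₀ f
  clear n {r} A₀ A v f lim (d₁ , d₁≉0 , clearable) = record
    { N = N ; B₀ = B₀ ; B = B
    ; minors = λ k → cleared-minors (λ {p} {q} → ι-injective {p} {q}) {d = d} {B k} {A k} (λ i j → cleared (suc k) i j) (v k)
    ; zero₀ = λ e i j → cleared-zero (λ {p} {q} → ι-injective {p} {q}) {d} {B₀ i j} {A₀ i j} (cleared zero i j) (e i j)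
    ; leading = record
      { below = λ α → Order.below (coefficient-order α)
      ; at    = λ α → trans (Order.at (coefficient-order α)) (sym (value α))
      }
    }
    where
    open IsLimit lim
    X : Vector (Matrix Fraction r r) (suc n)
    X = A₀ Vec.∷ A
    e = mindeg d₁ d₁≉0
    lead = coeff d₁ e
    lead≉0 = coeff-mindeg d₁ d₁≉0
    -- Normalises the denominator to leading coefficient 1, so that d^r starts with ε^N and the
    -- cleared determinant leads with f itself instead of a multiple of it.
    u = lead ⁻¹[ lead≉0 ]
    d : E.Carrier
    d = κ u E.* d₁
    d-order : Order e 1# d
    d-order = order-cong (trans (*-comm u lead) (proj₂ (inverse lead lead≉0))) (λ k → refl)
      (order-⊠ 0 (κ u) d₁ (order (λ _ ()) refl) (order-mindeg d₁ d₁≉0))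
    N = proj₁ (order-product r d-order)
    Bᵏ : Vector (Matrix E.Carrier r r) (suc n)
    Bᵏ k i j = κ u E.* proj₁ (clearable k i j)
    cleared : ∀ k i j → Cleared d (Bᵏ k i j) (X k i j)
    cleared k i j = cleared-multiple (κ u) {d₁} {proj₁ (clearable k i j)} {X k i j} d (E.refl {d})
      (Lift.lower (proj₂ (clearable k i j)))
    B₀ = Bᵏ zero
    B = tail Bᵏ
    -- N is the same for every α, because every coefficient is cleared by the same D = d^r.
    coefficient-order : ∀ α → let x = coefficient F⟨ε⟩ n (det (F⟨ε⟩ [x₁⋯x n ]) (affinePencil F⟨ε⟩ A₀ A)) α in
      Order N (limit x) (coefficient E.rawRing n (detᴱ n B₀ B) α)
    coefficient-order α = order-quotient g (den x) D (num x) (coeff-mindeg (den x) (den≉0 x))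
      (FractionIdentities.ι-/ E g (den x) D (num x) (cleared-det n {r} {d} {B₀} {B} {A₀} {A} (cleared zero) (λ k → cleared (suc k)) α))
      (proj₂ (order-product r d-order))
      (order-mindeg (den x) (den≉0 x)) (limit-order x (defined α))
      where
      x = coefficient F⟨ε⟩ n (det (F⟨ε⟩ [x₁⋯x n ]) (affinePencil F⟨ε⟩ A₀ A)) α
      g = coefficient E.rawRing n (detᴱ n B₀ B) α
      D = product {r} λ _ → d

-- Rank one and vanishing minors

module RankOne {c ℓ} (R : CommutativeRing c ℓ) where
  open CommutativeRing R hiding (zero)
  open DeterminantFormulas R using (MinorsVanish)

  -- Every column is a multiple of the single basis vector, so A is an outer product.
  rank-one⇒minors : ∀ {m n} {A : Matrix Carrier m n} → HasRank rawRing A 1 → MinorsVanish A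
  rank-one⇒minors {A = A} (b , _ , _ , columns) i j k l = begin
    A i j * A k l                         ≈⟨ *-cong (entry i j) (entry k l) ⟩
    (a j * b zero i) * (a l * b zero k)   ≈⟨ solve 4 (λ p x q y → (p :* x) :* (q :* y) := (q :* x) :* (p :* y))
                                               refl (a j) (b zero i) (a l) (b zero k) ⟩
    (a l * b zero i) * (a j * b zero k)   ≈⟨ *-cong (entry i l) (entry k j) ⟨
    A i l * A k j                         ∎
    where
    open SetoidReasoning setoid
    open Solver commutativeSemiring using (solve; _:=_; _:*_)
    a = λ j → proj₁ (columns j) zero
    entry : ∀ i j → A i j ≈ a j * b zero i
    entry i j = trans (proj₂ (columns j) i) (+-identityʳ _)

  rank-one⇒rows : ¬ (1# ≈ 0#) → ∀ {n} {A : Matrix Carrier 0 n} → ¬ HasRank rawRing A 1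
  rank-one⇒rows 1≉0 (b , independent , _) = 1≉0 (independent (λ _ → 1#) (λ ()) zero)

module RankAtMostOne {c ℓ} (F : Field c ℓ) where
  open Field F hiding (zero)
  open Determinant commutativeRing using (δ; sum-δˡ)
  open DeterminantFormulas commutativeRing using (MinorsVanish)
  open SingularPencils F using (pivot?)
  open SetoidReasoning setoid

  -- The column through the nonzero entry is a basis of the column space; the vanishing minors
  -- through that entry give the multiples.
  minors⇒rank-one : ∀ {m n} {A : Matrix Carrier m n} → MinorsVanish A → ∀ k l → ¬ (A k l ≈ 0#) →
    HasRank rawRing A 1
  minors⇒rank-one {A = A} v k l A≉0 = column , independent , column∈ , spans
    where
    column = λ _ i → A i l
    i = proj₁ (inverse (A k l) A≉0)
    independent : ∀ a → (∀ i → a zero * A i l + 0# ≈ 0#) → ∀ j → a j ≈ 0#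
    independent a e zero = xy≈0⇒y≈0 A≉0 (trans (*-comm _ _) (trans (sym (+-identityʳ _)) (e k)))
    column∈ = λ _ → δ l , λ i → sym (sum-δˡ (A i) l)
    spans = λ j → (λ _ → A k j * i) , λ p → sym (begin
      A k j * i * A p l + 0#   ≈⟨ +-identityʳ _ ⟩
      A k j * i * A p l        ≈⟨ trans (*-assoc _ _ _) (*-comm _ _) ⟩
      i * A p l * A k j        ≈⟨ *-assoc _ _ _ ⟩
      i * (A p l * A k j)      ≈⟨ *-congˡ (v p l k j) ⟩
      i * (A p j * A k l)      ≈⟨ *-comm _ _ ⟩
      A p j * A k l * i        ≈⟨ *-assoc _ _ _ ⟩
      A p j * (A k l * i)      ≈⟨ *-congˡ (proj₂ (inverse (A k l) A≉0)) ⟩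
      A p j * 1#               ≈⟨ *-identityʳ _ ⟩
      A p j                    ∎)

  minors⇒rank≤1 : ∀ {m n} {A : Matrix Carrier m n} → MinorsVanish A → HasRankAtMost rawRing A 1
  minors⇒rank≤1 {A = A} v with pivot? A
  ... | inj₁ A≈0           = 0 , z≤n , (λ ()) , (λ _ _ ()) , (λ ()) , λ j → (λ ()) , λ i → A≈0 i j
  ... | inj₂ (k , l , A≉0) = 1 , s≤s z≤n , minors⇒rank-one v k l A≉0

  outer-rank-one : ∀ {m n} (u : Vector Carrier m) (w : Vector Carrier n) k l →
    ¬ (u k ≈ 0#) → ¬ (w l ≈ 0#) → HasRank rawRing (λ i j → u i * w j) 1
  outer-rank-one u w k l u≉0 w≉0 = minors⇒rank-one
    (λ i j k l → solve 4 (λ a b c d → (a :* b) :* (c :* d) := (a :* d) :* (c :* b)) refl (u i) (w j) (u k) (w l))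
    k l (λ uw≈0 → w≉0 (xy≈0⇒y≈0 u≉0 uw≈0))
    where open Solver commutativeSemiring using (solve; _:=_; _:*_)

-- Padding to size n + r

module Padding {c ℓ} (F : Field c ℓ) where
  open Field F hiding (zero)
  open Determinant commutativeRing using (δ; δ-diag; δ-injection)
  open DeterminantFormulas commutativeRing using (MinorsVanish)
  open SingularPencils F using (pivot?; module Pivot)
  open PencilProperties commutativeRing
  open MvRing commutativeRing
  open RankAtMostOne F using (outer-rank-one)

  -- The padded pencil is block upper triangular with an identity block first: its first p columns
  -- are unit vectors, expanded one after the other. The block above B is arbitrary.
  det-padded : ∀ n p {r} {B₀ : Matrix Carrier r r} {B : Vector (Matrix Carrier r r) n}
    {C₀ : Matrix Carrier (p ℕ.+ r) (p ℕ.+ r)} {C : Vector (Matrix Carrier (p ℕ.+ r) (p ℕ.+ r)) n} →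
    (∀ i j → C₀ i (j ↑ˡ r) ≈ δ (j ↑ˡ r) i) → (∀ k i j → C k i (j ↑ˡ r) ≈ 0#) →
    (∀ i j → C₀ (p ↑ʳ i) (p ↑ʳ j) ≈ B₀ i j) → (∀ k i j → C k (p ↑ʳ i) (p ↑ʳ j) ≈ B k i j) →
    Mv._≈_ n (det (rawRing [x₁⋯x n ]) (Pencil n C₀ C)) (det (rawRing [x₁⋯x n ]) (Pencil n B₀ B))
  det-padded n zero    l₀ l e₀ e = Determinant.det-cong (mvRing n) λ i j →
    affine-cong n (e₀ i j) (λ k → e k i j)
  det-padded n (suc p) {r} {C₀ = C₀} {C} l₀ l e₀ e = S.trans
    (DeterminantFormulas.det-leftColumn (mvRing n) (Pencil n C₀ C) left)
    (det-padded n p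
      (λ i j → trans (l₀ (suc i) (suc j)) (δ-injection suc Fin.suc-injective (j ↑ˡ r) i))
      (λ k i j → l k (suc i) (suc j)) e₀ e)
    where
    module S = Mv n
    module Sδ = Determinant (mvRing n)
    module c = Homomorphism commutativeRing (mvRing n) (const-hom n)
    left : ∀ i → Pencil n C₀ C i zero S.≈ Sδ.δ zero i
    left zero    = S.trans (affine-cong n (l₀ zero zero) (λ k → l k zero zero))
      (S.trans (affine-const n 1#) c.1#-homo)
    left (suc i) = S.trans (affine-cong n (l₀ (suc i) zero) (λ k → l k (suc i) zero))
      (S.trans (affine-const n 0#) c.0#-homo)

  -- A factorisation B = u₂ w₂ᵀ.  When B = 0, the vector u₁ keeps the padded matrix nonzero.
  record Factorisation (n : ℕ) {r} (B : Matrix Carrier r r) : Set (c ⊔ ℓ) where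
    field
      u₁       : Vector Carrier n
      u₂ w₂    : Vector Carrier r
      product  : ∀ i j → u₂ i * w₂ j ≈ B i j
      u₁≉0⊎u₂≉0 : (∃ λ i → ¬ (u₁ i ≈ 0#)) ⊎ (∃ λ i → ¬ (u₂ i ≈ 0#))
      w₂≉0     : ∃ λ j → ¬ (w₂ j ≈ 0#)

  -- For B = 0 the padded vectors are (e_k, 0) and (0, e_0), whose outer product lies above the
  -- diagonal blocks; positive size provides e_0.
  factorise : ∀ {n r} → Fin n → {B : Matrix Carrier (suc r) (suc r)} → MinorsVanish B → Factorisation n B
  factorise k {B} v with pivot? B
  ... | inj₁ B≈0 = record
    { u₁ = δ k ; u₂ = λ _ → 0# ; w₂ = δ zero
    ; product = λ i j → trans (zeroˡ _) (sym (B≈0 i j))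
    ; u₁≉0⊎u₂≉0 = inj₁ (k , λ e → 1≉0 (trans (sym (δ-diag k)) e))
    ; w₂≉0 = zero , 1≉0
    }
  ... | inj₂ (p , q , B≉0) = record
    { u₁ = λ _ → 0# ; u₂ = a ; w₂ = b
    ; product = λ i j → sym (outer v i j)
    ; u₁≉0⊎u₂≉0 = inj₂ (p , B≉0)
    ; w₂≉0 = q , λ e → 1≉0 (trans (sym bₗ≈1) (trans (*-congʳ e) (zeroˡ _)))
    }
    where open Pivot B p q B≉0

  record Padded (n : ℕ) {r} (B₀ : Matrix Carrier r r) (B : Vector (Matrix Carrier r r) n) : Set (c ⊔ ℓ) where
    field
      C₀    : Matrix Carrier (n ℕ.+ r) (n ℕ.+ r)
      C     : Vector (Matrix Carrier (n ℕ.+ r) (n ℕ.+ r)) n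
      rank  : ∀ k → HasRank rawRing (C k) 1
      value : Mv._≈_ n (det (rawRing [x₁⋯x n ]) (Pencil n C₀ C)) (det (rawRing [x₁⋯x n ]) (Pencil n B₀ B))

  pad : ∀ n {r} (B₀ : Matrix Carrier r r) (B : Vector (Matrix Carrier r r) n) →
    (∀ k → Factorisation n (B k)) → Padded n B₀ B
  pad n {r} B₀ B factors = record
    { C₀ = λ i j → C₀ᵀ j i ; C = C ; rank = rank
    ; value = det-padded n n
        (λ i j → reflexive (≡.cong (λ v → v i) (VecP.lookup-++ˡ left right j)))
        (λ k i j → trans (*-congˡ (reflexive (VecP.lookup-++ˡ (λ _ → 0#) (w₂ k) j))) (zeroʳ _))
        (λ i j → reflexive (≡.trans (≡.cong (λ v → v (n ↑ʳ i)) (VecP.lookup-++ʳ left right j))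
          (VecP.lookup-++ʳ (λ (_ : Fin n) → 0#) (λ i → B₀ i j) i)))
        (λ k i j → trans (*-cong (reflexive (VecP.lookup-++ʳ (u₁ k) (u₂ k) i)) (reflexive (VecP.lookup-++ʳ (λ (_ : Fin n) → 0#) (w₂ k) j)))
          (product k i j))
    }
    where
    module _ (k : Fin n) where open Factorisation (factors k) public
    left : Vector (Vector Carrier (n ℕ.+ r)) n
    left j = δ (j ↑ˡ r)
    right : Vector (Vector Carrier (n ℕ.+ r)) r
    right j = (λ _ → 0#) Vec.++ (λ i → B₀ i j)
    C₀ᵀ : Vector (Vector Carrier (n ℕ.+ r)) (n ℕ.+ r)
    C₀ᵀ = left Vec.++ right
    u w : Vector (Vector Carrier (n ℕ.+ r)) n
    u k = u₁ k Vec.++ u₂ k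
    -- The zeros keep the first n columns of u wᵀ empty, so u₁ affects only the block above the
    -- diagonal, which `det-padded` leaves free.
    w k = (λ _ → 0#) Vec.++ w₂ k
    C : Vector (Matrix Carrier (n ℕ.+ r) (n ℕ.+ r)) n
    C k i j = u k i * w k j
    u≉0 : ∀ k → ∃ λ i → ¬ (u k i ≈ 0#)
    u≉0 k with u₁≉0⊎u₂≉0 k
    ... | inj₁ (i , ≉0) = i ↑ˡ r , ≉0 ∘ trans (sym (reflexive (VecP.lookup-++ˡ (u₁ k) (u₂ k) i)))
    ... | inj₂ (i , ≉0) = n ↑ʳ i , ≉0 ∘ trans (sym (reflexive (VecP.lookup-++ʳ (u₁ k) (u₂ k) i)))
    rank : ∀ k → HasRank rawRing (C k) 1
    rank k = let (i , uᵢ≉0) = u≉0 k ; (j , wⱼ≉0) = w₂≉0 k in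
      outer-rank-one (u k) (w k) i (n ↑ʳ j) uᵢ≉0
        (wⱼ≉0 ∘ trans (sym (reflexive (VecP.lookup-++ʳ (λ (_ : Fin n) → 0#) (w₂ k) j))))

-- Assembly of the two halves

module LimitsOfPencils {c ℓ} (F : Field c ℓ) where
  open Field F hiding (zero)
  open RationalFunctions F
  open FractionField F using (module E; module K; fractionRing; ι-injective; 1≉0ᴱ)
  open RankOne fractionRing using (rank-one⇒minors; rank-one⇒rows)
  open RankAtMostOne F using (minors⇒rank≤1)
  open MvRing commutativeRing
  open MvPolynomial rawRing using (MvPoly)

  limit-of-pencils : ∀ n r (A₀ : Matrix Fraction r r) (A : Vector (Matrix Fraction r r) n) →
    (∀ i → HasRank F⟨ε⟩ (A i) 1) → (f : MvPoly n) →
    IsLimit n (det (F⟨ε⟩ [x₁⋯x n ]) (affinePencil F⟨ε⟩ A₀ A)) f →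
    (Σ[ B₀ ∈ Matrix Carrier (n ℕ.+ r) (n ℕ.+ r) ] Σ[ B ∈ Vector (Matrix Carrier (n ℕ.+ r) (n ℕ.+ r)) n ]
      Mv._≈_ n f (det (rawRing [x₁⋯x n ]) (affinePencil rawRing B₀ B)) × (∀ i → HasRank rawRing (B i) 1))
    ×
    ((∀ i j → A₀ i j K.≈ K.0#) →
     Σ[ B ∈ Vector (Matrix Carrier r r) n ]
       Mv._≈_ n f (det (rawRing [x₁⋯x n ]) (linearPencil rawRing B)) × (∀ i → HasRankAtMost rawRing (B i) 1))
  limit-of-pencils n r A₀ A ranks f lim =
      -- One specialisation serves both halves: padded here, and for A₀ = 0 unpadded, with its
      -- vanishing constant matrix B₀ dropped.
      (C₀ , C , S.trans value (S.sym padded) , rank)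
    , λ A₀≈0 → B
      , S.trans value (Determinant.det-cong (mvRing n) λ i j → S.trans
          (S.+-congʳ (S.trans (c.⟦⟧-cong (zero₀ A₀≈0 i j)) c.0#-homo)) (S.+-identityˡ _))
      , λ k → minors⇒rank≤1 (minors k)
    where
    open Limits F using (clear; common-denominator; module Clearing)
    module S = Mv n
    module c = Homomorphism commutativeRing (mvRing n) (const-hom n)
    A-minors = λ k → rank-one⇒minors {A = A k} (ranks k)
    module cleared = Clearing (clear n A₀ A A-minors f lim (common-denominator (A₀ Vec.∷ A)))
    module special = Descent.Specialisation
      (Descent.specialise F cleared.N cleared.B₀ cleared.B cleared.minors f cleared.leading)
    open special using (B₀; B; minors; value)
    zero₀ : (∀ i j → A₀ i j K.≈ K.0#) → ∀ i j → B₀ i j ≈ 0#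
    zero₀ A₀≈0 = special.zero₀ (cleared.zero₀ A₀≈0)
    factors : ∀ k → Padding.Factorisation F n (B k)
    factors k = go r (A k) (ranks k) (B k) (minors k)
      where
      go : ∀ r (Aₖ : Matrix Fraction r r) → HasRank F⟨ε⟩ Aₖ 1 → (Bₖ : Matrix Carrier r r) →
        DeterminantFormulas.MinorsVanish commutativeRing Bₖ → Padding.Factorisation F n Bₖ
      -- Size 0 contradicts the rank of A k, so it can occur only for n = 0, when no factorisation
      -- is asked for.
      go zero    Aₖ rk Bₖ v = contradiction rk (rank-one⇒rows (1≉0ᴱ ∘ ι-injective {E.1#} {E.0#}) {A = Aₖ})
      go (suc r) Aₖ rk Bₖ v = Padding.factorise F k v
    open Padding.Padded (Padding.pad F n B₀ B factors) using (C₀; C; rank) renaming (value to padded)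

open import Data.Nat.Base using (_+_)

theorem1 :
    ∀ {c ℓ₁ ℓ₂} (ℝ : RealNumbers c ℓ₁ ℓ₂) (s : ℝ-or-ℂ) →
    let 𝔽 = Field.rawRing (scalars ℝ s)
        𝕂 = RationalFunctions.F⟨ε⟩ (scalars ℝ s)
        open RationalFunctions (scalars ℝ s) using (IsLimit)
        open RawRing using (Carrier)
    in
    ∀ (n r : ℕ)
      (A₀ : Matrix (Carrier 𝕂) r r) (A : Vector (Matrix (Carrier 𝕂) r r) n) →
      (∀ i → HasRank 𝕂 (A i) 1) →
    let 𝔽[x] = 𝔽 [x₁⋯x n ]
        𝕂[x] = 𝕂 [x₁⋯x n ]
        _≈_ = RawRing._≈_ 𝔽[x]
    in
    (f : Carrier 𝔽[x]) →
    IsLimit n (det 𝕂[x] (affinePencil 𝕂 A₀ A)) f →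
      (Σ[ B₀ ∈ Matrix (Carrier 𝔽) (n + r) (n + r) ]
       Σ[ B ∈ Vector (Matrix (Carrier 𝔽) (n + r) (n + r)) n ]
         f ≈ det 𝔽[x] (affinePencil 𝔽 B₀ B)
         × (∀ i → HasRank 𝔽 (B i) 1))
      ×
      ((∀ i j → RawRing._≈_ 𝕂 (A₀ i j) (RawRing.0# 𝕂)) →
       Σ[ B ∈ Vector (Matrix (Carrier 𝔽) r r) n ]
         f ≈ det 𝔽[x] (linearPencil 𝔽 B)
         × (∀ i → HasRankAtMost 𝔽 (B i) 1))
theorem1 ℝ s = LimitsOfPencils.limit-of-pencils (scalars ℝ s)
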